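{- Let $k\ge 2$. There is $N$ such that for all $n\ge N$ the following holds: the only edges $e\subseteq V_n$ of $\Delta^{2k-1}_n$ whose links $\mathrm{lk}(e,\Delta^{2k-1}_n)$ are cs-$(k-1)$-neighborly (with respect to $V_n\setminus(e\cup -e)$) are $e=\pm\{1,2\}$ and $e=\pm\{n-1,n\}$. Furthermore, the links of these four edges are centrally symmetric (closed under $\sigma\mapsto-\sigma$).
   Context: Simplicial complexes are finite abstract simplicial complexes. For a finite set $A$, $\overline{A}$ is the simplex of all subsets of $A$. $V_n=\{\pm1,\dots,\pm n\}$. For a set $\sigma$ of integers, $-\sigma=\{ -v:v\in\sigma\}$; for a complex $\Gamma$, $-\Gamma=\{ -\sigma:\sigma\in\Gamma\}$. The join is $\Gamma*\Gamma'=\{\sigma\cup\tau:\sigma\in\Gamma,\tau\in\Gamma'\}$ (disjoint vertex sets); $\Gamma*v:=\Gamma*\overline{\{v\}}$. A path $(v_1,\dots,v_m)$ is the 1-dimensional complex with edges $\{v_j,v_{j+1}\}$ (a cycle if $v_m=v_1$). $\partial C^*_m$ is the complex of all subsets of $V_m$ containing no pair $\{j,-j\}$. For a pure complex $\Delta$ and pure full-dimensional subcomplex $\Gamma$, $\Delta\setminus\Gamma$ is the subcomplex generated by the facets of $\Delta$ not in $\Gamma$. $\partial B$ is the boundary complex of a combinatorial ball $B$; $\mathrm{lk}(\tau,\Delta)=\{\sigma\in\Delta:\sigma\cap\tau=\emptyset,\ \sigma\cup\tau\in\Delta\}$. The complexes $\Delta^d_n$ ($d\ge1$, $n\ge d+1$)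 and $B^{d,i}_n$ are defined recursively: $\Delta^1_n$ is the cycle $(1,2,\dots,n,-1,\dots,-n,1)$; $\Delta^d_{d+1}=\partial C^*_{d+1}$; $B^{d,j}_n=\emptyset$ for $j<0$; $B^{1,0}_n=\overline{\{ -1,n\}}$; for $k\ge1$, $n\ge2k$: $B^{2k-1,k}_n=\Delta^{2k-1}_n\setminus B^{2k-1,k-1}_n$; for $d\ge2$, $n\ge d+1$, $i\le\lfloor d/2\rfloor$: $B^{d,i}_n=(B^{d-1,i}_{n-1}*n)\cup((-B^{d-1,i-1}_{n-1})*(-n))$; $\Delta^d_{n+1}$ is obtained from $\Delta^d_n$ by replacing $B=B^{d,\lceil d/2\rceil-1}_n$ with $\partial B*(n+1)$ and $-B$ with $\partial(-B)*(-n-1)$. (These are known to be well defined; $\Delta^d_n$ is a combinatorial $d$-sphere on $V_n$ invariant under $v\mapsto-v$.) A complex is cs-$i$-neighborly with respect to a vertex set $V=-V$ if every subset of $V$ of size at most $i$ containing no pair $\{v,-v\}$ is a face. -}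

module Defs where

open import Data.Bool using (Bool; true; false; if_then_else_; not; _∧_)
open import Data.Nat as ℕ using (ℕ; zero; suc; _∸_; _+_; _≤ᵇ_; _≡ᵇ_; ⌊_/2⌋; ⌈_/2⌉)
open import Data.Integer as ℤ using (ℤ; +_; -_; ∣_∣)
open import Data.List using (List; []; _∷_; _++_; map; concatMap; length; applyUpTo)
open import Data.List.Membership.Propositional using (_∈_; _∉_)
open import Data.List.Relation.Unary.All using (All)
open import Data.List.Relation.Unary.Any using (Any)
open import Data.Product using (_×_)
open import Data.Sum using (_⊎_)
open import Relation.Nullary using (¬_)
open import Relation.Nullary.Decidable using (⌊_⌋)
open import Relation.Binary.PropositionalEquality using (_≡_; _≢_)

-- Faces are finite sets of integer vertices, represented by lists
-- (read as sets).  A pure complex is represented by the list of its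
-- facets; its faces are all subsets of facets.

Face : Set
Face = List ℤ

Cx : Set
Cx = List Face

anyᵇ : {A : Set} → (A → Bool) → List A → Bool
anyᵇ p []       = false
anyᵇ p (x ∷ xs) = if p x then true else anyᵇ p xs

allᵇ : {A : Set} → (A → Bool) → List A → Bool
allᵇ p []       = true
allᵇ p (x ∷ xs) = p x ∧ allᵇ p xs

keep : {A : Set} → (A → Bool) → List A → List A
keep p []       = []
keep p (x ∷ xs) = if p x then x ∷ keep p xs else keep p xs

memᵇ : ℤ → Face → Bool
memᵇ v σ = anyᵇ (λ w → ⌊ v ℤ.≟ w ⌋) σ

subᵇ : Face → Face → Bool
subᵇ σ τ = allᵇ (λ v → memᵇ v τ) σ

eqᵇ : Face → Face → Bool
eqᵇ σ τ = subᵇ σ τ ∧ subᵇ τ σ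

negF : Face → Face
negF σ = map -_ σ

negC : Cx → Cx
negC Γ = map negF Γ

joinV : Cx → ℤ → Cx
joinV Γ v = map (v ∷_) Γ

minusC : Cx → Cx → Cx
minusC Δ Γ = keep (λ F → not (anyᵇ (eqᵇ F) Γ)) Δ

deletions : Face → List Face
deletions []       = []
deletions (x ∷ xs) = xs ∷ map (x ∷_) (deletions xs)

-- boundary of a combinatorial ball B (pure, given by its facets):
-- generated by the codimension-one faces lying in exactly one facet
bd : Cx → Cx
bd Γ = keep (λ r → length (keep (subᵇ r) Γ) ≡ᵇ 1) (concatMap deletions Γ)

replace : Cx → Cx → ℤ → Cx
replace Δ B v =
  minusC Δ (B ++ negC B) ++ joinV (bd B) v ++ joinV (bd (negC B)) (- v)

pathEdges : List ℤ → Cx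
pathEdges (x ∷ y ∷ r) = (x ∷ y ∷ []) ∷ pathEdges (y ∷ r)
pathEdges _           = []

cycleC : ℕ → Cx
cycleC n = pathEdges (applyUpTo (λ i → + suc i) n ++ applyUpTo (λ i → - (+ suc i)) n ++ (+ 1 ∷ []))

crossC : ℕ → Cx
crossC zero    = [] ∷ []
crossC (suc m) = map (+ suc m ∷_) (crossC m) ++ map (- (+ suc m) ∷_) (crossC m)

-- The families Δ^d_n and B^{d,i}_n, defined by recursion on d.
-- (Values outside the ranges n ≥ d+1, 0 ≤ i ≤ ⌈d/2⌉ are junk and
-- never used by the recursion on the defined range.)

record Level : Set where
  field
    Δl : ℕ → Cx
    Bl : ℕ → ℕ → Cx

open Level

Bpred : Level → ℕ → ℕ → Cx
Bpred L zero    n = []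
Bpred L (suc j) n = Bl L j n

B1 : ℕ → ℕ → Cx
B1 zero          n = ((- (+ 1)) ∷ + n ∷ []) ∷ []
B1 (suc zero)    n = minusC (cycleC n) (B1 zero n)
B1 (suc (suc _)) n = []

step : ℕ → Level → Level
step d P = record { Δl = Δd ; Bl = Bd }
  where
  Bj : ℕ → ℕ → Cx
  Bj i zero    = []
  Bj i (suc m) = joinV (Bl P i m) (+ suc m) ++ joinV (negC (Bpred P i m)) (- (+ suc m))
  c : ℕ
  c = ⌈ d /2⌉ ∸ 1
  -- Δ' m = Δ^d_{d+1+m}
  Δ' : ℕ → Cx
  Δ' zero    = crossC (suc d)
  Δ' (suc m) = replace (Δ' m) (Bj c (suc d + m)) (+ suc (suc d + m))
  Δd : ℕ → Cx
  Δd n = Δ' (n ∸ suc d)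
  Bd : ℕ → ℕ → Cx
  Bd i n = if i ≤ᵇ ⌊ d /2⌋ then Bj i n
           else (if i ≡ᵇ ⌈ d /2⌉ then minusC (Δd n) (Bj (i ∸ 1) n) else [])

level : ℕ → Level
level zero          = record { Δl = λ _ → [] ; Bl = λ _ _ → [] }
level (suc zero)    = record { Δl = cycleC ; Bl = B1 }
level (suc (suc e)) = step (suc (suc e)) (level (suc e))

Δ : ℕ → ℕ → Cx
Δ d n = Δl (level d) n

B : ℕ → ℕ → ℕ → Cx
B d i n = Bl (level d) i n

_⊆ᶠ_ : Face → Face → Set
σ ⊆ᶠ τ = All (_∈ τ) σ

_∈ᶜ_ : Face → Cx → Set
σ ∈ᶜ Γ = Any (σ ⊆ᶠ_) Γ

InLk : ℤ → ℤ → Cx → Face → Set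
InLk a b Γ σ = (a ∉ σ) × (b ∉ σ) × ((a ∷ b ∷ σ) ∈ᶜ Γ)

InV : ℕ → ℤ → Set
InV n v = (1 ℕ.≤ ∣ v ∣) × (∣ v ∣ ℕ.≤ n)

InVMinus : ℕ → ℤ → ℤ → ℤ → Set
InVMinus n a b v = InV n v × (v ≢ a) × (v ≢ b) × (- v ≢ a) × (- v ≢ b)

CsNeighborly : ℕ → (ℤ → Set) → (Face → Set) → Set
CsNeighborly i V F =
  (S : Face) → length S ℕ.≤ i → All V S → ((v : ℤ) → v ∈ S → - v ∉ S) → F S

CentrallySymmetric : (Face → Set) → Set
CentrallySymmetric F = (σ : Face) → F σ → F (negF σ)

SameEdge : ℤ → ℤ → ℤ → ℤ → Set
SameEdge a b c d = ((a ≡ c) × (b ≡ d)) ⊎ ((a ≡ d) × (b ≡ c))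

SpecialEdge : ℕ → ℤ → ℤ → Set
SpecialEdge n a b =
  SameEdge a b (+ 1) (+ 2) ⊎ SameEdge a b (- (+ 1)) (- (+ 2)) ⊎
  SameEdge a b (+ (n ∸ 1)) (+ n) ⊎ SameEdge a b (- (+ (n ∸ 1))) (- (+ n))

{-# OPTIONS --safe #-}
module Submission where

-- A complex is described by the indicator function of its facets, a chain with coefficients
-- in F₂.  Splitting a chain on V_n into the parts without ±n, with n and with −n, the
-- constructions become linear: B^{d,i}_n = (0, B^{d-1,i}_{n-1}, −B^{d-1,i-1}_{n-1}) and
-- Δ_{n+1} = (Δ_n + B + (−B), ∂B, ∂(−B)).  Hence lk({n−1, n}, Δ^d_n) = ∂B^{d-1,⌈d/2⌉-1}_{n-2}
-- = Δ^{d-2}_{n-2}, while lk({1, 2}) and lk({−1, −2}) both satisfy the recursion of the whole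
-- family, started from the complex {∅}.  These spheres are neighborly because the balls
-- are, and because small faces of a ball lie in its boundary.  For any other edge {M, v} a
-- missing set is found by restricting to V_M or V_{M+1}, where the link is contained in balls
-- of dimension d − 2 or lower, or else by adding the top vertex n to a missing set of the
-- same edge in Δ^{d-2}_{n-3}.  The list complexes of the definitions agree with the chains
-- since every ridge lies in at most two facets, so that the mod 2 boundary is the boundary.

open import Data.Bool using (Bool; true; false; _xor_; not; _∧_; if_then_else_; T; _∨_)
open import Data.Bool.Properties using (xor-same; xor-identityʳ; xor-assoc; xor-comm; not-involutive)
open import Data.Nat using (ℕ; zero; suc; _+_; _*_; _∸_; _≤_; _<_; z≤n; s≤s; _≤ᵇ_; _≡ᵇ_; ⌊_/2⌋; ⌈_/2⌉; _⊔_)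
open import Data.Nat.Properties
open import Data.List using (List; []; _∷_; _++_; map; length; replicate; concatMap; applyUpTo; foldr)
open import Data.List.Properties using (length-map; length-++; map-∘; map-id; map-cong)
open import Data.Product using (_×_; _,_; proj₁; proj₂; ∃-syntax)
open import Data.Sum using (_⊎_; inj₁; inj₂)
open import Data.Empty using (⊥; ⊥-elim)
open import Function using (_∘_)
open import Relation.Binary.PropositionalEquality
open import Algebra.Properties.CommutativeSemigroup +-commutativeSemigroup using () renaming (interchange to +-interchange)
open import Defs
open import Data.Integer using (ℤ; +_; -_; -[1+_]; ∣_∣)
open import Data.Integer.Properties using (∣-i∣≡∣i∣; neg-involutive; +-injective; -[1+-injective)
import Data.Integer as ℤ
open import Data.List.Membership.Propositional using (_∈_; _∉_)
open import Data.List.Relation.Unary.Any using (here; there)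
open import Data.List.Relation.Unary.All as All using (All; []; _∷_)
import Data.List.Relation.Unary.All.Properties as All
open import Data.List.Relation.Binary.Pointwise as PW using (Pointwise; []; _∷_)
open import Data.List.Relation.Binary.Permutation.Propositional as Perm using (_↭_; ↭-sym; ↭-trans; ↭-refl)
open import Data.List.Relation.Binary.Permutation.Propositional.Properties as Perm using (∈-resp-↭)
open import Relation.Nullary using (¬_; yes; no)
open import Data.List.Membership.Propositional.Properties using (∈-map⁺)
open import Function.Bundles using (_⇔_; mk⇔)
open import Relation.Binary.Definitions using (tri<; tri≈; tri>)

-- A code lists the statuses (absent, +, −) of the vertices ±n, …, ±1, the largest first; the
-- number n of a vertex is the length of the code starting at its status.

-- No topology of balls enters. Over F₂ the boundary is additive and ∂∂ = 0, so ∂(Δ + B) = ∂B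
-- already says that a ball and its complement in a sphere without boundary have the same boundary.
-- The price is to show that sums never cancel by accident: B and -B lie in Δ and share no facet,
-- which needs inclusions between balls of neighboring dimensions and indices. The complementary
-- ball ties neighborliness to stackedness (small faces lie in the boundary): for the complement,
-- each of the two properties is derived from both properties of B. Hence one induction proves them
-- together. On the negative side one set has to refute the link for all large n. A face of Δ_{n+1}
-- with vertices in V_n is a face of Δ_n, so a non-face remains one as n grows and a single n
-- suffices for each edge. The stubborn edge is {M - 1, M}: it is special as long as M is the top
-- vertex, so Δ_M offers no witness and Δ_{M+1} has to be used. The induction on the dimension steps
-- from Δ^{d-2}_{n-3} to Δ^d_n, since the link of n, seen on V_{n-3}, lies in that smaller sphere.

data Status : Set where
  ○ ⊕ ⊖ : Status

Code : Set
Code = List Status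

Chain : Set
Chain = Code → Bool

flipStatus : Status → Status
flipStatus ○ = ○
flipStatus ⊕ = ⊖
flipStatus ⊖ = ⊕

flip : Code → Code
flip = map flipStatus

flipStatus-invol : ∀ s → flipStatus (flipStatus s) ≡ s
flipStatus-invol ○ = refl
flipStatus-invol ⊕ = refl
flipStatus-invol ⊖ = refl

flip-invol : ∀ c → flip (flip c) ≡ c
flip-invol []      = refl
flip-invol (s ∷ c) = cong₂ _∷_ (flipStatus-invol s) (flip-invol c)

weight : Code → ℕ
weight []      = 0
weight (○ ∷ c) = weight c
weight (⊕ ∷ c) = suc (weight c)
weight (⊖ ∷ c) = suc (weight c)

weight-flip : ∀ c → weight (flip c) ≡ weight c
weight-flip []      = refl
weight-flip (○ ∷ c) = weight-flip c
weight-flip (⊕ ∷ c) = cong suc (weight-flip c)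
weight-flip (⊖ ∷ c) = cong suc (weight-flip c)

length-flip : ∀ c → length (flip c) ≡ length c
length-flip = length-map flipStatus

data _⊑_ : Code → Code → Set where
  []   : [] ⊑ []
  skip : ∀ s {c d} → c ⊑ d → (○ ∷ c) ⊑ (s ∷ d)
  same : ∀ s {c d} → c ⊑ d → (s ∷ c) ⊑ (s ∷ d)

⊑-flip : ∀ {c d} → c ⊑ d → flip c ⊑ flip d
⊑-flip []         = []
⊑-flip (skip s x) = skip (flipStatus s) (⊑-flip x)
⊑-flip (same s x) = same (flipStatus s) (⊑-flip x)

-- Chains modulo 2 and their boundary

𝟎 : Chain
𝟎 _ = false

infixl 6 _⊞_
_⊞_ : Chain → Chain → Chain
(f ⊞ g) c = f c xor g c

neg : Chain → Chain
neg f c = f (flip c)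

-- The parity of the number of facets that arise from a code by filling one ○. Chains are not graded
-- by size, so one map serves in every dimension.
∂ : Chain → Chain
∂ f []      = false
∂ f (○ ∷ c) = ∂ (f ∘ (○ ∷_)) c xor (f (⊕ ∷ c) xor f (⊖ ∷ c))
∂ f (⊕ ∷ c) = ∂ (f ∘ (⊕ ∷_)) c
∂ f (⊖ ∷ c) = ∂ (f ∘ (⊖ ∷_)) c

∂-𝟎 : ∂ 𝟎 ≗ 𝟎
∂-𝟎 []      = refl
∂-𝟎 (○ ∷ c) = cong (_xor false) (∂-𝟎 c)
∂-𝟎 (⊕ ∷ c) = ∂-𝟎 c
∂-𝟎 (⊖ ∷ c) = ∂-𝟎 c

xor-interchange : ∀ a b c d → (a xor b) xor (c xor d) ≡ (a xor c) xor (b xor d)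
xor-interchange false b false d     = refl
xor-interchange false false true d  = refl
xor-interchange false true true d   = refl
xor-interchange true false false d  = refl
xor-interchange true true false d   = sym (not-involutive d)
xor-interchange true false true d   = not-involutive d
xor-interchange true true true d    = refl

∂-⊞ : ∀ f g → ∂ (f ⊞ g) ≗ ∂ f ⊞ ∂ g
∂-⊞ f g []      = refl
∂-⊞ f g (○ ∷ c) = trans
  (cong₂ _xor_ (∂-⊞ (f ∘ (○ ∷_)) (g ∘ (○ ∷_)) c)
    (xor-interchange (f (⊕ ∷ c)) (g (⊕ ∷ c)) (f (⊖ ∷ c)) (g (⊖ ∷ c))))
  (xor-interchange (∂ (f ∘ (○ ∷_)) c) _ _ _)
∂-⊞ f g (⊕ ∷ c) = ∂-⊞ (f ∘ (⊕ ∷_)) (g ∘ (⊕ ∷_)) c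
∂-⊞ f g (⊖ ∷ c) = ∂-⊞ (f ∘ (⊖ ∷_)) (g ∘ (⊖ ∷_)) c

∂-neg : ∀ f → ∂ (neg f) ≗ neg (∂ f)
∂-neg f []      = refl
∂-neg f (○ ∷ c) = cong₂ _xor_ (∂-neg (f ∘ (○ ∷_)) c) (xor-comm (f (⊖ ∷ flip c)) _)
∂-neg f (⊕ ∷ c) = ∂-neg (f ∘ (⊖ ∷_)) c
∂-neg f (⊖ ∷ c) = ∂-neg (f ∘ (⊕ ∷_)) c

∂∂ : ∀ f → ∂ (∂ f) ≗ 𝟎
∂∂ f []      = refl
∂∂ f (○ ∷ c) = trans (cong₂ _xor_ (trans (∂-⊞ (∂ (f ∘ (○ ∷_))) (f ∘ (⊕ ∷_) ⊞ f ∘ (⊖ ∷_)) c)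
    (cong₂ _xor_ (∂∂ (f ∘ (○ ∷_)) c) (∂-⊞ (f ∘ (⊕ ∷_)) (f ∘ (⊖ ∷_)) c))) refl)
  (xor-same (∂ (f ∘ (⊕ ∷_)) c xor ∂ (f ∘ (⊖ ∷_)) c))
∂∂ f (⊕ ∷ c) = ∂∂ (f ∘ (⊕ ∷_)) c
∂∂ f (⊖ ∷ c) = ∂∂ (f ∘ (⊖ ∷_)) c

-- The balls and spheres as chains

-- The ball B^{d,i}_n from B^{d-1,i}_{n-1} and B^{d-1,i-1}_{n-1}.
half : Chain → Chain → Chain
half f g []      = false
half f g (○ ∷ c) = false
half f g (⊕ ∷ c) = f c
half f g (⊖ ∷ c) = g (flip c)

-- Δ_{n+1} from D = Δ_n and the ball B: modulo 2, removing ±B is adding it.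
ext : Chain → Chain → Chain
ext D B []      = false
ext D B (○ ∷ c) = D c xor (B c xor B (flip c))
ext D B (⊕ ∷ c) = ∂ B c
ext D B (⊖ ∷ c) = ∂ B (flip c)

full : ℕ → Chain
full zero    []      = true
full zero    (_ ∷ _) = false
full (suc n) []      = false
full (suc n) (○ ∷ c) = false
full (suc n) (⊕ ∷ c) = full n c
full (suc n) (⊖ ∷ c) = full n c

sphere : ℕ → (ℕ → Chain) → ℕ → Chain
sphere w B zero    = full w
sphere w B (suc m) = ext (sphere w B m) (B m)

Seq : Set
Seq = ℕ → ℕ → Chain

halves : Seq → Seq
halves g zero    m = half (g zero m) 𝟎
halves g (suc j) m = half (g (suc j) m) (g j m)

Ranged : ℕ → (ℕ → Set) → Set
Ranged J P = ∀ j → j ≤ J → P j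

if-≤ : ∀ {A : Set} → ℕ → ℕ → A → A → A
if-≤ zero    k       x y = x
if-≤ (suc j) zero    x y = y
if-≤ (suc j) (suc k) x y = if-≤ j k x y

if-≤-yes : ∀ {A : Set} {j k} {x y : A} → j ≤ k → if-≤ j k x y ≡ x
if-≤-yes z≤n     = refl
if-≤-yes (s≤s h) = if-≤-yes h

if-≤-no : ∀ {A : Set} {j k} {x y : A} → k < j → if-≤ j k x y ≡ y
if-≤-no {j = suc j} {zero}  (s≤s h) = refl
if-≤-no {j = suc j} {suc k} (s≤s h) = if-≤-no h

module Family (w : ℕ) (b : ℕ → Chain) where

  width : ℕ → ℕ
  width zero    = w
  width (suc k) = suc (suc (width k))

  -- With d = 2 k + 1 and n = d + 1 + m: Δc k m is Δ^d_n, balls k j m is B^{d,j-1}_n, and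
  -- pre is balls without the complementary ball B^{d,k+1}_n.  The index m is constant along
  -- the recursion that defines the balls.
  mutual
    pre : ℕ → Seq
    pre zero    zero          m = 𝟎
    pre zero    (suc zero)    m = b m
    pre zero    (suc (suc j)) m = 𝟎
    pre (suc k) j             m = halves (halves (balls k)) j m

    Δc : ℕ → ℕ → Chain
    Δc k = sphere (width k) (pre k (suc k))

    balls : ℕ → Seq
    balls k j = if-≤ j (suc k) (pre k j) (λ m → Δc k m ⊞ pre k (suc k) m)

  balls-low : ∀ k j m → j ≤ suc k → balls k j m ≡ pre k j m
  balls-low k j m h = cong-app (if-≤-yes h) m

  balls-top : ∀ k m → balls k (suc (suc k)) m ≡ Δc k m ⊞ pre k (suc k) m
  balls-top k m = cong-app (if-≤-no {j = suc (suc k)} {suc k} ≤-refl) m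

-- Neighborliness and stackedness

Cl : Chain → Code → Set
Cl f σ = ∃[ F ] (f F ≡ true × σ ⊑ F)

Cl-resp : ∀ {f g} → (∀ c → f c ≡ true → g c ≡ true) → ∀ {σ} → Cl f σ → Cl g σ
Cl-resp h (F , fF , x) = F , h F fF , x

Cl-≗ : ∀ {f g} → f ≗ g → ∀ {σ} → Cl f σ → Cl g σ
Cl-≗ h = Cl-resp (λ c e → trans (sym (h c)) e)

Cl-neg : ∀ {f σ} → Cl f (flip σ) → Cl (neg f) σ
Cl-neg {f} {σ} (F , e , x) = flip F , trans (cong f (flip-invol F)) e ,
  subst (_⊑ flip F) (flip-invol σ) (⊑-flip x)

Cl-unneg : ∀ {f σ} → Cl (neg f) σ → Cl f (flip σ)
Cl-unneg (F , e , x) = flip F , e , ⊑-flip x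

Cl-○ : ∀ {f σ} s → Cl (f ∘ (s ∷_)) σ → Cl f (○ ∷ σ)
Cl-○ s (F , e , x) = s ∷ F , e , skip s x

Cl-∷ : ∀ {f σ} s → Cl (f ∘ (s ∷_)) σ → Cl f (s ∷ σ)
Cl-∷ s (F , e , x) = s ∷ F , e , same s x

-- A facet of f survives in the sum unless it cancels, and it cancels only against a facet of g.
Cl-⊞ : ∀ f g {σ} → Cl f σ → Cl (f ⊞ g) σ ⊎ Cl g σ
Cl-⊞ f g (F , e , x) with g F in eq
... | false = inj₁ (F , cong₂ _xor_ e eq , x)
... | true  = inj₂ (F , eq , x)

-- With j = i + 1 and q = 1 this is cs-i-neighborliness of B^{d,i}. The value q = 0 asks for one
-- vertex less, which is what the family of links satisfies.
NeighborlyAt : ℕ → ℕ → Seq → ℕ → Set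
NeighborlyAt q len g j = ∀ m σ → length σ ≡ len + m → 2 + weight σ ≤ j + q → Cl (g j m) σ

-- For e = d + 1 and j = i + 1 this is i-stackedness of B^{d,i}: every interior face has more than d
-- - i vertices.
StackedAt : ℕ → ℕ → Seq → ℕ → Set
StackedAt e len g j = ∀ m σ → length σ ≡ len + m → Cl (g j m) σ → weight σ + j ≤ e → Cl (∂ (g j m)) σ

module _ {q len : ℕ} {g : Seq} (q≤1 : q ≤ 1) where
  -- The cone from -n has a base of index one lower, but -n itself uses up one vertex of the set.
  -- The empty ball at j = 0 satisfies the claim vacuously because q ≤ 1.
  Nbly-half : ∀ {J} → Ranged J (NeighborlyAt q len g) → Ranged J (NeighborlyAt q (suc len) (halves g))
  Nbly-half H zero    _ m σ l h = ⊥-elim (<⇒≱ (≤-trans (s≤s (s≤s z≤n)) h) q≤1)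
  Nbly-half H (suc j) r m (○ ∷ σ) l h = Cl-○ ⊕ (H (suc j) r m σ (suc-injective l) h)
  Nbly-half H (suc j) r m (⊕ ∷ σ) l h =
    Cl-∷ ⊕ (H (suc j) r m σ (suc-injective l) (≤-trans (n≤1+n _) h))
  Nbly-half H (suc j) r m (⊖ ∷ σ) l (s≤s h) = Cl-∷ ⊖ (Cl-neg
    (H j (≤-trans (n≤1+n j) r) m (flip σ) (trans (length-flip σ) (suc-injective l))
      (subst (λ x → 2 + x ≤ j + q) (sym (weight-flip σ)) h)))

half-0 : ∀ f g σ → ∂ (half f g) (○ ∷ σ) ≡ (f ⊞ neg g) σ
half-0 f g σ = cong₂ _xor_ (∂-𝟎 σ) refl

-- Faces containing ±n inherit the property from the base of their cone. For σ without ±n, the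
-- boundary without ±n is the sum of the two bases. Either σ survives in this sum or it lies in the
-- base of -n; there the index is one lower, so σ lies in the boundary of that base and is covered
-- by a cone from -n.
Stacked-half : ∀ {e len g J} → Ranged J (StackedAt e len g) → Ranged J (StackedAt (suc e) (suc len) (halves g))
Stacked-half {e} {len} {g} H zero r m (○ ∷ σ) l (⊕ ∷ F , fF , skip _ x) h =
  ○ ∷ F , trans (half-0 (g zero m) 𝟎 F) (cong (_xor false) fF) , same ○ x
Stacked-half {e} {len} {g} H zero r m (⊕ ∷ σ) l (⊕ ∷ F , fF , same _ x) (s≤s h) =
  Cl-∷ ⊕ (H zero z≤n m σ (suc-injective l) (F , fF , x) h)
Stacked-half {e} {len} {g} H (suc j) r m (⊕ ∷ σ) l (⊕ ∷ F , fF , same _ x) (s≤s h) =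
  Cl-∷ ⊕ (H (suc j) r m σ (suc-injective l) (F , fF , x) h)
Stacked-half {e} {len} {g} H (suc j) r m (⊖ ∷ σ) l (⊖ ∷ F , fF , same _ x) (s≤s h) =
  Cl-∷ ⊖ (Cl-≗ (λ c → sym (∂-neg (g j m) c))
    (Cl-neg (H j (≤-trans (n≤1+n j) r) m (flip σ) (trans (length-flip σ) (suc-injective l)) (flip F , fF , ⊑-flip x)
      (subst (λ x → x + j ≤ e) (sym (weight-flip σ))
        (≤-trans (+-monoʳ-≤ (weight σ) (n≤1+n j)) h)))))
Stacked-half {e} {len} {g} H (suc j) r m (○ ∷ σ) l (⊕ ∷ F , fF , skip _ x) h
  with Cl-⊞ (g (suc j) m) (neg (g j m)) (F , fF , x)
... | inj₁ (F′ , e′ , x′) = ○ ∷ F′ , trans (half-0 (g (suc j) m) (g j m) F′) e′ , same ○ x′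
... | inj₂ y = Cl-○ ⊖ (Cl-≗ (λ c → sym (∂-neg (g j m) c))
    (Cl-neg (H j (≤-trans (n≤1+n j) r) m (flip σ) (trans (length-flip σ) (suc-injective l)) (Cl-unneg y)
      (subst (λ x → x + j ≤ e) (sym (weight-flip σ))
        (≤-pred (subst (_≤ suc e) (+-suc (weight σ) j) h))))))
Stacked-half {e} {len} {g} H (suc j) r m (○ ∷ σ) l (⊖ ∷ F , fF , skip _ x) h =
  Cl-○ ⊖ (Cl-≗ (λ c → sym (∂-neg (g j m) c))
    (Cl-neg (H j (≤-trans (n≤1+n j) r) m (flip σ) (trans (length-flip σ) (suc-injective l)) (flip F , fF , ⊑-flip x)
      (subst (λ x → x + j ≤ e) (sym (weight-flip σ))
        (≤-pred (subst (_≤ suc e) (+-suc (weight σ) j) h))))))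

∂-full : ∀ n → ∂ (full n) ≗ 𝟎
∂-full zero    []      = refl
∂-full zero    (○ ∷ c) = cong (_xor false) (∂-𝟎 c)
∂-full zero    (⊕ ∷ c) = ∂-𝟎 c
∂-full zero    (⊖ ∷ c) = ∂-𝟎 c
∂-full (suc n) []      = refl
∂-full (suc n) (○ ∷ c) = cong₂ _xor_ (∂-𝟎 c) (xor-same (full n c))
∂-full (suc n) (⊕ ∷ c) = ∂-full n c
∂-full (suc n) (⊖ ∷ c) = ∂-full n c

-- On V_n, adding ±B to D creates the boundary ∂B + ∂(-B), and the bases of the two cones cancel it.
-- At the new vertices the boundary is ∂∂ of ±B.
∂-ext : ∀ D B → ∂ D ≗ 𝟎 → ∂ (ext D B) ≗ 𝟎
∂-ext D B h []      = refl
∂-ext D B h (○ ∷ c) = trans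
  (cong₂ _xor_ (trans (∂-⊞ D (B ⊞ neg B) c) (cong₂ _xor_ (h c)
    (trans (∂-⊞ B (neg B) c) (cong (∂ B c xor_) (∂-neg B c))))) refl)
  (xor-same (∂ B c xor ∂ B (flip c)))
∂-ext D B h (⊕ ∷ c) = ∂∂ B c
∂-ext D B h (⊖ ∷ c) = trans (∂-neg (∂ B) c) (∂∂ B (flip c))

∂-sphere : ∀ w B m → ∂ (sphere w B m) ≗ 𝟎
∂-sphere w B zero    = ∂-full w
∂-sphere w B (suc m) = ∂-ext (sphere w B m) (B m) (∂-sphere w B m)

full-flip : ∀ n σ → full n (flip σ) ≡ full n σ
full-flip zero    []      = refl
full-flip zero    (s ∷ c) = refl
full-flip (suc n) []      = refl
full-flip (suc n) (○ ∷ c) = refl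
full-flip (suc n) (⊕ ∷ c) = full-flip n c
full-flip (suc n) (⊖ ∷ c) = full-flip n c

sphere-flip : ∀ w B m σ → sphere w B m (flip σ) ≡ sphere w B m σ
sphere-flip w B zero    σ       = full-flip w σ
sphere-flip w B (suc m) []      = refl
sphere-flip w B (suc m) (○ ∷ σ) = cong₂ _xor_ (sphere-flip w B m σ)
  (trans (cong (λ x → B m (flip σ) xor B m x) (flip-invol σ)) (xor-comm (B m (flip σ)) _))
sphere-flip w B (suc m) (⊕ ∷ σ) = cong (∂ (B m)) (flip-invol σ)
sphere-flip w B (suc m) (⊖ ∷ σ) = refl

full-Cl : ∀ n σ → length σ ≡ n → Cl (full n) σ
full-Cl zero    []      _ = [] , refl , []
full-Cl (suc n) (○ ∷ σ) h = Cl-○ ⊕ (full-Cl n σ (suc-injective h))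
full-Cl (suc n) (⊕ ∷ σ) h = Cl-∷ ⊕ (full-Cl n σ (suc-injective h))
full-Cl (suc n) (⊖ ∷ σ) h = Cl-∷ ⊖ (full-Cl n σ (suc-injective h))

Cl-either : ∀ f g {σ} → Cl (f ⊞ g) σ → Cl f σ ⊎ Cl g σ
Cl-either f g (F , e , x) with f F in eq
... | true  = inj₁ (F , eq , x)
... | false = inj₂ (F , e , x)

⊑-refl : ∀ c → c ⊑ c
⊑-refl []      = []
⊑-refl (s ∷ c) = same s (⊑-refl c)

⊑-trans : ∀ {c d e} → c ⊑ d → d ⊑ e → c ⊑ e
⊑-trans []         y          = y
⊑-trans (skip s x) (skip t y) = skip t (⊑-trans x y)
⊑-trans (skip s x) (same _ y) = skip s (⊑-trans x y)
⊑-trans (same _ x) (skip t y) = skip t (⊑-trans x y)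
⊑-trans (same s x) (same _ y) = same s (⊑-trans x y)

∂-coface : ∀ f R → ∂ f R ≡ true → Cl f R
∂-coface f (⊕ ∷ R) e = Cl-∷ ⊕ (∂-coface (f ∘ (⊕ ∷_)) R e)
∂-coface f (⊖ ∷ R) e = Cl-∷ ⊖ (∂-coface (f ∘ (⊖ ∷_)) R e)
∂-coface f (○ ∷ R) e with ∂ (f ∘ (○ ∷_)) R in eq | f (⊕ ∷ R) in eq₁ | f (⊖ ∷ R) in eq₂
... | true  | _     | _    = Cl-∷ ○ (∂-coface (f ∘ (○ ∷_)) R eq)
... | false | true  | _    = Cl-○ ⊕ (R , eq₁ , ⊑-refl R)
... | false | false | true = Cl-○ ⊖ (R , eq₂ , ⊑-refl R)

Cl-∂ : ∀ {f σ} → Cl (∂ f) σ → Cl f σ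
Cl-∂ {f} (R , e , x) with ∂-coface f R e
... | F , fF , y = F , fF , ⊑-trans x y

-- The hypothesis on B says that the faces of B with at most s vertices lie in its
-- boundary, so replacing B by a cone over the boundary keeps all of them.
sphere-Nbly : ∀ w B s →
  (∀ m σ → length σ ≡ w + m → suc (weight σ) ≤ s → Cl (B m) σ) →
  (∀ m σ → length σ ≡ w + m → weight σ ≤ s → Cl (B m) σ → Cl (∂ (B m)) σ) →
  ∀ m σ → length σ ≡ w + m → weight σ ≤ s → Cl (sphere w B m) σ
sphere-Nbly w B s N S zero σ l h = full-Cl w σ (trans l (+-identityʳ w))
sphere-Nbly w B s N S (suc m) [] l h = ⊥-elim (0≢1+n (trans l (+-suc w m)))
sphere-Nbly w B s N S (suc m) (t ∷ σ) l h with suc-injective (trans l (+-suc w m))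
sphere-Nbly w B s N S (suc m) (⊕ ∷ σ) l h | l′ =
  Cl-∷ ⊕ (S m σ l′ (≤-trans (n≤1+n _) h) (N m σ l′ h))
sphere-Nbly w B s N S (suc m) (⊖ ∷ σ) l h | l′ =
  Cl-∷ ⊖ (Cl-neg {f = ∂ (B m)} (S m (flip σ) l″ (≤-trans (n≤1+n _) h′) (N m (flip σ) l″ h′)))
  where
  l″ = trans (length-flip σ) l′
  h′ = subst (λ x → suc x ≤ s) (sym (weight-flip σ)) h
sphere-Nbly w B s N S (suc m) (○ ∷ σ) l h | l′
  with Cl-⊞ (sphere w B m) (B m ⊞ neg (B m)) (sphere-Nbly w B s N S m σ l′ h)
... | inj₁ x = Cl-○ ○ x
... | inj₂ x with Cl-either (B m) (neg (B m)) x
... | inj₁ y = Cl-○ ⊕ (S m σ l′ h y)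
... | inj₂ y = Cl-○ ⊖ (Cl-neg {f = ∂ (B m)} (S m (flip σ) (trans (length-flip σ) l′)
      (subst (_≤ s) (sym (weight-flip σ)) h) (Cl-unneg y)))

Ranged-suc : ∀ {J P} → Ranged J P → P (suc J) → Ranged (suc J) P
Ranged-suc H h j j≤ with m≤n⇒m<n∨m≡n j≤
... | inj₁ (s≤s j≤′) = H j j≤′
... | inj₂ refl      = h

module Neighborly (w : ℕ) (b : ℕ → Chain) (q : ℕ) (q≤1 : q ≤ 1) where
  open Family w b

  -- It grows by two because each step of k halves twice. For q = 1 it equals d + 1. `stk-≡` splits
  -- it so that faces with at most k + q vertices of the ball of index j = k + 1 are in its
  -- boundary; this is the amount of neighborliness of Δ.
  stk : ℕ → ℕ
  stk zero    = suc q
  stk (suc k) = suc (suc (stk k))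

  stk-≡ : ∀ k → stk k ≡ k + q + suc k
  stk-≡ zero    = sym (+-comm q 1)
  stk-≡ (suc k) = cong suc (trans (cong suc (stk-≡ k)) (sym (+-suc (k + q) (suc k))))

  balls-∂top : ∀ k m → ∂ (balls k (suc (suc k)) m) ≗ ∂ (pre k (suc k) m)
  balls-∂top k m σ = trans (cong (λ f → ∂ f σ) (balls-top k m))
    (trans (∂-⊞ (Δc k m) (pre k (suc k) m) σ)
      (cong (_xor ∂ (pre k (suc k) m) σ) (∂-sphere (width k) (pre k (suc k)) m σ)))

  module _ (N₁ : NeighborlyAt q w (pre 0) 1) (S₁ : StackedAt (suc q) w (pre 0) 1) where

    Good : ℕ → Set
    Good k = Ranged (suc k) (NeighborlyAt q (width k) (pre k)) ×
             Ranged (suc k) (StackedAt (stk k) (width k) (pre k))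

    Δ-Nbly′ : ∀ k → Good k → ∀ m σ → length σ ≡ width k + m → weight σ ≤ k + q → Cl (Δc k m) σ
    Δ-Nbly′ k (N , S) = sphere-Nbly (width k) (pre k (suc k)) (k + q)
      (λ m σ l h → N (suc k) ≤-refl m σ l (s≤s h))
      (λ m σ l h x → S (suc k) ≤-refl m σ l x
        (≤-trans (+-monoˡ-≤ (suc k) h) (≤-reflexive (sym (stk-≡ k)))))

    -- Only the complement Δ + B is new. A small face of Δ that is missing from it lies in B, so by
    -- stackedness in ∂B, which is also the boundary of the complement. Conversely, a small face of
    -- the complement lies in B by neighborliness of B and hence again in ∂B.
    balls-good : ∀ k → Good k → Ranged (suc (suc k)) (NeighborlyAt q (width k) (balls k)) ×
                 Ranged (suc (suc k)) (StackedAt (stk k) (width k) (balls k))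
    balls-good k G@(N , S) =
      Ranged-suc (λ j h m σ → subst (λ f → length σ ≡ width k + m → 2 + weight σ ≤ j + q → Cl f σ)
        (sym (balls-low k j m h)) (N j h m σ)) Ntop ,
      Ranged-suc (λ j h m σ → subst (λ f → length σ ≡ width k + m → Cl f σ → weight σ + j ≤ stk k → Cl (∂ f) σ)
        (sym (balls-low k j m h)) (S j h m σ)) Stop
      where
      bound : ∀ σ → weight σ ≤ k + q → weight σ + suc k ≤ stk k
      bound σ h = ≤-trans (+-monoˡ-≤ (suc k) h) (≤-reflexive (sym (stk-≡ k)))
      to-top : ∀ m σ → Cl (∂ (pre k (suc k) m)) σ → Cl (∂ (balls k (suc (suc k)) m)) σ
      to-top m σ = Cl-≗ (λ c → sym (balls-∂top k m c))
      Ntop : NeighborlyAt q (width k) (balls k) (suc (suc k))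
      Ntop m σ l (s≤s (s≤s h)) with Cl-⊞ (Δc k m) (pre k (suc k) m) (Δ-Nbly′ k G m σ l h)
      ... | inj₁ x = subst (λ f → Cl f σ) (sym (balls-top k m)) x
      ... | inj₂ x = Cl-∂ (to-top m σ (S (suc k) ≤-refl m σ l x (bound σ h)))
      Stop : StackedAt (stk k) (width k) (balls k) (suc (suc k))
      Stop m σ l x h = to-top m σ (S (suc k) ≤-refl m σ l (N (suc k) ≤-refl m σ l (s≤s h′))
          (≤-trans (+-monoʳ-≤ (weight σ) (n≤1+n (suc k))) h))
        where
        h′ : suc (weight σ) ≤ k + q
        h′ = +-cancelʳ-≤ (suc k) (suc (weight σ)) (k + q)
          (≤-trans (≤-reflexive (sym (+-suc (weight σ) (suc k)))) (≤-trans h (≤-reflexive (stk-≡ k))))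

    good : ∀ k → Good k
    good zero    = Ranged-suc (λ { .0 z≤n m σ l h → ⊥-elim (<⇒≱ (≤-trans (s≤s (s≤s z≤n)) h) q≤1) }) N₁ ,
                   Ranged-suc (λ { .0 z≤n m σ l (F , () , _) }) S₁
    good (suc k) = Nbly-half q≤1 (Nbly-half q≤1 (proj₁ (balls-good k (good k)))) ,
                   Stacked-half (Stacked-half (proj₂ (balls-good k (good k))))

    Δ-Nbly : ∀ k m σ → length σ ≡ width k + m → weight σ ≤ k + q → Cl (Δc k m) σ
    Δ-Nbly k = Δ-Nbly′ k (good k)

-- The link of the edge {n - 1, n}

module Links (w : ℕ) (b : ℕ → Chain) where
  open Family w b
  open Neighborly w b 0 z≤n using (balls-∂top)

  -- The bases of the two cones are Δ + B and -B. Their sum Δ + B + (-B), together with the cones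
  -- over ∂(Δ + B) = ∂B and over ∂(-B), is precisely the recursion that defines the next sphere.
  ∂-half-top : ∀ k m → ∂ (halves (balls k) (suc (suc k)) m) ≗ Δc k (suc m)
  ∂-half-top k m []      = refl
  ∂-half-top k m (○ ∷ σ) = begin
    ∂ (halves (balls k) (suc (suc k)) m) (○ ∷ σ)
      ≡⟨ half-0 (balls k (suc (suc k)) m) (balls k (suc k) m) σ ⟩
    balls k (suc (suc k)) m σ xor balls k (suc k) m (flip σ)
      ≡⟨ cong₂ (λ f g → f σ xor g (flip σ)) (balls-top k m) (balls-low k (suc k) m ≤-refl) ⟩
    (Δc k m σ xor pre k (suc k) m σ) xor pre k (suc k) m (flip σ)
      ≡⟨ xor-assoc (Δc k m σ) _ _ ⟩
    Δc k (suc m) (○ ∷ σ) ∎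
    where open ≡-Reasoning
  ∂-half-top k m (⊕ ∷ σ) = balls-∂top k m σ
  ∂-half-top k m (⊖ ∷ σ) = trans (∂-neg (balls k (suc k) m) σ)
    (cong (λ f → ∂ f (flip σ)) (balls-low k (suc k) m ≤-refl))

  link-top : ∀ k m σ → Δc (suc k) m (⊕ ∷ ⊕ ∷ σ) ≡ Δc k m σ
  link-top k zero    σ = refl
  link-top k (suc m) σ = ∂-half-top k m σ

-- The links of {1, 2} and {−1, −2} are read off the codes ending in ⊕ ⊕ and ⊖ ⊖.  Both
-- obey the recursion of the family, started from the complex {∅} on no vertices.

record Restricts (n : ℕ) (f g : Chain) : Set where
  constructor mk
  field
    at : ∀ σ → length σ ≡ n → (f (σ ++ ⊕ ∷ ⊕ ∷ []) ≡ g σ) × (f (σ ++ ⊖ ∷ ⊖ ∷ []) ≡ g σ)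
open Restricts

×-cong₂ : ∀ (_∙_ : Bool → Bool → Bool) {a b c d e f} → (a ≡ b) × (c ≡ b) → (d ≡ e) × (f ≡ e) →
  ((a ∙ d) ≡ (b ∙ e)) × ((c ∙ f) ≡ (b ∙ e))
×-cong₂ _∙_ (refl , refl) (refl , refl) = refl , refl

flip-++ : ∀ σ τ → flip (σ ++ τ) ≡ flip σ ++ flip τ
flip-++ []      τ = refl
flip-++ (s ∷ σ) τ = cong (flipStatus s ∷_) (flip-++ σ τ)

R-⊞ : ∀ {n f f′ g g′} → Restricts n f f′ → Restricts n g g′ → Restricts n (f ⊞ g) (f′ ⊞ g′)
R-⊞ H K .at σ l = ×-cong₂ _xor_ (H .at σ l) (K .at σ l)

-- The sign change exchanges the endings ⊕ ⊕ and ⊖ ⊖, which is why `Restricts` carries both at once.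
R-neg : ∀ {n f f′} → Restricts n f f′ → Restricts n (neg f) (neg f′)
R-neg {f = f} H .at σ l with H .at (flip σ) (trans (length-flip σ) l)
... | x , y = trans (cong f (flip-++ σ _)) y , trans (cong f (flip-++ σ _)) x

R-∷ : ∀ {n f f′} s → Restricts (suc n) f f′ → Restricts n (f ∘ (s ∷_)) (f′ ∘ (s ∷_))
R-∷ s H .at σ l = H .at (s ∷ σ) (cong suc l)

R-∂ : ∀ {n f f′} → Restricts n f f′ → Restricts n (∂ f) (∂ f′)
R-∂ H .at []      l    = refl , refl
R-∂ H .at (○ ∷ σ) refl = ×-cong₂ _xor_ (R-∂ (R-∷ ○ H) .at σ refl)
  (×-cong₂ _xor_ (H .at (⊕ ∷ σ) refl) (H .at (⊖ ∷ σ) refl))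
R-∂ H .at (⊕ ∷ σ) refl = R-∂ (R-∷ ⊕ H) .at σ refl
R-∂ H .at (⊖ ∷ σ) refl = R-∂ (R-∷ ⊖ H) .at σ refl

R-half : ∀ {n f f′ g g′} → Restricts n f f′ → Restricts n g g′ →
  Restricts (suc n) (half f g) (half f′ g′)
R-half H K .at (○ ∷ σ) l = refl , refl
R-half H K .at (⊕ ∷ σ) l = H .at σ (suc-injective l)
R-half H K .at (⊖ ∷ σ) l = R-neg K .at σ (suc-injective l)

R-ext : ∀ {n f f′ g g′} → Restricts n f f′ → Restricts n g g′ →
  Restricts (suc n) (ext f g) (ext f′ g′)
R-ext H K .at (○ ∷ σ) l = R-⊞ H (R-⊞ K (R-neg K)) .at σ (suc-injective l)
R-ext H K .at (⊕ ∷ σ) l = R-∂ K .at σ (suc-injective l)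
R-ext H K .at (⊖ ∷ σ) l = R-neg (R-∂ K) .at σ (suc-injective l)

R-full : ∀ n → Restricts n (full (2 + n)) (full n)
R-full zero    .at []      l = refl , refl
R-full (suc n) .at (○ ∷ σ) l = refl , refl
R-full (suc n) .at (⊕ ∷ σ) l = R-full n .at σ (suc-injective l)
R-full (suc n) .at (⊖ ∷ σ) l = R-full n .at σ (suc-injective l)

R-𝟎 : ∀ n → Restricts n 𝟎 𝟎
R-𝟎 n .at σ l = refl , refl

R-halves : ∀ {n J f g} → (∀ j → j ≤ J → ∀ m → Restricts (n + m) (f j m) (g j m)) →
  ∀ j → j ≤ J → ∀ m → Restricts (suc n + m) (halves f j m) (halves g j m)
R-halves H zero    h m = R-half (H zero h m) (R-𝟎 _)
R-halves H (suc j) h m = R-half (H (suc j) h m) (H j (≤-trans (n≤1+n j) h) m)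

R-sphere : ∀ n {f g : ℕ → Chain} → (∀ m → Restricts (n + m) (f m) (g m)) →
  ∀ m → Restricts (n + m) (sphere (2 + n) f m) (sphere n g m)
R-sphere n H zero    rewrite +-identityʳ n = R-full n
R-sphere n H (suc m) rewrite +-suc n m = R-ext (R-sphere n H m) (H m)

module Bottom (w : ℕ) (b b′ : ℕ → Chain) (base : ∀ m → Restricts (w + m) (b m) (b′ m)) where
  module F = Family (2 + w) b
  module F′ = Family w b′

  width-+2 : ∀ k → F.width k ≡ 2 + F′.width k
  width-+2 zero    = refl
  width-+2 (suc k) = cong (λ z → 2 + z) (width-+2 k)

  mutual
    R-pre : ∀ k j → j ≤ suc k → ∀ m → Restricts (F′.width k + m) (F.pre k j m) (F′.pre k j m)
    R-pre zero    zero       h m = R-𝟎 _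
    R-pre zero    (suc zero) h m = base m
    R-pre zero    (suc (suc j)) (s≤s ()) m
    R-pre (suc k) j          h m = R-halves (R-halves (R-balls k)) j h m

    R-Δ : ∀ k m → Restricts (F′.width k + m) (F.Δc k m) (F′.Δc k m)
    R-Δ k m rewrite width-+2 k = R-sphere (F′.width k) (R-pre k (suc k) ≤-refl) m

    R-balls : ∀ k j → j ≤ suc (suc k) → ∀ m →
      Restricts (F′.width k + m) (F.balls k j m) (F′.balls k j m)
    R-balls k j h m with m≤n⇒m<n∨m≡n h
    ... | inj₁ (s≤s h′) rewrite F.balls-low k j m h′ | F′.balls-low k j m h′ = R-pre k j h′ m
    ... | inj₂ refl     rewrite F.balls-top k m | F′.balls-top k m =
      R-⊞ (R-Δ k m) (R-pre k (suc k) ≤-refl m)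

-- The base ball B^{1,0}_n = {−1, n}, n = m + 2; bottom m is the vertex −1 of V_{m+1}.

pad : Chain → Chain
pad f (○ ∷ c) = f c
pad f _       = false

bottom : ℕ → Chain
bottom zero    = half 𝟎 (full 0)
bottom (suc m) = pad (bottom m)

edge : ℕ → Chain
edge m = half (bottom m) 𝟎

bottomCode : ℕ → Code
bottomCode m = replicate m ○ ++ ⊖ ∷ []

bottom-code : ∀ m → bottom m (bottomCode m) ≡ true
bottom-code zero    = refl
bottom-code (suc m) = bottom-code m

bottom-true : ∀ m c → bottom m c ≡ true → c ≡ bottomCode m
bottom-true zero    (⊖ ∷ []) e = refl
bottom-true zero    [] ()
bottom-true zero    (○ ∷ _) ()
bottom-true zero    (⊕ ∷ _) ()
bottom-true zero    (⊖ ∷ _ ∷ _) ()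
bottom-true (suc m) []      ()
bottom-true (suc m) (⊕ ∷ c) ()
bottom-true (suc m) (⊖ ∷ c) ()
bottom-true (suc m) (○ ∷ c) e = cong (○ ∷_) (bottom-true m c e)

bottom-Cl : ∀ m σ → length σ ≡ suc m → weight σ ≡ 0 → Cl (bottom m) σ
bottom-Cl zero    (○ ∷ []) l e = ⊖ ∷ [] , refl , skip ⊖ []
bottom-Cl (suc m) (○ ∷ σ)  l e = Cl-∷ ○ (bottom-Cl m σ (suc-injective l) e)

∂-bottom : ∀ m σ → length σ ≡ suc m → weight σ ≡ 0 → ∂ (bottom m) σ ≡ true
∂-bottom zero    (○ ∷ []) l e = refl
∂-bottom (suc m) (○ ∷ σ)  l e = cong (_xor false) (∂-bottom m σ (suc-injective l) e)

edge-N : NeighborlyAt 1 2 (Family.pre 2 edge 0) 1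
edge-N m (○ ∷ σ) l (s≤s (s≤s h)) = Cl-○ ⊕ (bottom-Cl m σ (suc-injective l) (n≤0⇒n≡0 h))
edge-N m (⊕ ∷ σ) l (s≤s (s≤s ()))
edge-N m (⊖ ∷ σ) l (s≤s (s≤s ()))

edge-S : StackedAt 2 2 (Family.pre 2 edge 0) 1
edge-S m (○ ∷ σ) l (⊕ ∷ F , e , skip _ x) h = ○ ∷ F , trans (half-0 (bottom m) 𝟎 F) (cong (_xor false) e) , same ○ x
edge-S m (⊕ ∷ σ) l (⊕ ∷ F , e , same _ x) h = ⊕ ∷ σ ,
  ∂-bottom m σ (suc-injective l) (n≤0⇒n≡0 (≤-pred (≤-pred (≤-trans (≤-reflexive (cong suc (+-comm 1 (weight σ)))) h)))) ,
  ⊑-refl (⊕ ∷ σ)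

bottom-pair : ∀ m σ s → s ≢ ○ → bottom m (σ ++ s ∷ s ∷ []) ≡ false
bottom-pair m       []          ○ h = ⊥-elim (h refl)
bottom-pair zero    []          ⊕ h = refl
bottom-pair (suc m) []          ⊕ h = refl
bottom-pair zero    []          ⊖ h = refl
bottom-pair (suc m) []          ⊖ h = refl
bottom-pair zero    (○ ∷ σ)     s h = refl
bottom-pair (suc m) (○ ∷ σ)     s h = bottom-pair m σ s h
bottom-pair zero    (⊕ ∷ σ)     s h = refl
bottom-pair (suc m) (⊕ ∷ σ)     s h = refl
bottom-pair zero    (⊖ ∷ [])    s h = refl
bottom-pair zero    (⊖ ∷ _ ∷ σ) s h = refl
bottom-pair (suc m) (⊖ ∷ σ)     s h = refl

edge-R : ∀ m → Restricts m (edge m) 𝟎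
edge-R zero    .at []      l = refl , refl
edge-R (suc m) .at (○ ∷ σ) l = refl , refl
edge-R (suc m) .at (⊖ ∷ σ) l = refl , refl
edge-R (suc m) .at (⊕ ∷ σ) l = bottom-pair (suc m) σ ⊕ (λ ()) , bottom-pair (suc m) σ ⊖ (λ ())

module Main where
  open Family 2 edge public
  open Links 2 edge public
  open Neighborly 2 edge 1 ≤-refl using (balls-∂top) public
  Δ-cs : ∀ k m σ → length σ ≡ width k + m → weight σ ≤ k + 1 → Cl (Δc k m) σ
  Δ-cs = Neighborly.Δ-Nbly 2 edge 1 ≤-refl edge-N edge-S

module LinkFamily where
  open Family 0 (λ _ → 𝟎) public
  Δ-cs : ∀ k m σ → length σ ≡ width k + m → weight σ ≤ k + 0 → Cl (Δc k m) σ
  Δ-cs = Neighborly.Δ-Nbly 0 (λ _ → 𝟎) 0 z≤n (λ { m σ l (s≤s ()) }) (λ { m σ l (F , () , _) h })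

open Bottom 0 edge (λ _ → 𝟎) edge-R using (R-Δ; width-+2) public

-- Inclusions and disjointness among the balls

infix 4 _⊆_
record _⊆_ (f g : Chain) : Set where
  constructor mk
  field incl : ∀ c → f c ≡ true → g c ≡ true
open _⊆_

record Disj (f g : Chain) : Set where
  constructor mk
  field disj : ∀ c → f c ≡ true → g c ≡ true → ⊥
open Disj

⊆-trans : ∀ {f g h} → f ⊆ g → g ⊆ h → f ⊆ h
⊆-trans x y .incl c e = y .incl c (x .incl c e)

⊆-≗ : ∀ {f g} → f ≗ g → f ⊆ g
⊆-≗ h .incl c e = trans (sym (h c)) e

𝟎-⊆ : ∀ {g} → 𝟎 ⊆ g
𝟎-⊆ .incl c ()

⊆-neg : ∀ {f g} → f ⊆ g → neg f ⊆ neg g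
⊆-neg x .incl c = x .incl (flip c)

half-⊆ : ∀ {f g h} → f ⊆ h ∘ (⊕ ∷_) → neg g ⊆ h ∘ (⊖ ∷_) → half f g ⊆ h
half-⊆ x y .incl (⊕ ∷ c) = x .incl c
half-⊆ x y .incl (⊖ ∷ c) = y .incl c

⊞-⊆ : ∀ {f g h} → f ⊆ h → g ⊆ h → f ⊞ g ⊆ h
⊞-⊆ {f} x y .incl c e with f c in eq
... | true  = x .incl c eq
... | false = y .incl c e

prv : Seq → Seq
prv g zero    m = 𝟎
prv g (suc j) m = g j m

-- Halving adds a vertex, so the shift to `suc m` puts both sides on the same V_n. For the balls
-- these say that B^{d,i}_n and B^{d,i-1}_n lie in ∂B^{d+1,i}_n.
Bounds Bounds′ : Seq → ℕ → Set
Bounds  g j = ∀ m → g j (suc m) ⊆ ∂ (halves g j m)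
Bounds′ g j = ∀ m → prv g j (suc m) ⊆ ∂ (halves g j m)

⊆-neg-∂ : ∀ {f g} → f ⊆ ∂ g → neg f ⊆ ∂ (neg g)
⊆-neg-∂ {f} {g} x = ⊆-trans (⊆-neg x) (⊆-≗ (λ c → sym (∂-neg g c)))

Bounds-half : ∀ {g J} → Ranged J (Bounds g) → Ranged J (Bounds (halves g))
Bounds-half H zero    r m = half-⊆ (H zero r m) 𝟎-⊆
Bounds-half H (suc j) r m =
  half-⊆ (H (suc j) r m) (⊆-neg-∂ (H j (≤-trans (n≤1+n j) r) m))

Bounds′-half : ∀ {g J} → Ranged J (Bounds′ g) → Ranged J (Bounds′ (halves g))
Bounds′-half H zero          r m = 𝟎-⊆
Bounds′-half H (suc zero)    r m = half-⊆ (H 1 r m) 𝟎-⊆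
Bounds′-half H (suc (suc j)) r m =
  half-⊆ (H (suc (suc j)) r m) (⊆-neg-∂ (H (suc j) (≤-trans (n≤1+n _) r) m))

half-full : ∀ {n f g} → f ⊆ full n → g ⊆ full n → half f g ⊆ full (suc n)
half-full {n} x y = half-⊆ x (⊆-trans (⊆-neg y) (⊆-≗ (full-flip n)))

InFull : ℕ → Seq → ℕ → Set
InFull n g j = g j 0 ⊆ full n

InFull-half : ∀ {n g J} → Ranged J (InFull n g) → Ranged J (InFull (suc n) (halves g))
InFull-half H zero    r = half-full (H zero r) 𝟎-⊆
InFull-half H (suc j) r = half-full (H (suc j) r) (H j (≤-trans (n≤1+n j) r))

-- `Apart` is what keeps B and -B disjoint one dimension higher. `Nested` bounds the cofacets in the
-- boundary of a half, and it absorbs the cone from -n when a half is restricted to V_{n-1}.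
Apart Nested : Seq → ℕ → Set
Apart  g j = ∀ m → Disj (g j m) (g (suc j) m)
Nested g j = ∀ m → neg (g j m) ⊆ g (suc j) m

half-Disj : ∀ {f g f′ g′} → Disj f f′ → Disj g g′ → Disj (half f g) (half f′ g′)
half-Disj x y .disj (⊕ ∷ c) = x .disj c
half-Disj x y .disj (⊖ ∷ c) = y .disj (flip c)

𝟎-Disj : ∀ {f} → Disj 𝟎 f
𝟎-Disj .disj c ()

Disj-sym : ∀ {f g} → Disj f g → Disj g f
Disj-sym x .disj c e e′ = x .disj c e′ e

Apart-half : ∀ {g J} → Ranged J (Apart g) → Ranged J (Apart (halves g))
Apart-half H zero    r m = half-Disj (H zero r m) 𝟎-Disj
Apart-half H (suc j) r m = half-Disj (H (suc j) r m) (H j (≤-trans (n≤1+n j) r) m)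

Nested² : ∀ {g} j → Nested g j → Nested g (suc j) → ∀ m → g j m ⊆ g (suc (suc j)) m
Nested² {g} j x y m .incl c e = y m .incl c (x m .incl (flip c) (trans (cong (g j m) (flip-invol c)) e))

neg-half : ∀ f g → neg (half f g) ≗ half g f
neg-half f g []      = refl
neg-half f g (○ ∷ c) = refl
neg-half f g (⊕ ∷ c) = cong g (flip-invol c)
neg-half f g (⊖ ∷ c) = refl

half-mono : ∀ {f g f′ g′} → f ⊆ f′ → g ⊆ g′ → half f g ⊆ half f′ g′
half-mono x y = half-⊆ x (⊆-neg y)

⊆-refl : ∀ {f} → f ⊆ f
⊆-refl .incl c e = e

Nested-half : ∀ {g J} → Ranged J (Nested g) → Ranged J (Nested (halves g))
Nested-half {g} H zero    r m = ⊆-trans (⊆-≗ (neg-half (g 0 m) 𝟎)) (half-mono 𝟎-⊆ ⊆-refl)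
Nested-half {g} H (suc j) r m = ⊆-trans (⊆-≗ (neg-half (g (suc j) m) (g j m)))
  (half-mono (Nested² {g} j (H j (≤-trans (n≤1+n j) r)) (H (suc j) r) m) ⊆-refl)

open Main

halves-low : ∀ k j m → j ≤ suc k → halves (balls k) j m ≡ halves (pre k) j m
halves-low k zero    m h = cong₂ half (balls-low k zero m h) refl
halves-low k (suc j) m h = cong₂ half (balls-low k (suc j) m h) (balls-low k j m (≤-trans (n≤1+n j) h))

prv-low : ∀ k j m → j ≤ suc k → prv (balls k) j m ≡ prv (pre k) j m
prv-low k zero    m h = refl
prv-low k (suc j) m h = balls-low k j m (≤-trans (n≤1+n j) h)

record Bound (k : ℕ) : Set where
  field
    bounds  : Ranged (suc k) (Bounds (pre k))
    bounds′ : Ranged (suc k) (Bounds′ (pre k))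
    inΔ     : ∀ m → pre k (suc k) m ⊆ Δc k m
    infull  : Ranged (suc k) (InFull (width k) (pre k))
open Bound

module _ {k : ℕ} (H : Bound k) where
  b-bounds : Ranged (suc (suc k)) (Bounds (balls k))
  b-bounds = Ranged-suc
    (λ j h m → subst₂ (λ f g → f ⊆ ∂ g) (sym (balls-low k j (suc m) h)) (sym (halves-low k j m h)) (bounds H j h m))
    (λ m → ⊆-trans (subst (_⊆ Δc k (suc m)) (sym (balls-top k (suc m))) (⊞-⊆ ⊆-refl (inΔ H (suc m))))
                   (⊆-≗ (λ c → sym (∂-half-top k m c))))

  b-bounds′ : Ranged (suc (suc k)) (Bounds′ (balls k))
  b-bounds′ = Ranged-suc
    (λ j h m → subst₂ (λ f g → f ⊆ ∂ g) (sym (prv-low k j (suc m) h)) (sym (halves-low k j m h)) (bounds′ H j h m))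
    (λ m → ⊆-trans (subst (_⊆ Δc k (suc m)) (sym (balls-low k (suc k) (suc m) ≤-refl)) (inΔ H (suc m)))
                   (⊆-≗ (λ c → sym (∂-half-top k m c))))

  b-infull : Ranged (suc (suc k)) (InFull (width k) (balls k))
  b-infull = Ranged-suc
    (λ j h → subst (_⊆ full (width k)) (sym (balls-low k j 0 h)) (infull H j h))
    (subst (_⊆ full (width k)) (sym (balls-top k 0)) (⊞-⊆ ⊆-refl (inΔ H 0)))

bottom-∂ : ∀ m → bottom (suc m) ⊆ ∂ (edge m)
bottom-∂ m .incl (○ ∷ c) e = trans (half-0 (bottom m) 𝟎 c) (cong (_xor false) e)

edge-full : edge 0 ⊆ full 2
edge-full .incl (⊕ ∷ ⊖ ∷ []) e = refl
edge-full .incl (⊕ ∷ []) ()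
edge-full .incl (⊕ ∷ ○ ∷ _) ()
edge-full .incl (⊕ ∷ ⊕ ∷ _) ()
edge-full .incl (⊕ ∷ ⊖ ∷ _ ∷ _) ()

bound : ∀ k → Bound k
bound zero .bounds  zero          h m = 𝟎-⊆
bound zero .bounds  (suc zero)    h m = half-⊆ (bottom-∂ m) (mk (λ _ ()))
bound zero .bounds  (suc (suc j)) (s≤s ())
bound zero .bounds′ zero          h m = 𝟎-⊆
bound zero .bounds′ (suc zero)    h m = 𝟎-⊆
bound zero .bounds′ (suc (suc j)) (s≤s ())
bound zero .inΔ     zero              = edge-full
bound zero .inΔ     (suc m)           = half-⊆ (bottom-∂ m) (mk (λ _ ()))
bound zero .infull  zero          h   = 𝟎-⊆
bound zero .infull  (suc zero)    h   = edge-full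
bound zero .infull  (suc (suc j)) (s≤s ())
bound (suc k) .bounds  = Bounds-half (Bounds-half (b-bounds (bound k)))
bound (suc k) .bounds′ = Bounds′-half (Bounds′-half (b-bounds′ (bound k)))
bound (suc k) .infull  = InFull-half {g = halves (balls k)} (InFull-half {g = balls k} (b-infull (bound k)))
bound (suc k) .inΔ zero = InFull-half {g = halves (balls k)} (InFull-half {g = balls k} (b-infull (bound k))) (suc (suc k)) ≤-refl
-- The new sphere contains the cones over ±∂B, with B the ball of the previous m. The two bases of
-- the next ball lie in ∂B by the two boundary inclusions.
bound (suc k) .inΔ (suc m) = half-⊆ (Bounds-half (b-bounds (bound k)) (suc (suc k)) ≤-refl m)
  (⊆-neg (Bounds′-half (b-bounds′ (bound k)) (suc (suc k)) ≤-refl m))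

pre⊆Δ : ∀ k m → pre k (suc k) m ⊆ Δc k m
pre⊆Δ k = inΔ (bound k)

negpre⊆Δ : ∀ k m → neg (pre k (suc k) m) ⊆ Δc k m
negpre⊆Δ k m = ⊆-trans (⊆-neg (pre⊆Δ k m)) (⊆-≗ (sphere-flip (width k) (pre k (suc k)) m))

⊞-Disj : ∀ {f g} → f ⊆ g → Disj f (g ⊞ f)
⊞-Disj x .disj c e e′ rewrite x .incl c e | e with e′
... | ()

mutual
  pre-apart : ∀ k → Ranged k (Apart (pre k))
  pre-apart zero    zero h m = 𝟎-Disj
  pre-apart (suc k) = Apart-half (Apart-half (balls-apart k))

  balls-apart : ∀ k → Ranged (suc k) (Apart (balls k))
  balls-apart k = Ranged-suc
    (λ j h m → subst₂ Disj (sym (balls-low k j m (≤-trans h (n≤1+n k)))) (sym (balls-low k (suc j) m (s≤s h))) (pre-apart k j h m))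
    (λ m → subst₂ Disj (sym (balls-low k (suc k) m ≤-refl)) (sym (balls-top k m)) (⊞-Disj (pre⊆Δ k m)))

-- The sign change swaps the two bases of a half, so a common facet of ±B would give a common facet
-- of the bases.
neg-half-Disj : ∀ {f g} → Disj g f → Disj (half f g) (neg (half f g))
neg-half-Disj {f} {g} x .disj c e e′ =
  half-Disj (Disj-sym x) x .disj c e (trans (sym (neg-half f g c)) e′)

pre-neg : ∀ k m → Disj (pre k (suc k) m) (neg (pre k (suc k) m))
pre-neg zero    m = neg-half-Disj 𝟎-Disj
pre-neg (suc k) m = neg-half-Disj (Apart-half (balls-apart k) (suc k) ≤-refl m)

⊆-⊞ : ∀ {f g h} → f ⊆ g → Disj h f → f ⊆ g ⊞ h
⊆-⊞ {f} {g} {h} x y .incl c e rewrite x .incl c e with h c in eq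
... | false = refl
... | true  = ⊥-elim (y .disj c eq e)

mutual
  pre-nested : ∀ k → Ranged k (Nested (pre k))
  pre-nested zero    zero h m = 𝟎-⊆
  pre-nested (suc k) = Nested-half (Nested-half (balls-nested k))

  balls-nested : ∀ k → Ranged (suc k) (Nested (balls k))
  balls-nested k = Ranged-suc
    (λ j h m → subst₂ (λ f g → neg f ⊆ g) (sym (balls-low k j m (≤-trans h (n≤1+n k)))) (sym (balls-low k (suc j) m (s≤s h))) (pre-nested k j h m))
    (λ m → subst₂ (λ f g → neg f ⊆ g) (sym (balls-low k (suc k) m ≤-refl)) (sym (balls-top k m))
      (⊆-⊞ (negpre⊆Δ k m) (pre-neg k m)))

-- Every ridge lies in at most two facets

b2n : Bool → ℕ
b2n false = 0
b2n true  = 1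

odd : ℕ → Bool
odd zero    = false
odd (suc n) = not (odd n)

odd-+ : ∀ m n → odd (m + n) ≡ odd m xor odd n
odd-+ zero    n = refl
odd-+ (suc m) n with odd m | odd-+ m n
... | false | e = cong not e
... | true  | e = trans (cong not e) (not-involutive (odd n))

odd-b2n : ∀ b → odd (b2n b) ≡ b
odd-b2n false = refl
odd-b2n true  = refl

odd≤ : ∀ n → b2n (odd n) ≤ n
odd≤ zero          = z≤n
odd≤ (suc zero)    = ≤-refl
odd≤ (suc (suc n)) rewrite not-involutive (odd n) = ≤-trans (odd≤ n) (≤-trans (n≤1+n n) (n≤1+n _))

-- The integer version of `∂`, for arbitrary multiplicities so that it also counts entries of lists
-- of codes.
up : (Code → ℕ) → Code → ℕ
up f []      = 0
up f (○ ∷ c) = up (f ∘ (○ ∷_)) c + (f (⊕ ∷ c) + f (⊖ ∷ c))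
up f (⊕ ∷ c) = up (f ∘ (⊕ ∷_)) c
up f (⊖ ∷ c) = up (f ∘ (⊖ ∷_)) c

up-cong : ∀ {f g} → f ≗ g → up f ≗ up g
up-cong h []      = refl
up-cong h (○ ∷ c) = cong₂ _+_ (up-cong (h ∘ (○ ∷_)) c) (cong₂ _+_ (h _) (h _))
up-cong h (⊕ ∷ c) = up-cong (h ∘ (⊕ ∷_)) c
up-cong h (⊖ ∷ c) = up-cong (h ∘ (⊖ ∷_)) c

up-0 : ∀ c → up (λ _ → 0) c ≡ 0
up-0 []      = refl
up-0 (○ ∷ c) = trans (+-identityʳ _) (up-0 c)
up-0 (⊕ ∷ c) = up-0 c
up-0 (⊖ ∷ c) = up-0 c

up-+ : ∀ f g c → up (λ x → f x + g x) c ≡ up f c + up g c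
up-+ f g []      = refl
up-+ f g (○ ∷ c) = trans
  (cong₂ _+_ (up-+ (f ∘ (○ ∷_)) (g ∘ (○ ∷_)) c)
    (+-interchange (f (⊕ ∷ c)) (g (⊕ ∷ c)) (f (⊖ ∷ c)) (g (⊖ ∷ c))))
  (+-interchange (up (f ∘ (○ ∷_)) c) _ _ _)
up-+ f g (⊕ ∷ c) = up-+ (f ∘ (⊕ ∷_)) (g ∘ (⊕ ∷_)) c
up-+ f g (⊖ ∷ c) = up-+ (f ∘ (⊖ ∷_)) (g ∘ (⊖ ∷_)) c

up-flip : ∀ f c → up (f ∘ flip) c ≡ up f (flip c)
up-flip f []      = refl
up-flip f (○ ∷ c) = cong₂ _+_ (up-flip (f ∘ (○ ∷_)) c) (+-comm (f (⊖ ∷ flip c)) _)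
up-flip f (⊕ ∷ c) = up-flip (f ∘ (⊖ ∷_)) c
up-flip f (⊖ ∷ c) = up-flip (f ∘ (⊕ ∷_)) c

cofacets : Chain → Code → ℕ
cofacets f = up (b2n ∘ f)

odd-cofacets : ∀ f c → odd (cofacets f c) ≡ ∂ f c
odd-cofacets f []      = refl
odd-cofacets f (○ ∷ c) = trans (odd-+ (cofacets (f ∘ (○ ∷_)) c) _) (cong₂ _xor_ (odd-cofacets (f ∘ (○ ∷_)) c)
  (trans (odd-+ (b2n (f (⊕ ∷ c))) _) (cong₂ _xor_ (odd-b2n (f (⊕ ∷ c))) (odd-b2n (f (⊖ ∷ c))))))
odd-cofacets f (⊕ ∷ c) = odd-cofacets (f ∘ (⊕ ∷_)) c
odd-cofacets f (⊖ ∷ c) = odd-cofacets (f ∘ (⊖ ∷_)) c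

b2n-⊞ : ∀ {f g} → Disj f g → ∀ c → b2n ((f ⊞ g) c) ≡ b2n (f c) + b2n (g c)
b2n-⊞ {f} {g} x c with f c in eq | g c in eq′
... | false | _     = refl
... | true  | false = refl
... | true  | true  = ⊥-elim (Disj.disj x c eq eq′)

cofacets-⊞ : ∀ {f g} → Disj f g → ∀ c → cofacets (f ⊞ g) c ≡ cofacets f c + cofacets g c
cofacets-⊞ {f} {g} x c = trans (up-cong (b2n-⊞ x) c) (up-+ (b2n ∘ f) (b2n ∘ g) c)

record Thin (f : Chain) : Set where
  constructor mk
  field thin : ∀ c → cofacets f c ≤ 2
open Thin

Thin-≗ : ∀ {f g} → f ≗ g → Thin f → Thin g
Thin-≗ h x .thin c = subst (_≤ 2) (up-cong (λ d → cong b2n (h d)) c) (x .thin c)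

Thin-𝟎 : Thin 𝟎
Thin-𝟎 .thin c = subst (_≤ 2) (sym (up-0 c)) z≤n

Thin-∂𝟎 : Thin (∂ 𝟎)
Thin-∂𝟎 = Thin-≗ (λ c → sym (∂-𝟎 c)) Thin-𝟎

Thin-neg : ∀ {f} → Thin f → Thin (neg f)
Thin-neg {f} x .thin c = subst (_≤ 2) (sym (up-flip (b2n ∘ f) c)) (x .thin (flip c))

b2n≤1 : ∀ b → b2n b ≤ 1
b2n≤1 false = z≤n
b2n≤1 true  = ≤-refl

Thin-half : ∀ {f g} → Thin f → Thin g → Thin (half f g)
Thin-half x y .thin []      = z≤n
Thin-half {f} {g} x y .thin (○ ∷ c) rewrite up-0 c = +-mono-≤ (b2n≤1 (f c)) (b2n≤1 (g (flip c)))
Thin-half x y .thin (⊕ ∷ c) = x .thin c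
Thin-half x y .thin (⊖ ∷ c) = Thin-neg y .thin c

Thin-pad : ∀ {f} → Thin f → Thin (pad f)
Thin-pad x .thin []      = z≤n
Thin-pad x .thin (○ ∷ c) = subst (_≤ 2) (sym (+-identityʳ _)) (x .thin c)
Thin-pad x .thin (⊕ ∷ c) = Thin-𝟎 .thin c
Thin-pad x .thin (⊖ ∷ c) = Thin-𝟎 .thin c

Thin-full : ∀ n → Thin (full n)
Thin-full zero .thin []      = z≤n
Thin-full zero .thin (○ ∷ c) rewrite up-0 c = z≤n
Thin-full zero .thin (⊕ ∷ c) = Thin-𝟎 .thin c
Thin-full zero .thin (⊖ ∷ c) = Thin-𝟎 .thin c
Thin-full (suc n) .thin []      = z≤n
Thin-full (suc n) .thin (○ ∷ c) rewrite up-0 c = +-mono-≤ (b2n≤1 (full n c)) (b2n≤1 (full n c))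
Thin-full (suc n) .thin (⊕ ∷ c) = Thin-full n .thin c
Thin-full (suc n) .thin (⊖ ∷ c) = Thin-full n .thin c

⊞-cancel : ∀ f g → f ⊞ g ⊞ g ≗ f
⊞-cancel f g c = trans (xor-assoc (f c) (g c) (g c)) (trans (cong (f c xor_) (xor-same (g c))) (xor-identityʳ (f c)))

⊞-⊆-Disj : ∀ {f g} → g ⊆ f → Disj (f ⊞ g) g
⊞-⊆-Disj h .Disj.disj c e e′ rewrite e′ | _⊆_.incl h c e′ with e
... | ()

cofacets-split : ∀ {f g} → g ⊆ f → ∀ c → cofacets f c ≡ cofacets (f ⊞ g) c + cofacets g c
cofacets-split {f} {g} h c = trans (up-cong (λ d → cong b2n (sym (⊞-cancel f g d))) c)
  (cofacets-⊞ (⊞-⊆-Disj h) c)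

-- A ridge has b cofacets in -g and x in the rest of f. In the boundary of the half the x facets
-- remain, and each cone contributes one more when the ridge is in the boundary of its base, that
-- is, when x + b or b is odd.
thin-arith : ∀ x b → x + b ≤ 2 → b ≤ 2 → x + (b2n (odd (x + b)) + b2n (odd b)) ≤ 2
thin-arith zero 0 p q = z≤n
thin-arith zero 1 p q = ≤-refl
thin-arith zero 2 p q = z≤n
thin-arith zero (suc (suc (suc b))) p (s≤s (s≤s ()))
thin-arith (suc zero) 0 p q = ≤-refl
thin-arith (suc zero) 1 p q = ≤-refl
thin-arith (suc zero) (suc (suc b)) (s≤s (s≤s ())) q
thin-arith (suc (suc zero)) 0 p q = ≤-refl
thin-arith (suc (suc zero)) (suc b) (s≤s (s≤s ())) q
thin-arith (suc (suc (suc x))) b (s≤s (s≤s ())) q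

Thin-∂-half : ∀ {f g} → Thin f → Thin g → Thin (∂ f) → Thin (∂ g) → neg g ⊆ f → Thin (∂ (half f g))
Thin-∂-half x y x′ y′ h .thin [] = z≤n
Thin-∂-half {f} {g} x y x′ y′ h .thin (○ ∷ c) = subst (_≤ 2) (cong₂ _+_
    (up-cong (λ d → cong b2n (sym (half-0 f g d))) c)
    (cong₂ _+_ (cong b2n (trans (cong odd (sym (cofacets-split h c))) (odd-cofacets f c)))
               (cong b2n (odd-cofacets (neg g) c))))
  (thin-arith (cofacets (f ⊞ neg g) c) (cofacets (neg g) c)
    (subst (_≤ 2) (cofacets-split h c) (x .thin c)) (Thin-neg y .thin c))
Thin-∂-half x y x′ y′ h .thin (⊕ ∷ c) = x′ .thin c
Thin-∂-half {f} {g} x y x′ y′ h .thin (⊖ ∷ c) = Thin-≗ (λ d → sym (∂-neg g d)) (Thin-neg y′) .thin c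

-- For a ridge in V_n the cone over ∂B supplies a cofacet only if B had an odd number of them, hence
-- at least one, and those were removed. No count increases. For a ridge at a new vertex the count
-- is that of its remaining part in ±∂B.
Thin-ext : ∀ {D B} → Thin D → Thin (∂ B) → B ⊆ D → neg B ⊆ D → Disj B (neg B) → Thin (ext D B)
Thin-ext x y h h′ d .thin [] = z≤n
Thin-ext {D} {B} x y h h′ d .thin (○ ∷ c) = ≤-trans
  (+-monoʳ-≤ (cofacets (D ⊞ (B ⊞ neg B)) c) (≤-trans
    (+-mono-≤
      (subst (λ z → b2n z ≤ cofacets B c) (odd-cofacets B c) (odd≤ (cofacets B c)))
      (subst (λ z → b2n z ≤ cofacets (neg B) c) (trans (odd-cofacets (neg B) c) (∂-neg B c)) (odd≤ (cofacets (neg B) c))))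
    (≤-reflexive (sym (cofacets-⊞ d c)))))
  (subst (_≤ 2) (cofacets-split (⊞-⊆ h h′) c) (x .thin c))
Thin-ext x y h h′ d .thin (⊕ ∷ c) = y .thin c
Thin-ext x y h h′ d .thin (⊖ ∷ c) = Thin-neg y .thin c

Thin-sphere : ∀ w B → (∀ m → Thin (∂ (B m))) → (∀ m → B m ⊆ sphere w B m) →
  (∀ m → Disj (B m) (neg (B m))) → ∀ m → Thin (sphere w B m)
Thin-sphere w B y h d zero    = Thin-full w
Thin-sphere w B y h d (suc m) = Thin-ext (Thin-sphere w B y h d m) (y m) (h m)
  (⊆-trans (⊆-neg (h m)) (⊆-≗ (sphere-flip w B m))) (d m)

ThinSeq Thin∂Seq : Seq → ℕ → Set
ThinSeq  g j = ∀ m → Thin (g j m)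
Thin∂Seq g j = ∀ m → Thin (∂ (g j m))

ThinSeq-half : ∀ {g J} → Ranged J (ThinSeq g) → Ranged J (ThinSeq (halves g))
ThinSeq-half H zero    r m = Thin-half (H zero r m) Thin-𝟎
ThinSeq-half H (suc j) r m = Thin-half (H (suc j) r m) (H j (≤-trans (n≤1+n j) r) m)

Thin∂Seq-half : ∀ {g J} → Ranged (suc J) (ThinSeq g) → Ranged (suc J) (Thin∂Seq g) → Ranged J (Nested g) →
  Ranged (suc J) (Thin∂Seq (halves g))
Thin∂Seq-half T H N zero    r       m = Thin-∂-half (T 0 r m) Thin-𝟎 (H 0 r m) Thin-∂𝟎 𝟎-⊆
Thin∂Seq-half T H N (suc j) (s≤s r) m =
  Thin-∂-half (T (suc j) (s≤s r) m) (T j (≤-trans r (n≤1+n _)) m)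
    (H (suc j) (s≤s r) m) (H j (≤-trans r (n≤1+n _)) m) (N j r m)

Thin-bottom : ∀ m → Thin (bottom m)
Thin-bottom zero    = Thin-half Thin-𝟎 (Thin-full 0)
Thin-bottom (suc m) = Thin-pad (Thin-bottom m)

∂-pad : ∀ f → ∂ (pad f) ≗ pad (∂ f)
∂-pad f []      = refl
∂-pad f (○ ∷ c) = xor-identityʳ (∂ f c)
∂-pad f (⊕ ∷ c) = ∂-𝟎 c
∂-pad f (⊖ ∷ c) = ∂-𝟎 c

∂-bottom0 : ∂ (bottom 0) ≗ pad (full 0)
∂-bottom0 []      = refl
∂-bottom0 (○ ∷ c) = trans (half-0 𝟎 (full 0) c) (full-flip 0 c)
∂-bottom0 (⊕ ∷ c) = ∂-𝟎 c
∂-bottom0 (⊖ ∷ c) = trans (∂-neg (full 0) c) (∂-full 0 (flip c))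

Thin-∂bottom : ∀ m → Thin (∂ (bottom m))
Thin-∂bottom zero    = Thin-≗ (λ c → sym (∂-bottom0 c)) (Thin-pad (Thin-full 0))
Thin-∂bottom (suc m) = Thin-≗ (λ c → sym (∂-pad (bottom m) c)) (Thin-pad (Thin-∂bottom m))

open Main

Thin-Δ′ : ∀ k → Ranged (suc k) (Thin∂Seq (pre k)) → ∀ m → Thin (Δc k m)
Thin-Δ′ k H = Thin-sphere (width k) (pre k (suc k)) (H (suc k) ≤-refl) (pre⊆Δ k) (pre-neg k)

mutual
  Thin-pre : ∀ k → Ranged (suc k) (ThinSeq (pre k))
  Thin-pre zero    zero       h m = Thin-𝟎
  Thin-pre zero    (suc zero) h m = Thin-half (Thin-bottom m) Thin-𝟎
  Thin-pre zero    (suc (suc j)) (s≤s ()) m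
  Thin-pre (suc k) = ThinSeq-half (ThinSeq-half (Thin-balls k))

  Thin-∂pre : ∀ k → Ranged (suc k) (Thin∂Seq (pre k))
  Thin-∂pre zero    zero       h m = Thin-∂𝟎
  Thin-∂pre zero    (suc zero) h m = Thin-∂-half (Thin-bottom m) Thin-𝟎 (Thin-∂bottom m) Thin-∂𝟎 𝟎-⊆
  Thin-∂pre zero    (suc (suc j)) (s≤s ()) m
  Thin-∂pre (suc k) = Thin∂Seq-half (ThinSeq-half (Thin-balls k))
    (Thin∂Seq-half (Thin-balls k) (Thin-∂balls k) (balls-nested k)) (Nested-half (balls-nested k))

  Thin-balls : ∀ k → Ranged (suc (suc k)) (ThinSeq (balls k))
  Thin-balls k = Ranged-suc (λ j h m → subst Thin (sym (balls-low k j m h)) (Thin-pre k j h m))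
    (λ m → subst Thin (sym (balls-top k m)) (Thin-⊞ m))
    where
    Thin-⊞ : ∀ m → Thin (Δc k m ⊞ pre k (suc k) m)
    Thin-⊞ m .thin c = ≤-trans (m≤m+n _ _)
      (subst (_≤ 2) (cofacets-split (pre⊆Δ k m) c) (Thin-Δ′ k (Thin-∂pre k) m .thin c))

  Thin-∂balls : ∀ k → Ranged (suc (suc k)) (Thin∂Seq (balls k))
  Thin-∂balls k = Ranged-suc (λ j h m → subst (λ f → Thin (∂ f)) (sym (balls-low k j m h)) (Thin-∂pre k j h m))
    (λ m → Thin-≗ (λ c → sym (balls-∂top k m c)) (Thin-∂pre k (suc k) ≤-refl m))

-- Codes and vertex lists

toF : Code → Face
toF []      = []
toF (○ ∷ c) = toF c
toF (⊕ ∷ c) = + suc (length c) ∷ toF c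
toF (⊖ ∷ c) = - (+ suc (length c)) ∷ toF c

toF-≤ : ∀ c {v} → v ∈ toF c → ∣ v ∣ ≤ length c
toF-≤ (○ ∷ c) v∈          = ≤-trans (toF-≤ c v∈) (n≤1+n _)
toF-≤ (⊕ ∷ c) (here refl) = ≤-refl
toF-≤ (⊕ ∷ c) (there v∈)  = ≤-trans (toF-≤ c v∈) (n≤1+n _)
toF-≤ (⊖ ∷ c) (here refl) = ≤-refl
toF-≤ (⊖ ∷ c) (there v∈)  = ≤-trans (toF-≤ c v∈) (n≤1+n _)

toF-flip : ∀ c → toF (flip c) ≡ negF (toF c)
toF-flip []      = refl
toF-flip (○ ∷ c) = toF-flip c
toF-flip (⊕ ∷ c) = cong₂ _∷_ (cong (λ n → - (+ suc n)) (length-flip c)) (toF-flip c)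
toF-flip (⊖ ∷ c) = cong₂ _∷_ (cong (λ n → + suc n) (length-flip c)) (toF-flip c)

label : Status → ℕ → ℤ
label ⊖ n = - (+ n)
label _ n = + n

label-∣ : ∀ s n → ∣ label s n ∣ ≡ n
label-∣ ○ n = refl
label-∣ ⊕ n = refl
label-∣ ⊖ n = ∣-i∣≡∣i∣ (+ n)

∈-∷ : ∀ s c {v} → v ∈ toF (s ∷ c) → (s ≢ ○ × v ≡ label s (suc (length c))) ⊎ v ∈ toF c
∈-∷ ○ c v∈         = inj₂ v∈
∈-∷ ⊕ c (here e)   = inj₁ ((λ ()) , e)
∈-∷ ⊕ c (there v∈) = inj₂ v∈
∈-∷ ⊖ c (here e)   = inj₁ ((λ ()) , e)
∈-∷ ⊖ c (there v∈) = inj₂ v∈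

∈-there : ∀ s c {v} → v ∈ toF c → v ∈ toF (s ∷ c)
∈-there ○ c v∈ = v∈
∈-there ⊕ c v∈ = there v∈
∈-there ⊖ c v∈ = there v∈

⊑-length : ∀ {c d} → c ⊑ d → length c ≡ length d
⊑-length []         = refl
⊑-length (skip s x) = cong suc (⊑-length x)
⊑-length (same s x) = cong suc (⊑-length x)

⊑⇒⊆ : ∀ {c d} → c ⊑ d → ∀ {v} → v ∈ toF c → v ∈ toF d
⊑⇒⊆ (skip s x) v∈ = ∈-there s _ (⊑⇒⊆ x v∈)
⊑⇒⊆ (same ○ x) v∈ = ⊑⇒⊆ x v∈
⊑⇒⊆ (same ⊕ x) (here refl) = here (cong (λ n → + suc n) (⊑-length x))
⊑⇒⊆ (same ⊕ x) (there v∈)  = there (⊑⇒⊆ x v∈)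
⊑⇒⊆ (same ⊖ x) (here refl) = here (cong (λ n → - (+ suc n)) (⊑-length x))
⊑⇒⊆ (same ⊖ x) (there v∈)  = there (⊑⇒⊆ x v∈)

∈-tail : ∀ s c {v} → ∣ v ∣ ≤ length c → v ∈ toF (s ∷ c) → v ∈ toF c
∈-tail s c h v∈ with ∈-∷ s c v∈
... | inj₁ (_ , refl) = ⊥-elim (1+n≰n (subst (_≤ length c) (label-∣ s _) h))
... | inj₂ v∈′        = v∈′

∈-head⊕ : ∀ s c → + suc (length c) ∈ toF (s ∷ c) → s ≡ ⊕
∈-head⊕ s c v∈ with ∈-∷ s c v∈
∈-head⊕ ○ c v∈ | inj₁ (h , _) = ⊥-elim (h refl)
∈-head⊕ ⊕ c v∈ | inj₁ _ = refl
∈-head⊕ ⊖ c v∈ | inj₁ (_ , ())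
... | inj₂ v∈′ = ⊥-elim (1+n≰n (toF-≤ c v∈′))

∈-head⊖ : ∀ s c → - (+ suc (length c)) ∈ toF (s ∷ c) → s ≡ ⊖
∈-head⊖ s c v∈ with ∈-∷ s c v∈
∈-head⊖ ○ c v∈ | inj₁ (h , _) = ⊥-elim (h refl)
∈-head⊖ ⊖ c v∈ | inj₁ _ = refl
∈-head⊖ ⊕ c v∈ | inj₁ (_ , ())
... | inj₂ v∈′ = ⊥-elim (1+n≰n (toF-≤ c v∈′))

⊆⇒⊑ : ∀ c d → length c ≡ length d → (∀ {v} → v ∈ toF c → v ∈ toF d) → c ⊑ d
⊆⇒⊑ []      []      l h = []
⊆⇒⊑ (s ∷ c) (t ∷ d) l h = go s (suc-injective l) h
  where
  go : ∀ s → length c ≡ length d → (∀ {v} → v ∈ toF (s ∷ c) → v ∈ toF (t ∷ d)) → (s ∷ c) ⊑ (t ∷ d)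
  go ○ l h = skip t (⊆⇒⊑ c d l (λ v∈ → ∈-tail t d (≤-trans (toF-≤ c v∈) (≤-reflexive l)) (h v∈)))
  go ⊕ l h with ∈-head⊕ t d (subst (λ n → + suc n ∈ toF (t ∷ d)) l (h (here refl)))
  ... | refl = same ⊕ (⊆⇒⊑ c d l (λ v∈ → ∈-tail ⊕ d (≤-trans (toF-≤ c v∈) (≤-reflexive l)) (h (there v∈))))
  go ⊖ l h with ∈-head⊖ t d (subst (λ n → - (+ suc n) ∈ toF (t ∷ d)) l (h (here refl)))
  ... | refl = same ⊖ (⊆⇒⊑ c d l (λ v∈ → ∈-tail ⊖ d (≤-trans (toF-≤ c v∈) (≤-reflexive l)) (h (there v∈))))

_==ˢ_ : Status → Status → Bool
○ ==ˢ ○ = true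
⊕ ==ˢ ⊕ = true
⊖ ==ˢ ⊖ = true
_ ==ˢ _ = false

_==_ : Code → Code → Bool
[]      == []      = true
[]      == (_ ∷ _) = false
(_ ∷ _) == []      = false
(s ∷ c) == (t ∷ d) = (s ==ˢ t) ∧ (c == d)

==-refl : ∀ c → (c == c) ≡ true
==-refl []      = refl
==-refl (○ ∷ c) = ==-refl c
==-refl (⊕ ∷ c) = ==-refl c
==-refl (⊖ ∷ c) = ==-refl c

==⇒≡ : ∀ c d → (c == d) ≡ true → c ≡ d
==⇒≡ []      []      e = refl
==⇒≡ (○ ∷ c) (○ ∷ d) e = cong (○ ∷_) (==⇒≡ c d e)
==⇒≡ (⊕ ∷ c) (⊕ ∷ d) e = cong (⊕ ∷_) (==⇒≡ c d e)
==⇒≡ (⊖ ∷ c) (⊖ ∷ d) e = cong (⊖ ∷_) (==⇒≡ c d e)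

_⊑ᵇ_ : Code → Code → Bool
[]      ⊑ᵇ []      = true
[]      ⊑ᵇ (_ ∷ _) = false
(_ ∷ _) ⊑ᵇ []      = false
(○ ∷ c) ⊑ᵇ (t ∷ d) = c ⊑ᵇ d
(⊕ ∷ c) ⊑ᵇ (t ∷ d) = (⊕ ==ˢ t) ∧ (c ⊑ᵇ d)
(⊖ ∷ c) ⊑ᵇ (t ∷ d) = (⊖ ==ˢ t) ∧ (c ⊑ᵇ d)

⊑ᵇ⇒⊑ : ∀ c d → (c ⊑ᵇ d) ≡ true → c ⊑ d
⊑ᵇ⇒⊑ []      []      e = []
⊑ᵇ⇒⊑ (○ ∷ c) (t ∷ d) e = skip t (⊑ᵇ⇒⊑ c d e)
⊑ᵇ⇒⊑ (⊕ ∷ c) (⊕ ∷ d) e = same ⊕ (⊑ᵇ⇒⊑ c d e)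
⊑ᵇ⇒⊑ (⊖ ∷ c) (⊖ ∷ d) e = same ⊖ (⊑ᵇ⇒⊑ c d e)

⊑⇒⊑ᵇ : ∀ {c d} → c ⊑ d → (c ⊑ᵇ d) ≡ true
⊑⇒⊑ᵇ []         = refl
⊑⇒⊑ᵇ (skip s x) = ⊑⇒⊑ᵇ x
⊑⇒⊑ᵇ (same ○ x) = ⊑⇒⊑ᵇ x
⊑⇒⊑ᵇ (same ⊕ x) = ⊑⇒⊑ᵇ x
⊑⇒⊑ᵇ (same ⊖ x) = ⊑⇒⊑ᵇ x

⊑-weight : ∀ {c d} → c ⊑ d → weight c ≤ weight d
⊑-weight []         = z≤n
⊑-weight (skip ○ x) = ⊑-weight x
⊑-weight (skip ⊕ x) = ≤-trans (⊑-weight x) (n≤1+n _)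
⊑-weight (skip ⊖ x) = ≤-trans (⊑-weight x) (n≤1+n _)
⊑-weight (same ○ x) = ⊑-weight x
⊑-weight (same ⊕ x) = s≤s (⊑-weight x)
⊑-weight (same ⊖ x) = s≤s (⊑-weight x)

Bool-ext : ∀ {a b} → (a ≡ true → b ≡ true) → (b ≡ true → a ≡ true) → a ≡ b
Bool-ext {true}  {b}     f g = sym (f refl)
Bool-ext {false} {false} f g = refl
Bool-ext {false} {true}  f g = g refl

∧-true : ∀ {a b} → a ∧ b ≡ true → a ≡ true × b ≡ true
∧-true {true} {true} e = refl , refl

memᵇ⇒∈ : ∀ v F → memᵇ v F ≡ true → v ∈ F
memᵇ⇒∈ v (w ∷ F) e with v ℤ.≟ w
... | yes v≡w = here v≡w
... | no  _   = there (memᵇ⇒∈ v F e)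

∈⇒memᵇ : ∀ v F → v ∈ F → memᵇ v F ≡ true
∈⇒memᵇ v (w ∷ F) v∈ with v ℤ.≟ w
∈⇒memᵇ v (w ∷ F) v∈         | yes _   = refl
∈⇒memᵇ v (w ∷ F) (here v≡w) | no  v≢w = ⊥-elim (v≢w v≡w)
∈⇒memᵇ v (w ∷ F) (there v∈) | no  _   = ∈⇒memᵇ v F v∈

subᵇ⇒⊆ : ∀ σ τ → subᵇ σ τ ≡ true → ∀ {v} → v ∈ σ → v ∈ τ
subᵇ⇒⊆ (x ∷ σ) τ e (here refl) = memᵇ⇒∈ x τ (proj₁ (∧-true e))
subᵇ⇒⊆ (x ∷ σ) τ e (there v∈)  = subᵇ⇒⊆ σ τ (proj₂ (∧-true {memᵇ x τ} e)) v∈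

⊆⇒subᵇ : ∀ σ τ → (∀ {v} → v ∈ σ → v ∈ τ) → subᵇ σ τ ≡ true
⊆⇒subᵇ []      τ h = refl
⊆⇒subᵇ (x ∷ σ) τ h rewrite ∈⇒memᵇ x τ (h (here refl)) = ⊆⇒subᵇ σ τ (h ∘ there)

-- Up to permutation, because the lists have no common order: paths ascend, whereas cones put the
-- new vertex first.
record Encodes (n s : ℕ) (F : Face) (c : Code) : Set where
  constructor enc
  field
    len  : length c ≡ n
    size : weight c ≡ s
    perm : F ↭ toF c
open Encodes

sub-code : ∀ {n s t r F c d} → Encodes n s r c → Encodes n t F d → subᵇ r F ≡ (c ⊑ᵇ d)
sub-code {r = r} {F} {c} {d} x y = Bool-ext
  (λ e → ⊑⇒⊑ᵇ (⊆⇒⊑ c d (trans (len x) (sym (len y)))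
    (λ v∈ → ∈-resp-↭ (perm y) (subᵇ⇒⊆ r F e (∈-resp-↭ (↭-sym (perm x)) v∈)))))
  (λ e → ⊆⇒subᵇ r F (λ v∈ → ∈-resp-↭ (↭-sym (perm y)) (⊑⇒⊆ (⊑ᵇ⇒⊑ c d e) (∈-resp-↭ (perm x) v∈))))

⊑-antisym : ∀ {c d} → c ⊑ d → d ⊑ c → c ≡ d
⊑-antisym []         _          = refl
⊑-antisym (skip ○ x) (skip _ y) = cong (○ ∷_) (⊑-antisym x y)
⊑-antisym (skip ○ x) (same _ y) = cong (○ ∷_) (⊑-antisym x y)
⊑-antisym (same s x) (skip _ y) = cong (○ ∷_) (⊑-antisym x y)
⊑-antisym (same s x) (same _ y) = cong (s ∷_) (⊑-antisym x y)

eq-code : ∀ {n s t F G c d} → Encodes n s F c → Encodes n t G d → eqᵇ F G ≡ (c == d)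
eq-code {c = c} {d} x y rewrite sub-code x y | sub-code y x = Bool-ext
  (λ e → subst (λ z → (c == z) ≡ true)
    (⊑-antisym (⊑ᵇ⇒⊑ c d (proj₁ (∧-true e))) (⊑ᵇ⇒⊑ d c (proj₂ (∧-true {c ⊑ᵇ d} e)))) (==-refl c))
  (λ e → subst (λ z → (c ⊑ᵇ z) ∧ (z ⊑ᵇ c) ≡ true) (==⇒≡ c d e)
    (cong₂ _∧_ (⊑⇒⊑ᵇ (⊑-refl c)) (⊑⇒⊑ᵇ (⊑-refl c))))

-- List complexes represented by chains

count : List Code → Code → ℕ
count []       c = 0
count (x ∷ xs) c = b2n (x == c) + count xs c

-- Complexes as chains: every facet is encoded by a code of length n and weight s,
-- and the multiplicity of a code in the list is the 0/1 value of the chain f.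
record Rep (n s : ℕ) (Γ : Cx) (f : Chain) : Set where
  constructor rep
  field
    codes : List Code
    faces : Pointwise (Encodes n s) Γ codes
    mult  : ∀ c → count codes c ≡ b2n (f c)
open Rep

count-++ : ∀ xs ys c → count (xs ++ ys) c ≡ count xs c + count ys c
count-++ []       ys c = refl
count-++ (x ∷ xs) ys c = trans (cong₂ _+_ (refl {x = b2n (x == c)}) (count-++ xs ys c)) (sym (+-assoc (b2n (x == c)) _ _))

count-[] : ∀ s xs → count (map (s ∷_) xs) [] ≡ 0
count-[] s []       = refl
count-[] s (x ∷ xs) = count-[] s xs

count-same : ∀ s xs c → count (map (s ∷_) xs) (s ∷ c) ≡ count xs c
count-same s []       c = refl
count-same ○ (x ∷ xs) c = cong₂ _+_ (refl {x = b2n (x == c)}) (count-same ○ xs c)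
count-same ⊕ (x ∷ xs) c = cong₂ _+_ (refl {x = b2n (x == c)}) (count-same ⊕ xs c)
count-same ⊖ (x ∷ xs) c = cong₂ _+_ (refl {x = b2n (x == c)}) (count-same ⊖ xs c)

count-diff : ∀ s t xs c → (s ==ˢ t) ≡ false → count (map (s ∷_) xs) (t ∷ c) ≡ 0
count-diff s t []       c e = refl
count-diff s t (x ∷ xs) c e rewrite e = count-diff s t xs c e

==-flip : ∀ c d → (flip c == d) ≡ (c == flip d)
==-flip []      []      = refl
==-flip []      (_ ∷ _) = refl
==-flip (_ ∷ _) []      = refl
==-flip (○ ∷ c) (○ ∷ d) = ==-flip c d
==-flip (○ ∷ c) (⊕ ∷ d) = refl
==-flip (○ ∷ c) (⊖ ∷ d) = refl
==-flip (⊕ ∷ c) (○ ∷ d) = refl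
==-flip (⊕ ∷ c) (⊕ ∷ d) = refl
==-flip (⊕ ∷ c) (⊖ ∷ d) = ==-flip c d
==-flip (⊖ ∷ c) (○ ∷ d) = refl
==-flip (⊖ ∷ c) (⊕ ∷ d) = ==-flip c d
==-flip (⊖ ∷ c) (⊖ ∷ d) = refl

count-flip : ∀ xs c → count (map flip xs) c ≡ count xs (flip c)
count-flip []       c = refl
count-flip (x ∷ xs) c = cong₂ _+_ (cong b2n (==-flip x c)) (count-flip xs c)

Rep-≗ : ∀ {n s Γ f g} → f ≗ g → Rep n s Γ f → Rep n s Γ g
Rep-≗ h (rep cs p m) = rep cs p (λ c → trans (m c) (cong b2n (h c)))

Rep-neg : ∀ {n s Γ f} → Rep n s Γ f → Rep n s (negC Γ) (neg f)
Rep-neg (rep cs p m) = rep (map flip cs)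
  (PW.map⁺ negF flip (PW.map (λ {F} {c} x → enc (trans (length-flip c) (len x)) (trans (weight-flip c) (size x))
    (subst (negF F ↭_) (sym (toF-flip c)) (Perm.map⁺ -_ (perm x)))) p))
  (λ c → trans (count-flip cs c) (m (flip c)))

Rep-++ : ∀ {n s Γ Γ′ f g} → Disj f g → Rep n s Γ f → Rep n s Γ′ g → Rep n s (Γ ++ Γ′) (f ⊞ g)
Rep-++ d (rep cs p m) (rep ds q m′) = rep (cs ++ ds) (PW.++⁺ p q)
  (λ c → trans (count-++ cs ds c) (trans (cong₂ _+_ (m c) (m′ c)) (sym (b2n-⊞ d c))))

cone : Status → Chain → Chain
cone s f []      = false
cone s f (t ∷ c) = (s ==ˢ t) ∧ f c

count-cone : ∀ s {cs f} → (∀ c → count cs c ≡ b2n (f c)) → ∀ c → count (map (s ∷_) cs) c ≡ b2n (cone s f c)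
count-cone s {cs} m []      = count-[] s cs
count-cone s {cs} m (t ∷ c) with s ==ˢ t in e
... | false = count-diff s t cs c e
... | true  = trans (eq s t e) (m c)
  where
  eq : ∀ s t → (s ==ˢ t) ≡ true → count (map (s ∷_) cs) (t ∷ c) ≡ count cs c
  eq ○ ○ _ = count-same ○ cs c
  eq ⊕ ⊕ _ = count-same ⊕ cs c
  eq ⊖ ⊖ _ = count-same ⊖ cs c

Rep-pad : ∀ {n s Γ f} → Rep n s Γ f → Rep (suc n) s Γ (cone ○ f)
Rep-pad {Γ = Γ} (rep cs p m) = rep (map (○ ∷_) cs) (go p) (count-cone ○ {cs} m)
  where
  go : ∀ {Γ cs} → Pointwise (Encodes _ _) Γ cs → Pointwise (Encodes _ _) Γ (map (○ ∷_) cs)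
  go []       = []
  go (x ∷ xs) = enc (cong suc (len x)) (size x) (perm x) ∷ go xs

Rep-⊕ : ∀ {n s Γ f} → Rep n s Γ f → Rep (suc n) (suc s) (joinV Γ (+ suc n)) (cone ⊕ f)
Rep-⊕ (rep cs p m) = rep (map (⊕ ∷_) cs) (PW.map⁺ _ _ (PW.map go p)) (count-cone ⊕ {cs} m)
  where
  go : ∀ {F c n s} → Encodes n s F c → Encodes (suc n) (suc s) (+ suc n ∷ F) (⊕ ∷ c)
  go (enc refl refl q) = enc refl refl (Perm.prep _ q)

Rep-⊖ : ∀ {n s Γ f} → Rep n s Γ f → Rep (suc n) (suc s) (joinV Γ (- (+ suc n))) (cone ⊖ f)
Rep-⊖ (rep cs p m) = rep (map (⊖ ∷_) cs) (PW.map⁺ _ _ (PW.map go p)) (count-cone ⊖ {cs} m)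
  where
  go : ∀ {F c n s} → Encodes n s F c → Encodes (suc n) (suc s) (- (+ suc n) ∷ F) (⊖ ∷ c)
  go (enc refl refl q) = enc refl refl (Perm.prep _ q)

cone-Disj : ∀ {s t f g} → (∀ u → (s ==ˢ u) ∧ (t ==ˢ u) ≡ false) → Disj (cone s f) (cone t g)
cone-Disj {s} {t} h .Disj.disj (u ∷ c) e e′ with s ==ˢ u | t ==ˢ u | h u
cone-Disj h .Disj.disj (u ∷ c) ()  e′  | false | _     | _
cone-Disj h .Disj.disj (u ∷ c) e   ()  | true  | false | _
cone-Disj h .Disj.disj (u ∷ c) e   e′  | true  | true  | ()

⊕⊖-apart : ∀ u → (⊕ ==ˢ u) ∧ (⊖ ==ˢ u) ≡ false
⊕⊖-apart ○ = refl
⊕⊖-apart ⊕ = refl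
⊕⊖-apart ⊖ = refl

Rep-half : ∀ {n s Γ Γ′ f g} → Rep n s Γ f → Rep n s Γ′ g →
  Rep (suc n) (suc s) (joinV Γ (+ suc n) ++ joinV (negC Γ′) (- (+ suc n))) (half f g)
Rep-half {f = f} {g} x y = Rep-≗ eq (Rep-++ (cone-Disj ⊕⊖-apart) (Rep-⊕ x) (Rep-⊖ (Rep-neg y)))
  where
  eq : (cone ⊕ f ⊞ cone ⊖ (neg g)) ≗ half f g
  eq []      = refl
  eq (○ ∷ c) = refl
  eq (⊕ ∷ c) = xor-identityʳ (f c)
  eq (⊖ ∷ c) = refl

open Encodes
open Rep

count-pos : ∀ xs c → anyᵇ (c ==_) xs ≡ false → count xs c ≡ 0
count-pos []       c e = refl
count-pos (x ∷ xs) c e with c == x in eq | x == c in eq′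
... | false | false = count-pos xs c e
... | false | true  with ==⇒≡ x c eq′
...   | refl with trans (sym (==-refl x)) eq
...     | ()
count-pos (x ∷ xs) c () | true | _

count-any : ∀ xs c → anyᵇ (c ==_) xs ≡ true → 1 ≤ count xs c
count-any (x ∷ xs) c e with c == x in eq
... | true  with ==⇒≡ c x eq
...   | refl rewrite ==-refl c = s≤s z≤n
count-any (x ∷ xs) c e | false = ≤-trans (count-any xs c e) (m≤n+m _ _)

any-mult : ∀ cs c b → count cs c ≡ b2n b → anyᵇ (c ==_) cs ≡ b
any-mult cs c b e with anyᵇ (c ==_) cs in eq
any-mult cs c false e | false = refl
any-mult cs c true  e | true  = refl
any-mult cs c false e | true  = ⊥-elim (1+n≰n (subst (1 ≤_) e (count-any cs c eq)))
any-mult cs c true  e | false with trans (sym (count-pos cs c eq)) e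
... | ()

any-code : ∀ {n s t F c Γ cs} → Encodes n s F c → Pointwise (Encodes n t) Γ cs →
  anyᵇ (eqᵇ F) Γ ≡ anyᵇ (c ==_) cs
any-code x []       = refl
any-code x (y ∷ ys) rewrite eq-code x y | any-code x ys = refl

keep-code : ∀ {n s Γ cs} (p : Face → Bool) (p′ : Code → Bool) →
  (∀ {F c} → Encodes n s F c → p F ≡ p′ c) →
  Pointwise (Encodes n s) Γ cs → Pointwise (Encodes n s) (keep p Γ) (keep p′ cs)
keep-code p p′ h []                   = []
keep-code p p′ h (_∷_ {y = c} x xs) rewrite h x with p′ c
... | true  = x ∷ keep-code p p′ h xs
... | false = keep-code p p′ h xs

count-keep : ∀ p xs c → count (keep p xs) c ≡ (if p c then count xs c else 0)
count-keep p [] c with p c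
... | true  = refl
... | false = refl
count-keep p (x ∷ xs) c with x == c in eq
count-keep p (x ∷ xs) c | true with ==⇒≡ x c eq
... | refl with p x in e
...   | true  rewrite eq = cong suc (trans (count-keep p xs x) (cong (if_then count xs x else 0) e))
...   | false = trans (count-keep p xs x) (cong (if_then count xs x else 0) e)
count-keep p (x ∷ xs) c | false with p x
... | true  rewrite eq = count-keep p xs c
... | false = count-keep p xs c

Rep-minus : ∀ {n s Γ Γ′ f g} → g ⊆ f → Rep n s Γ f → Rep n s Γ′ g → Rep n s (minusC Γ Γ′) (f ⊞ g)
Rep-minus {Γ′ = Γ′} {f} {g} h (rep cs p m) (rep ds q m′) = rep (keep (not ∘ g) cs)
  (keep-code _ (not ∘ g) (λ {F} {c} x → cong not (trans (any-code x q) (any-mult ds c (g c) (m′ c)))) p)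
  (λ c → trans (count-keep (not ∘ g) cs c) (aux c))
  where
  aux : ∀ c → (if not (g c) then count cs c else 0) ≡ b2n (f c xor g c)
  aux c with g c in eq
  ... | true  rewrite _⊆_.incl h c eq = refl
  ... | false = trans (m c) (cong b2n (sym (xor-identityʳ (f c))))

-- Boundaries

dels : Code → List Code
dels []      = []
dels (○ ∷ c) = map (○ ∷_) (dels c)
dels (⊕ ∷ c) = (○ ∷ c) ∷ map (⊕ ∷_) (dels c)
dels (⊖ ∷ c) = (○ ∷ c) ∷ map (⊖ ∷_) (dels c)

count-dels : ∀ x c → count (dels x) c ≡ up (λ d → b2n (x == d)) c
count-dels []      []      = refl
count-dels []      (○ ∷ c) = sym (trans (+-identityʳ _) (up-0 c))
count-dels []      (⊕ ∷ c) = sym (up-0 c)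
count-dels []      (⊖ ∷ c) = sym (up-0 c)
count-dels (○ ∷ x) []      = count-[] ○ (dels x)
count-dels (⊕ ∷ x) []      = count-[] ⊕ (dels x)
count-dels (⊖ ∷ x) []      = count-[] ⊖ (dels x)
count-dels (○ ∷ x) (○ ∷ c) = trans (count-same ○ (dels x) c) (trans (count-dels x c) (sym (+-identityʳ _)))
count-dels (○ ∷ x) (⊕ ∷ c) = trans (count-diff ○ ⊕ (dels x) c refl) (sym (up-0 c))
count-dels (○ ∷ x) (⊖ ∷ c) = trans (count-diff ○ ⊖ (dels x) c refl) (sym (up-0 c))
count-dels (⊕ ∷ x) (○ ∷ c) rewrite count-diff ⊕ ○ (dels x) c refl | up-0 c = refl
count-dels (⊕ ∷ x) (⊕ ∷ c) = trans (count-same ⊕ (dels x) c) (count-dels x c)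
count-dels (⊕ ∷ x) (⊖ ∷ c) = trans (count-diff ⊕ ⊖ (dels x) c refl) (sym (up-0 c))
count-dels (⊖ ∷ x) (○ ∷ c) rewrite count-diff ⊖ ○ (dels x) c refl | up-0 c = +-identityʳ _
count-dels (⊖ ∷ x) (⊕ ∷ c) = trans (count-diff ⊖ ⊕ (dels x) c refl) (sym (up-0 c))
count-dels (⊖ ∷ x) (⊖ ∷ c) = trans (count-same ⊖ (dels x) c) (count-dels x c)

⊑ᵇ-weight : ∀ d x → (d ⊑ᵇ x) ≡ true → weight d ≤ weight x
⊑ᵇ-weight d x e = ⊑-weight (⊑ᵇ⇒⊑ d x e)

⊑ᵇ-heavy : ∀ d x → weight x < weight d → (d ⊑ᵇ x) ≡ false
⊑ᵇ-heavy d x h with d ⊑ᵇ x in e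
... | false = refl
... | true  = ⊥-elim (<⇒≱ h (⊑ᵇ-weight d x e))

⊑ᵇ-== : ∀ d x → weight x ≡ weight d → (d ⊑ᵇ x) ≡ (x == d)
⊑ᵇ-== []      []      e = refl
⊑ᵇ-== []      (_ ∷ _) e = refl
⊑ᵇ-== (_ ∷ _) []      e = refl
⊑ᵇ-== (○ ∷ d) (○ ∷ x) e = ⊑ᵇ-== d x e
⊑ᵇ-== (○ ∷ d) (⊕ ∷ x) e = ⊑ᵇ-heavy d x (≤-reflexive e)
⊑ᵇ-== (○ ∷ d) (⊖ ∷ x) e = ⊑ᵇ-heavy d x (≤-reflexive e)
⊑ᵇ-== (⊕ ∷ d) (○ ∷ x) e = refl
⊑ᵇ-== (⊕ ∷ d) (⊕ ∷ x) e = ⊑ᵇ-== d x (suc-injective e)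
⊑ᵇ-== (⊕ ∷ d) (⊖ ∷ x) e = refl
⊑ᵇ-== (⊖ ∷ d) (○ ∷ x) e = refl
⊑ᵇ-== (⊖ ∷ d) (⊕ ∷ x) e = refl
⊑ᵇ-== (⊖ ∷ d) (⊖ ∷ x) e = ⊑ᵇ-== d x (suc-injective e)

-- With exactly one vertex more, x contains d just when it fills one ○ of d, and then in a unique
-- way.
⊑ᵇ-cofacet : ∀ d x → weight x ≡ suc (weight d) → b2n (d ⊑ᵇ x) ≡ up (λ c → b2n (x == c)) d
⊑ᵇ-cofacet []      (s ∷ x) e = refl
⊑ᵇ-cofacet (○ ∷ d) []      ()
⊑ᵇ-cofacet (⊕ ∷ d) []      ()
⊑ᵇ-cofacet (⊖ ∷ d) []      ()
⊑ᵇ-cofacet (○ ∷ d) (○ ∷ x) e = trans (⊑ᵇ-cofacet d x e) (sym (+-identityʳ _))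
⊑ᵇ-cofacet (○ ∷ d) (⊕ ∷ x) e rewrite up-0 d =
  trans (cong b2n (⊑ᵇ-== d x (suc-injective e))) (sym (+-identityʳ _))
⊑ᵇ-cofacet (○ ∷ d) (⊖ ∷ x) e rewrite up-0 d = cong b2n (⊑ᵇ-== d x (suc-injective e))
⊑ᵇ-cofacet (⊕ ∷ d) (○ ∷ x) e = sym (up-0 d)
⊑ᵇ-cofacet (⊕ ∷ d) (⊕ ∷ x) e = ⊑ᵇ-cofacet d x (suc-injective e)
⊑ᵇ-cofacet (⊕ ∷ d) (⊖ ∷ x) e = sym (up-0 d)
⊑ᵇ-cofacet (⊖ ∷ d) (○ ∷ x) e = sym (up-0 d)
⊑ᵇ-cofacet (⊖ ∷ d) (⊕ ∷ x) e = sym (up-0 d)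
⊑ᵇ-cofacet (⊖ ∷ d) (⊖ ∷ x) e = ⊑ᵇ-cofacet d x (suc-injective e)

-- Permuting a face permutes its deletions, so only multiplicities can be preserved. R is general
-- because passing below a first vertex x replaces it by the relation that puts x in front.
dels-perm : ∀ {F G} → F ↭ G → (R : Face → Code → Set) → (∀ {r r′ d} → r ↭ r′ → R r′ d → R r d) →
  ∀ {ds} → Pointwise R (deletions G) ds →
  ∃[ ds′ ] (Pointwise R (deletions F) ds′ × (∀ c → count ds′ c ≡ count ds c))
dels-perm Perm.refl R resp p = _ , p , λ c → refl
dels-perm (Perm.trans q q′) R resp p with dels-perm q′ R resp p
... | _ , p′ , e with dels-perm q R resp p′
... | _ , p″ , e′ = _ , p″ , λ c → trans (e′ c) (e c)
dels-perm (Perm.prep x q) R resp (_∷_ {y = d} r rs)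
  with dels-perm q (λ r → R (x ∷ r)) (resp ∘ Perm.prep x) (PW-unmap rs)
  where
  PW-unmap : ∀ {Γ ds} → Pointwise R (map (x ∷_) Γ) ds → Pointwise (λ r → R (x ∷ r)) Γ ds
  PW-unmap {[]}    []       = []
  PW-unmap {_ ∷ _} (r ∷ rs) = r ∷ PW-unmap rs
... | ds′ , p′ , e = d ∷ ds′ , resp q r ∷ PW-map p′ , λ c → cong₂ _+_ (refl {x = b2n (d == c)}) (e c)
  where
  PW-map : ∀ {Γ ds} → Pointwise (λ r → R (x ∷ r)) Γ ds → Pointwise R (map (x ∷_) Γ) ds
  PW-map []       = []
  PW-map (r ∷ rs) = r ∷ PW-map rs
dels-perm (Perm.swap x y q) R resp (_∷_ {y = d} r (_∷_ {y = d′} r′ rs))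
  with dels-perm q (λ r → R (y ∷ x ∷ r)) (resp ∘ Perm.prep y ∘ Perm.prep x) (PW-unmap rs)
  where
  PW-unmap : ∀ {Γ ds} → Pointwise R (map (y ∷_) (map (x ∷_) Γ)) ds → Pointwise (λ r → R (y ∷ x ∷ r)) Γ ds
  PW-unmap {[]}    []       = []
  PW-unmap {_ ∷ _} (r ∷ rs) = r ∷ PW-unmap rs
... | ds′ , p′ , e = d′ ∷ d ∷ ds′ ,
  resp (Perm.prep y q) r′ ∷ resp (Perm.prep x q) r ∷ PW-map p′ ,
  λ c → trans (cong (λ z → b2n (d′ == c) + (b2n (d == c) + z)) (e c))
        (trans (sym (+-assoc (b2n (d′ == c)) _ _))
          (trans (cong₂ _+_ (+-comm (b2n (d′ == c)) (b2n (d == c))) refl) (+-assoc (b2n (d == c)) _ _)))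
  where
  PW-map : ∀ {Γ ds} → Pointwise (λ r → R (y ∷ x ∷ r)) Γ ds → Pointwise R (map (x ∷_) (map (y ∷_) Γ)) ds
  PW-map []       = []
  PW-map (r ∷ rs) = resp (Perm.swap x y ↭-refl) r ∷ PW-map rs

dels-code : ∀ x → Pointwise (λ r d → length d ≡ length x × suc (weight d) ≡ weight x × r ≡ toF d)
  (deletions (toF x)) (dels x)
dels-code []      = []
dels-code (○ ∷ x) = go (dels-code x)
  where
  go : ∀ {Γ ds} → Pointwise (λ r d → length d ≡ length x × suc (weight d) ≡ weight x × r ≡ toF d) Γ ds →
    Pointwise (λ r d → length d ≡ suc (length x) × suc (weight d) ≡ weight x × r ≡ toF d) Γ (map (○ ∷_) ds)
  go []                  = []
  go ((l , w , e) ∷ rs) = (cong suc l , w , e) ∷ go rs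
dels-code (⊕ ∷ x) = (refl , refl , refl) ∷ PW.map⁺ _ _
  (PW.map (λ { (l , w , refl) → cong suc l , cong suc w , cong (λ n → + suc n ∷ _) (sym l) }) (dels-code x))
dels-code (⊖ ∷ x) = (refl , refl , refl) ∷ PW.map⁺ _ _
  (PW.map (λ { (l , w , refl) → cong suc l , cong suc w , cong (λ n → - (+ suc n) ∷ _) (sym l) }) (dels-code x))

deletions-code : ∀ {n s F x} → Encodes n (suc s) F x →
  ∃[ ds ] (Pointwise (Encodes n s) (deletions F) ds × (∀ c → count ds c ≡ up (λ d → b2n (x == d)) c))
deletions-code {n} {s} {F} {x} h with dels-perm (perm h) (Encodes n s)
    (λ q y → enc (len y) (size y) (↭-trans q (perm y)))
    (PW.map (λ { (l , w , refl) → enc (trans l (len h)) (suc-injective (trans w (size h))) ↭-refl }) (dels-code x))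
... | ds , p , e = ds , p , λ c → trans (e c) (count-dels x c)

ridges-code : ∀ {n s Γ cs} → Pointwise (Encodes n (suc s)) Γ cs →
  ∃[ ds ] (Pointwise (Encodes n s) (concatMap deletions Γ) ds × (∀ c → count ds c ≡ up (count cs) c))
ridges-code []       = [] , [] , λ c → sym (up-0 c)
ridges-code (_∷_ {y = x} h hs) with deletions-code h | ridges-code hs
... | ds , p , e | ds′ , p′ , e′ = ds ++ ds′ , PW.++⁺ p p′ , λ c →
  trans (count-++ ds ds′ c) (trans (cong₂ _+_ (e c) (e′ c)) (sym (up-+ (λ d → b2n (x == d)) _ c)))

cofaces-code : ∀ {n s r d Γ cs} → Encodes n s r d → Pointwise (Encodes n (suc s)) Γ cs →
  length (keep (subᵇ r) Γ) ≡ up (count cs) d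
cofaces-code {d = d} x []       = sym (up-0 d)
cofaces-code {r = r} {d} x (_∷_ {x = F} {y = c} {xs = Γ} y ys) = trans (len-keep (subᵇ r F) refl)
  (trans (cong₂ _+_ (trans (cong b2n (sub-code x y)) (⊑ᵇ-cofacet d c (trans (size y) (cong suc (sym (size x))))))
                    (cofaces-code x ys))
         (sym (up-+ (λ d → b2n (c == d)) _ d)))
  where
  len-keep : ∀ b → subᵇ r F ≡ b → length (keep (subᵇ r) (F ∷ Γ)) ≡ b2n b + length (keep (subᵇ r) Γ)
  len-keep true  e rewrite e = refl
  len-keep false e rewrite e = refl

-- The deletions list a ridge once per cofacet, and `bd` keeps it when there is just one; the kept
-- ridges thus occur once. With at most two cofacets, one means odd.
Rep-bd : ∀ {n s Γ f} → Thin f → Rep n (suc s) Γ f → Rep n s (bd Γ) (∂ f)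
Rep-bd {f = f} t (rep cs p m) with ridges-code p
... | ds , q , e = rep (keep (λ d → cofacets f d ≡ᵇ 1) ds)
  (keep-code _ (λ d → cofacets f d ≡ᵇ 1)
    (λ {r} {d} x → cong (_≡ᵇ 1) (trans (cofaces-code x p) (up-cong m d))) q)
  (λ c → trans (count-keep _ ds c) (trans (cong (if cofacets f c ≡ᵇ 1 then_else 0) (trans (e c) (up-cong m c)))
    (trans (small (cofacets f c) (Thin.thin t c)) (cong b2n (odd-cofacets f c)))))
  where
  small : ∀ n → n ≤ 2 → (if n ≡ᵇ 1 then n else 0) ≡ b2n (odd n)
  small 0 _ = refl
  small 1 _ = refl
  small 2 _ = refl
  small (suc (suc (suc n))) (s≤s (s≤s ()))

Rep-replace : ∀ {n s Δl Bl D B} → Thin B → B ⊆ D → neg B ⊆ D → Disj B (neg B) →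
  Rep n (suc s) Δl D → Rep n (suc s) Bl B → Rep (suc n) (suc s) (replace Δl Bl (+ suc n)) (ext D B)
Rep-replace {D = D} {B} t h h′ d x y = Rep-≗ eq
  (Rep-++ (mk λ { [] () e′ ; (○ ∷ c) e () ; (⊕ ∷ c) () e′ ; (⊖ ∷ c) () e′ })
    (Rep-pad (Rep-minus (⊞-⊆ h h′) x (Rep-++ d y (Rep-neg y))))
    (Rep-++ (cone-Disj ⊕⊖-apart) (Rep-⊕ (Rep-bd t y)) (Rep-⊖ (Rep-bd (Thin-neg t) (Rep-neg y)))))
  where
  eq : cone ○ (D ⊞ (B ⊞ neg B)) ⊞ (cone ⊕ (∂ B) ⊞ cone ⊖ (∂ (neg B))) ≗ ext D B
  eq []      = refl
  eq (○ ∷ c) = xor-identityʳ _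
  eq (⊕ ∷ c) = xor-identityʳ _
  eq (⊖ ∷ c) = ∂-neg B c

Rep-cross : ∀ s → Rep s s (crossC s) (full s)
Rep-cross zero = rep ([] ∷ []) (enc refl refl ↭-refl ∷ []) (λ { [] → refl ; (_ ∷ _) → refl })
Rep-cross (suc s) = Rep-≗ eq (Rep-++ (cone-Disj ⊕⊖-apart) (Rep-⊕ (Rep-cross s)) (Rep-⊖ (Rep-cross s)))
  where
  eq : cone ⊕ (full s) ⊞ cone ⊖ (full s) ≗ full (suc s)
  eq []      = refl
  eq (○ ∷ c) = refl
  eq (⊕ ∷ c) = xor-identityʳ _
  eq (⊖ ∷ c) = refl

open Encodes
open Rep
open Level
open Main

-- The cycle

pathEdges-++ : ∀ (f : ℕ → ℤ) n y r → pathEdges (applyUpTo f (suc n) ++ y ∷ r) ≡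
  pathEdges (applyUpTo f (suc n)) ++ (f n ∷ y ∷ []) ∷ pathEdges (y ∷ r)
pathEdges-++ f zero    y r = refl
pathEdges-++ f (suc n) y r = cong (_ ∷_) (pathEdges-++ (f ∘ suc) n y r)

pathEdges-snoc : ∀ (f : ℕ → ℤ) n → pathEdges (applyUpTo f (suc (suc n))) ≡
  pathEdges (applyUpTo f (suc n)) ++ (f n ∷ f (suc n) ∷ []) ∷ []
pathEdges-snoc f zero    = refl
pathEdges-snoc f (suc n) = cong (_ ∷_) (pathEdges-snoc (f ∘ suc) n)

pathEdges-neg : ∀ (f : ℕ → ℤ) n → pathEdges (applyUpTo (λ i → - f i) n) ≡ negC (pathEdges (applyUpTo f n))
pathEdges-neg f zero          = refl
pathEdges-neg f (suc zero)    = refl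
pathEdges-neg f (suc (suc n)) = cong (_ ∷_) (pathEdges-neg (f ∘ suc) (suc n))

positive : ℕ → ℤ
positive i = + suc i

cycle-split : ∀ n → cycleC (suc n) ≡ pathEdges (applyUpTo positive (suc n)) ++ (+ suc n ∷ - (+ 1) ∷ []) ∷
  (negC (pathEdges (applyUpTo positive (suc n))) ++ (- (+ suc n) ∷ + 1 ∷ []) ∷ [])
cycle-split n = trans (pathEdges-++ positive n _ _)
  (cong (λ r → pathEdges (applyUpTo positive (suc n)) ++ (+ suc n ∷ - (+ 1) ∷ []) ∷ r)
    (trans (pathEdges-++ (λ i → - positive i) n (+ 1) [])
      (cong (_++ ((- (+ suc n) ∷ + 1 ∷ []) ∷ [])) (pathEdges-neg positive (suc n)))))

blank : ℕ → Code
blank n = replicate n ○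

length-blank : ∀ n → length (blank n) ≡ n
length-blank zero    = refl
length-blank (suc n) = cong suc (length-blank n)

weight-blank : ∀ n → weight (blank n) ≡ 0
weight-blank zero    = refl
weight-blank (suc n) = weight-blank n

toF-blank : ∀ n → toF (blank n) ≡ []
toF-blank zero    = refl
toF-blank (suc n) = toF-blank n

length-bottom : ∀ m → length (bottomCode m) ≡ suc m
length-bottom zero    = refl
length-bottom (suc m) = cong suc (length-bottom m)

weight-bottom : ∀ m → weight (bottomCode m) ≡ 1
weight-bottom zero    = refl
weight-bottom (suc m) = weight-bottom m

toF-bottom : ∀ m → toF (bottomCode m) ≡ - (+ 1) ∷ []
toF-bottom zero    = refl
toF-bottom (suc m) = toF-bottom m

pathCodes : ℕ → List Code
pathCodes zero    = (⊕ ∷ ⊕ ∷ []) ∷ []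
pathCodes (suc m) = map (○ ∷_) (pathCodes m) ++ (⊕ ∷ ⊕ ∷ blank (suc m)) ∷ []

Encodes-pad : ∀ {n s Γ cs} → Pointwise (Encodes n s) Γ cs → Pointwise (Encodes (suc n) s) Γ (map (○ ∷_) cs)
Encodes-pad []       = []
Encodes-pad (x ∷ xs) = enc (cong suc (len x)) (size x) (perm x) ∷ Encodes-pad xs

path-code : ∀ m → Pointwise (Encodes (2 + m) 2) (pathEdges (applyUpTo positive (2 + m))) (pathCodes m)
path-code zero    = enc refl refl (Perm.swap _ _ ↭-refl) ∷ []
path-code (suc m) = subst (λ Γ → Pointwise (Encodes (3 + m) 2) Γ (pathCodes (suc m)))
  (sym (pathEdges-snoc positive (suc m)))
  (PW.++⁺ (Encodes-pad (path-code m)) (last ∷ []))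
  where
  last : Encodes (3 + m) 2 (positive (suc m) ∷ positive (2 + m) ∷ []) (⊕ ∷ ⊕ ∷ blank (suc m))
  last = enc (cong (λ z → 3 + z) (length-blank m)) (cong (λ z → 2 + z) (weight-blank m))
    (subst (λ r → positive (suc m) ∷ positive (2 + m) ∷ [] ↭ + suc (suc (suc r)) ∷ + suc (suc r) ∷ toF (blank m)) (sym (length-blank m))
      (subst (λ r → positive (suc m) ∷ positive (2 + m) ∷ [] ↭ + suc (suc (suc m)) ∷ + suc (suc m) ∷ r) (sym (toF-blank m))
        (Perm.swap _ _ ↭-refl)))

edgeCode : ℕ → Code
edgeCode m = ⊕ ∷ bottomCode m

edge-perm : ∀ m → + (2 + m) ∷ - (+ 1) ∷ [] ↭ toF (edgeCode m)
edge-perm m = subst (λ r → + (2 + m) ∷ - (+ 1) ∷ [] ↭ r)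
  (sym (cong₂ (λ n F → + suc n ∷ F) (length-bottom m) (toF-bottom m))) ↭-refl

edge-enc : ∀ m → Encodes (2 + m) 2 (+ (2 + m) ∷ - (+ 1) ∷ []) (edgeCode m)
edge-enc m = enc (cong suc (length-bottom m)) (cong suc (weight-bottom m)) (edge-perm m)

Encodes-neg : ∀ {n s F c} → Encodes n s F c → Encodes n s (negF F) (flip c)
Encodes-neg {F = F} {c} x = enc (trans (length-flip c) (len x)) (trans (weight-flip c) (size x))
    (subst (negF F ↭_) (sym (toF-flip c)) (Perm.map⁺ -_ (perm x)))

cycleCodes : ℕ → List Code
cycleCodes m = pathCodes m ++ edgeCode m ∷ (map flip (pathCodes m) ++ flip (edgeCode m) ∷ [])

cycle-code : ∀ m → Pointwise (Encodes (2 + m) 2) (cycleC (2 + m)) (cycleCodes m)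
cycle-code m = subst (λ Γ → Pointwise (Encodes (2 + m) 2) Γ (cycleCodes m)) (sym (cycle-split (suc m)))
  (PW.++⁺ (path-code m) (edge-enc m ∷ PW.++⁺ (PW.map⁺ _ _ (PW.map Encodes-neg (path-code m)))
    (Encodes-neg (edge-enc m) ∷ [])))

bottom-== : ∀ m c → (bottomCode m == c) ≡ bottom m c
bottom-== m c = Bool-ext
  (λ e → subst (λ z → bottom m z ≡ true) (==⇒≡ (bottomCode m) c e) (bottom-code m))
  (λ e → subst (λ z → (bottomCode m == z) ≡ true) (sym (bottom-true m c e)) (==-refl (bottomCode m)))

edge-== : ∀ m c → (edgeCode m == c) ≡ edge m c
edge-== m []      = refl
edge-== m (○ ∷ c) = refl
edge-== m (⊕ ∷ c) = bottom-== m c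
edge-== m (⊖ ∷ c) = refl

count-cycle : ∀ m c → count (cycleCodes m) c ≡
  (count (pathCodes m) c + b2n (edge m c)) + (count (pathCodes m) (flip c) + b2n (edge m (flip c)))
count-cycle m c = trans (count-++ (pathCodes m) _ c) (trans
  (cong₂ _+_ (refl {x = count (pathCodes m) c}) (cong₂ _+_ (cong b2n (edge-== m c)) (trans (count-++ (map flip (pathCodes m)) _ c)
    (cong₂ _+_ (count-flip (pathCodes m) c)
      (trans (+-identityʳ _) (cong b2n (trans (==-flip (edgeCode m) c) (edge-== m (flip c)))))))))
  (sym (+-assoc (count (pathCodes m) c) _ _)))

∂-bottom-== : ∀ m c → ∂ (bottom m) c ≡ (blank (suc m) == c)
∂-bottom-== zero    c = trans (∂-bottom0 c) (aux c)
  where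
  aux : ∀ c → pad (full 0) c ≡ (blank 1 == c)
  aux []          = refl
  aux (○ ∷ [])    = refl
  aux (○ ∷ _ ∷ _) = refl
  aux (⊕ ∷ _)     = refl
  aux (⊖ ∷ _)     = refl
∂-bottom-== (suc m) c = trans (∂-pad (bottom m) c) (aux c)
  where
  aux : ∀ c → pad (∂ (bottom m)) c ≡ (blank (2 + m) == c)
  aux []      = refl
  aux (○ ∷ c) = ∂-bottom-== m c
  aux (⊕ ∷ _) = refl
  aux (⊖ ∷ _) = refl

count-path : ∀ m s c → count (pathCodes (suc m)) (s ∷ c) ≡
  count (map (○ ∷_) (pathCodes m)) (s ∷ c) + (b2n ((⊕ ∷ ⊕ ∷ blank (suc m)) == (s ∷ c)) + 0)
count-path m s c = count-++ (map (○ ∷_) (pathCodes m)) _ (s ∷ c)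

count-path-○ : ∀ m c → count (pathCodes (suc m)) (○ ∷ c) ≡ count (pathCodes m) c
count-path-○ m c = trans (count-path m ○ c) (trans (+-identityʳ _) (count-same ○ (pathCodes m) c))

count-path-⊖ : ∀ m c → count (pathCodes (suc m)) (⊖ ∷ c) ≡ 0
count-path-⊖ m c = trans (count-path m ⊖ c) (trans (+-identityʳ _) (count-diff ○ ⊖ (pathCodes m) c refl))

-- The new edges of the cycle join n + 1 to n and to −1.
count-path-⊕ : ∀ m c → count (pathCodes (suc m)) (⊕ ∷ c) + b2n (bottom (suc m) c) ≡ b2n (∂ (edge m) c)
count-path-⊕ m c = trans (cong₂ _+_ (trans (count-path m ⊕ c)
  (cong₂ _+_ (count-diff ○ ⊕ (pathCodes m) c refl) (+-identityʳ _))) refl) (aux c)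
  where
  aux : ∀ c → b2n ((⊕ ∷ blank (suc m)) == c) + b2n (bottom (suc m) c) ≡ b2n (∂ (edge m) c)
  aux []      = refl
  aux (○ ∷ c) = cong b2n (sym (trans (half-0 (bottom m) 𝟎 c) (xor-identityʳ _)))
  aux (⊕ ∷ c) = trans (+-identityʳ _) (cong b2n (sym (∂-bottom-== m c)))
  aux (⊖ ∷ c) = cong b2n (sym (∂-𝟎 c))

-- Here a and b count a code in the path and in its negative, and e, e′ tell whether it is one of
-- the two edges that join them. As the total is at most one, subtracting these edges agrees with
-- adding them modulo 2.
xor-arith : ∀ a b d e e′ → (a + b2n e) + (b + b2n e′) ≡ b2n d → a + b ≡ b2n (d xor (e xor e′))
xor-arith zero    zero    false false false h = refl
xor-arith zero    zero    true  false true  h = refl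
xor-arith zero    zero    true  true  false h = refl
xor-arith zero    (suc _) true  false false h = trans (cong suc (sym (+-identityʳ _))) h
xor-arith (suc a) b       true  false false h = trans (sym (cong₂ _+_ (+-identityʳ (suc a)) (+-identityʳ b))) h
xor-arith zero    (suc b) true  false true  h = ⊥-elim (1+n≢0 (trans (+-comm 1 b) (suc-injective h)))
xor-arith (suc a) b       true  false true  h = ⊥-elim (1+n≢0 (trans (sym (trans (cong₂ _+_ refl (+-comm b 1)) (+-suc (a + 0) b))) (suc-injective h)))
xor-arith zero    (suc b) true  true  e′    h = ⊥-elim (1+n≢0 (suc-injective h))
xor-arith (suc a) b       true  true  e′    h = ⊥-elim (1+n≢0 (trans (sym (cong (_+ (b + b2n e′)) (+-comm a 1))) (suc-injective h)))

cycle-mult : ∀ m c → count (cycleCodes m) c ≡ b2n (Δc 0 m c)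
cycle-mult zero []              = refl
cycle-mult zero (○ ∷ [])        = refl
cycle-mult zero (⊕ ∷ [])        = refl
cycle-mult zero (⊖ ∷ [])        = refl
cycle-mult zero (○ ∷ ○ ∷ [])    = refl
cycle-mult zero (○ ∷ ⊕ ∷ [])    = refl
cycle-mult zero (○ ∷ ⊖ ∷ [])    = refl
cycle-mult zero (⊕ ∷ ○ ∷ [])    = refl
cycle-mult zero (⊕ ∷ ⊕ ∷ [])    = refl
cycle-mult zero (⊕ ∷ ⊖ ∷ [])    = refl
cycle-mult zero (⊖ ∷ ○ ∷ [])    = refl
cycle-mult zero (⊖ ∷ ⊕ ∷ [])    = refl
cycle-mult zero (⊖ ∷ ⊖ ∷ [])    = refl
cycle-mult zero (○ ∷ ○ ∷ _ ∷ _) = refl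
cycle-mult zero (○ ∷ ⊕ ∷ _ ∷ _) = refl
cycle-mult zero (○ ∷ ⊖ ∷ _ ∷ _) = refl
cycle-mult zero (⊕ ∷ ○ ∷ _ ∷ _) = refl
cycle-mult zero (⊕ ∷ ⊕ ∷ _ ∷ _) = refl
cycle-mult zero (⊕ ∷ ⊖ ∷ _ ∷ _) = refl
cycle-mult zero (⊖ ∷ ○ ∷ _ ∷ _) = refl
cycle-mult zero (⊖ ∷ ⊕ ∷ _ ∷ _) = refl
cycle-mult zero (⊖ ∷ ⊖ ∷ _ ∷ _) = refl
cycle-mult (suc m) []      = trans (count-cycle (suc m) [])
  (cong₂ (λ x y → (x + 0) + (y + 0)) z z)
  where
  z : count (pathCodes (suc m)) [] ≡ 0
  z = trans (count-++ (map (○ ∷_) (pathCodes m)) _ []) (cong₂ _+_ (count-[] ○ (pathCodes m)) refl)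
cycle-mult (suc m) (○ ∷ c) = trans (count-cycle (suc m) (○ ∷ c))
  (trans (cong₂ _+_ (trans (+-identityʳ _) (count-path-○ m c)) (trans (+-identityʳ _) (count-path-○ m (flip c))))
    (xor-arith (count (pathCodes m) c) (count (pathCodes m) (flip c)) (Δc 0 m c) (edge m c) (edge m (flip c))
      (trans (sym (count-cycle m c)) (cycle-mult m c))))
cycle-mult (suc m) (⊕ ∷ c) = trans (count-cycle (suc m) (⊕ ∷ c))
  (trans (cong₂ _+_ (count-path-⊕ m c) (trans (+-identityʳ _) (count-path-⊖ m (flip c)))) (+-identityʳ _))
cycle-mult (suc m) (⊖ ∷ c) = trans (count-cycle (suc m) (⊖ ∷ c))
  (cong₂ _+_ (trans (+-identityʳ _) (count-path-⊖ m c)) (count-path-⊕ m (flip c)))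

Rep-cycle : ∀ m → Rep (2 + m) 2 (cycleC (2 + m)) (Δc 0 m)
Rep-cycle m = rep (cycleCodes m) (cycle-code m) (cycle-mult m)

Rep-edge : ∀ m → Rep (2 + m) 2 (B1 0 (2 + m)) (edge m)
Rep-edge m = rep (edgeCode m ∷ [])
  (enc (len x) (size x) (↭-trans (Perm.swap _ _ ↭-refl) (perm x)) ∷ [])
  (λ c → trans (+-identityʳ _) (cong b2n (edge-== m c)))
  where x = edge-enc m

-- Odd and even dimensions: d = 1 + ev k and d = 2 + ev k

ev : ℕ → ℕ
ev zero    = zero
ev (suc k) = suc (suc (ev k))

width-ev : ∀ k → width k ≡ 2 + ev k
width-ev zero    = refl
width-ev (suc k) = cong (λ z → 2 + z) (width-ev k)

⌊ev/2⌋ : ∀ k → ⌊ ev k /2⌋ ≡ k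
⌊ev/2⌋ zero    = refl
⌊ev/2⌋ (suc k) = cong suc (⌊ev/2⌋ k)

⌊1+ev/2⌋ : ∀ k → ⌊ suc (ev k) /2⌋ ≡ k
⌊1+ev/2⌋ zero    = refl
⌊1+ev/2⌋ (suc k) = cong suc (⌊1+ev/2⌋ k)

≤⇒≤ᵇ≡ : ∀ {i j} → i ≤ j → (i ≤ᵇ j) ≡ true
≤⇒≤ᵇ≡ {i} {j} h with i ≤ᵇ j | ≤⇒≤ᵇ h
... | true | _ = refl

>⇒≤ᵇ≡ : ∀ {i j} → j < i → (i ≤ᵇ j) ≡ false
>⇒≤ᵇ≡ {i} {j} h with i ≤ᵇ j | ≤ᵇ⇒≤ i j
... | false | _ = refl
... | true  | f = ⊥-elim (<⇒≱ h (f _))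

≡ᵇ-refl : ∀ i → (i ≡ᵇ i) ≡ true
≡ᵇ-refl zero    = refl
≡ᵇ-refl (suc i) = ≡ᵇ-refl i

joined : Level → ℕ → ℕ → Cx
joined P i n = joinV (Bl P i n) (+ suc n) ++ joinV (negC (Bpred P i n)) (- (+ suc n))

Bl-low : ∀ d P i n → i ≤ ⌊ d /2⌋ → Bl (step d P) i (suc n) ≡ joined P i n
Bl-low d P i n h rewrite ≤⇒≤ᵇ≡ h = refl

Bl-top : ∀ d P i n → ⌊ d /2⌋ < suc i → suc i ≡ ⌈ d /2⌉ →
  Bl (step d P) (suc i) (suc n) ≡ minusC (Δl (step d P) (suc n)) (joined P i n)
Bl-top d P i n h e rewrite >⇒≤ᵇ≡ h | sym e | ≡ᵇ-refl i = refl

Δl-zero : ∀ d P → Δl (step d P) (suc d + 0) ≡ crossC (suc d)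
Δl-zero d P rewrite m+n∸m≡n d 0 = refl

Δl-suc : ∀ d P i m → ⌈ d /2⌉ ≡ suc i → Δl (step d P) (suc d + suc m) ≡
  replace (Δl (step d P) (suc d + m)) (joined P i (d + m)) (+ suc (suc d + m))
Δl-suc d P i m e rewrite m+n∸m≡n d (suc m) | m+n∸m≡n d m | e = refl

Rep-[] : ∀ {n s n′ s′ f} → Rep n s [] f → Rep n′ s′ [] (half f 𝟎)
Rep-[] {f = f} (rep [] [] m) = rep [] [] aux
  where
  aux : ∀ c → 0 ≡ b2n (half f 𝟎 c)
  aux []      = refl
  aux (○ ∷ c) = refl
  aux (⊕ ∷ c) = m c
  aux (⊖ ∷ c) = refl

-- `Bpred` matches the shift j = i + 1: it is the empty complex at j = 0.
RepSeq : ℕ → ℕ → Level → Seq → ℕ → Set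
RepSeq n s P g j = ∀ m → Rep (n + m) s (Bpred P j (n + m)) (g j m)

RepSeq-half : ∀ {n s P Q g J} → (∀ i n → suc i ≤ J → Bl Q i (suc n) ≡ joined P i n) →
  Ranged J (RepSeq n s P g) → Ranged J (RepSeq (suc n) (suc s) Q (halves g))
RepSeq-half E H zero    r m = Rep-[] (H 0 r m)
RepSeq-half {n} {s} {Q = Q} {g} E H (suc j) r m =
  subst (λ Γ → Rep (suc n + m) (suc s) Γ (halves g (suc j) m)) (sym (E j (n + m) r))
    (Rep-half (H (suc j) r m) (H j (≤-trans (n≤1+n j) r) m))

RepΔ : ℕ → Set
RepΔ k = ∀ m → Rep (width k + m) (width k) (Δl (level (suc (ev k))) (width k + m)) (Δc k m)

RepB : ℕ → Set
RepB k = Ranged (suc (suc k)) (RepSeq (width k) (width k) (level (suc (ev k))) (balls k))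

Thin-pre′ : ∀ k m → Thin (pre k (suc k) m)
Thin-pre′ k m = Thin-pre k (suc k) ≤-refl m

RepB-0 : RepB 0
RepB-0 zero                h m = rep [] [] (λ c → refl)
RepB-0 (suc zero)          h m = Rep-edge m
RepB-0 (suc (suc zero))    h m = Rep-minus (pre⊆Δ 0 m) (Rep-cycle m) (Rep-edge m)
RepB-0 (suc (suc (suc j))) (s≤s (s≤s ()))

module OddStep (k : ℕ) (H : RepB k) where
  P = level (suc (ev k))
  Q = level (suc (suc (ev k)))
  R = level (suc (suc (suc (ev k))))

  even : Ranged (suc (suc k)) (RepSeq (suc (width k)) (suc (width k)) Q (halves (balls k)))
  even = RepSeq-half (λ i n h → Bl-low (suc (suc (ev k))) P i n
    (subst (λ z → i ≤ suc z) (sym (⌊ev/2⌋ k)) (≤-pred h))) H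

  odd-joined : ∀ i n → suc i ≤ suc (suc k) → Bl R i (suc n) ≡ joined Q i n
  odd-joined i n h = Bl-low (suc (suc (suc (ev k)))) Q i n
    (subst (λ z → i ≤ suc z) (sym (⌊1+ev/2⌋ k)) (≤-pred h))

  odd-low : Ranged (suc (suc k)) (RepSeq (suc (suc (width k))) (suc (suc (width k))) R (pre (suc k)))
  odd-low = RepSeq-half odd-joined even

  -- the ball B^{d,⌈d/2⌉-1}
  middle : ∀ m → Rep (width (suc k) + m) (width (suc k)) (joined Q (suc k) (suc (width k + m))) (pre (suc k) (suc (suc k)) m)
  middle m = subst (λ Γ → Rep (width (suc k) + m) (width (suc k)) Γ (pre (suc k) (suc (suc k)) m))
    (odd-joined (suc k) (suc (width k + m)) ≤-refl) (odd-low (suc (suc k)) ≤-refl m)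

  d : ℕ
  d = suc (suc (suc (ev k)))

  ⌈d/2⌉ : ⌈ d /2⌉ ≡ suc (suc k)
  ⌈d/2⌉ = cong (λ z → 2 + z) (⌊ev/2⌋ k)

  width-d : width (suc k) ≡ suc d
  width-d = width-ev (suc k)

  RepΔ-step : RepΔ (suc k)
  RepΔ-step zero = subst₂ (λ Γ n → Rep n (width (suc k)) Γ (Δc (suc k) 0))
    (sym (trans (cong (λ z → Δl R (z + 0)) width-d) (trans (Δl-zero d Q) (cong crossC (sym width-d)))))
    (sym (+-identityʳ (width (suc k)))) (Rep-cross (width (suc k)))
  RepΔ-step (suc m) = subst₂ (λ Γ n → Rep n (width (suc k)) Γ (Δc (suc k) (suc m)))
    (sym (trans (cong (λ z → Δl R (z + suc m)) width-d) (trans (Δl-suc d Q (suc k) m ⌈d/2⌉)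
      (cong (λ z → replace (Δl R (z + m)) (joined Q (suc k) (z ∸ 1 + m)) (+ suc (z + m))) (sym width-d)))))
    (sym (+-suc (width (suc k)) m))
    (Rep-replace (Thin-pre′ (suc k) m) (pre⊆Δ (suc k) m) (negpre⊆Δ (suc k) m) (pre-neg (suc k) m)
      (RepΔ-step m) (middle m))

  RepB-step : RepB (suc k)
  RepB-step = Ranged-suc
    (λ j h m → subst (Rep _ _ _) (sym (balls-low (suc k) j m h)) (odd-low j h m))
    (λ m → subst₂ (Rep _ _) (sym (Bl-top d Q (suc k) (suc (width k + m))
        (subst (λ z → suc (suc z) ≤ suc (suc k)) (sym (⌊1+ev/2⌋ k)) ≤-refl) (sym ⌈d/2⌉)))
      (sym (balls-top (suc k) m)) (Rep-minus (pre⊆Δ (suc k) m) (RepΔ-step m) (middle m)))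

repB : ∀ k → RepB k
repB zero    = RepB-0
repB (suc k) = OddStep.RepB-step k (repB k)

repΔ : ∀ k → RepΔ k
repΔ zero    = Rep-cycle
repΔ (suc k) = OddStep.RepΔ-step k (repB k)

open Encodes
open Rep
open Main

-- Faces given by lists of vertices

In : ℕ → Chain → Face → Set
In n f σ = ∃[ F ] (length F ≡ n × f F ≡ true × All (_∈ toF F) σ)

∈ᶜ⇒In : ∀ {n s Γ f σ} → Rep n s Γ f → σ ∈ᶜ Γ → In n f σ
∈ᶜ⇒In {n} {s} {f = f} {σ} (rep cs p m) = go p (λ c h → pos (m c) h)
  where
  pos : ∀ {x b} → x ≡ b2n b → 1 ≤ x → b ≡ true
  pos {b = true}  e h = refl
  pos {b = false} refl ()
  go : ∀ {Γ cs} → Pointwise (Encodes n s) Γ cs → (∀ c → 1 ≤ count cs c → f c ≡ true) → σ ∈ᶜ Γ → In n f σ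
  go (_∷_ {y = c} {ys = cs} x _) h (here σ⊆) = c , len x , h c (subst (λ z → 1 ≤ b2n z + count cs c) (sym (==-refl c)) (s≤s z≤n)) ,
    All.map (∈-resp-↭ (perm x)) σ⊆
  go (_ ∷ xs) h (there i)  = go xs (λ c e → h c (≤-trans e (m≤n+m _ _))) i

In⇒∈ᶜ : ∀ {n n′ s Γ f σ} → Rep n s Γ f → In n′ f σ → σ ∈ᶜ Γ
In⇒∈ᶜ {n} {s = s} {σ = σ} (rep cs p m) (F , _ , fF , σ⊆) =
  go p (subst (1 ≤_) (sym (trans (m F) (cong b2n fF))) ≤-refl)
  where
  go : ∀ {Γ cs} → Pointwise (Encodes n s) Γ cs → 1 ≤ count cs F → σ ∈ᶜ Γ
  go (_∷_ {y = c} x xs) h with c == F in e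
  ... | false = there (go xs h)
  ... | true  with ==⇒≡ c F e
  ...   | refl = here (All.map (∈-resp-↭ (↭-sym (perm x))) σ⊆)

vertex-sign : ℤ → Status
vertex-sign (+ _)    = ⊕
vertex-sign -[1+ _ ] = ⊖

insert : ℤ → Code → Code
insert v []      = []
insert v (s ∷ c) with ∣ v ∣ ≟ suc (length c)
... | yes _ = vertex-sign v ∷ c
... | no  _ = s ∷ insert v c

length-insert : ∀ v c → length (insert v c) ≡ length c
length-insert v []      = refl
length-insert v (s ∷ c) with ∣ v ∣ ≟ suc (length c)
... | yes _ = refl
... | no  _ = cong suc (length-insert v c)

weight-∷ : ∀ s c → weight c ≤ weight (s ∷ c)
weight-∷ ○ c = ≤-refl
weight-∷ ⊕ c = n≤1+n _
weight-∷ ⊖ c = n≤1+n _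

weight-∷-mono : ∀ s {c d} → weight c ≤ suc (weight d) → weight (s ∷ c) ≤ suc (weight (s ∷ d))
weight-∷-mono ○ h = h
weight-∷-mono ⊕ h = s≤s h
weight-∷-mono ⊖ h = s≤s h

weight-insert : ∀ v c → weight (insert v c) ≤ suc (weight c)
weight-insert v []      = z≤n
weight-insert v (s ∷ c) with ∣ v ∣ ≟ suc (length c)
weight-insert (+ _)    (s ∷ c) | yes _ = s≤s (weight-∷ s c)
weight-insert -[1+ _ ] (s ∷ c) | yes _ = s≤s (weight-∷ s c)
... | no  _ = weight-∷-mono s (weight-insert v c)

insert-∈ : ∀ v c → 1 ≤ ∣ v ∣ → ∣ v ∣ ≤ length c → v ∈ toF (insert v c)
insert-∈ v []      h h′ = ⊥-elim (<⇒≱ h h′)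
insert-∈ v (s ∷ c) h h′ with ∣ v ∣ ≟ suc (length c)
insert-∈ (+ _)    (s ∷ c) h h′ | yes refl = here refl
insert-∈ -[1+ _ ] (s ∷ c) h h′ | yes refl = here refl
... | no  ne = ∈-there s (insert v c) (insert-∈ v c h (≤-pred (≤∧≢⇒< h′ ne)))

∈-∷-length : ∀ s (c : Code) {d : Code} {v} → length c ≡ length d → v ≡ label s (suc (length c)) → s ≢ ○ → v ∈ toF (s ∷ d)
∈-∷-length ○ c l e h = ⊥-elim (h refl)
∈-∷-length ⊕ c l e h = here (trans e (cong (λ n → + suc n) l))
∈-∷-length ⊖ c l e h = here (trans e (cong (λ n → - (+ suc n)) l))

insert-keeps : ∀ v c {w} → w ∈ toF c → w ≢ - v → w ∈ toF (insert v c)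
insert-keeps v (s ∷ c) w∈ h with ∣ v ∣ ≟ suc (length c) | ∈-∷ s c w∈
insert-keeps v (s ∷ c) w∈ h        | yes _    | inj₂ w∈′ = ∈-there (vertex-sign v) c w∈′
insert-keeps (+ _) (⊕ ∷ c) w∈ h    | yes refl | inj₁ (_ , refl) = here refl
insert-keeps (+ _) (⊖ ∷ c) w∈ h    | yes refl | inj₁ (_ , refl) = ⊥-elim (h refl)
insert-keeps -[1+ _ ] (⊕ ∷ c) w∈ h | yes refl | inj₁ (_ , refl) = ⊥-elim (h refl)
insert-keeps -[1+ _ ] (⊖ ∷ c) w∈ h | yes refl | inj₁ (_ , refl) = here refl
insert-keeps v (○ ∷ c) w∈ h        | yes _    | inj₁ (s≢○ , _)  = ⊥-elim (s≢○ refl)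
... | no _ | inj₁ (s≢○ , e)  = ∈-∷-length s c (sym (length-insert v c)) e s≢○
... | no _ | inj₂ w∈′ = ∈-there s (insert v c) (insert-keeps v c w∈′ h)

encode : ℕ → Face → Code
encode n = foldr insert (blank n)

length-encode : ∀ n S → length (encode n S) ≡ n
length-encode n []      = length-blank n
length-encode n (v ∷ S) = trans (length-insert v (encode n S)) (length-encode n S)

-- An inequality, because S may repeat vertices.
weight-encode : ∀ n S → weight (encode n S) ≤ length S
weight-encode n []      = ≤-reflexive (weight-blank n)
weight-encode n (v ∷ S) = ≤-trans (weight-insert v (encode n S)) (s≤s (weight-encode n S))

encode-∈ : ∀ n S → All (InV n) S → (∀ v → v ∈ S → - v ∉ S) → All (_∈ toF (encode n S)) S
encode-∈ n []      _              h = []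
encode-∈ n (v ∷ S) ((p , q) ∷ hs) h =
  insert-∈ v (encode n S) p (subst (∣ v ∣ ≤_) (sym (length-encode n S)) q) ∷
  All.tabulate (λ {w} w∈ → insert-keeps v (encode n S)
    (All.lookup (encode-∈ n S hs (λ u u∈ → h u (there u∈) ∘ there)) w∈)
    (λ { refl → h v (here refl) (there w∈) }))

∈-flip : ∀ c {v} → v ∈ toF c → - v ∈ toF (flip c)
∈-flip c v∈ = subst (_ ∈_) (sym (toF-flip c)) (∈-map⁺ -_ v∈)

∉-neg : ∀ c {v} → v ∈ toF c → - v ∉ toF c
∉-neg (○ ∷ c) v∈ v∈′ = ∉-neg c v∈ v∈′
∉-neg (⊕ ∷ c) (here refl) (there v∈) = 1+n≰n (toF-≤ c v∈)
∉-neg (⊕ ∷ c) {v} (there v∈) (here e) = 1+n≰n (subst (_≤ length c) (trans (sym (∣-i∣≡∣i∣ v)) (cong ∣_∣ e)) (toF-≤ c v∈))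
∉-neg (⊕ ∷ c) (there v∈) (there v∈′) = ∉-neg c v∈ v∈′
∉-neg (⊖ ∷ c) (here refl) (there v∈) = 1+n≰n (toF-≤ c v∈)
∉-neg (⊖ ∷ c) {v} (there v∈) (here e) = 1+n≰n (subst (_≤ length c) (trans (sym (∣-i∣≡∣i∣ v)) (cong ∣_∣ e)) (toF-≤ c v∈))
∉-neg (⊖ ∷ c) (there v∈) (there v∈′) = ∉-neg c v∈ v∈′

∈-suffix : ∀ τ ρ {v} → ∣ v ∣ ≤ length ρ → v ∈ toF (τ ++ ρ) → v ∈ toF ρ
∈-suffix []      ρ h v∈ = v∈
∈-suffix (s ∷ τ) ρ h v∈ = ∈-suffix τ ρ h (∈-tail s (τ ++ ρ)
  (≤-trans h (≤-trans (m≤n+m _ (length τ)) (≤-reflexive (sym (length-++ τ))))) v∈)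

suffix-∈ : ∀ τ ρ {v} → v ∈ toF ρ → v ∈ toF (τ ++ ρ)
suffix-∈ []      ρ v∈ = v∈
suffix-∈ (s ∷ τ) ρ v∈ = ∈-there s (τ ++ ρ) (suffix-∈ τ ρ v∈)

∈-prefix : ∀ τ ρ ρ′ {v} → length ρ ≡ length ρ′ → length ρ < ∣ v ∣ → v ∈ toF (τ ++ ρ) → v ∈ toF (τ ++ ρ′)
∈-prefix []      ρ ρ′ l h v∈ = ⊥-elim (<⇒≱ h (toF-≤ ρ v∈))
∈-prefix (s ∷ τ) ρ ρ′ l h v∈ with ∈-∷ s (τ ++ ρ) v∈
... | inj₁ (s≢○ , e) = ∈-∷-length s (τ ++ ρ) (trans (length-++ τ) (trans (cong (λ z → length τ + z) l) (sym (length-++ τ)))) e s≢○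
... | inj₂ v∈′ = ∈-there s (τ ++ ρ′) (∈-prefix τ ρ ρ′ l h v∈′)

last-two : ∀ (c : Code) {n} → length c ≡ 2 + n → ∃[ τ ] ∃[ s ] ∃[ t ] c ≡ τ ++ s ∷ t ∷ []
last-two (s ∷ t ∷ [])    l = [] , s , t , refl
last-two (u ∷ s ∷ t ∷ c) l with last-two (s ∷ t ∷ c) refl
... | τ , s′ , t′ , e = u ∷ τ , s′ , t′ , cong (u ∷_) e

⊑-++ : ∀ {c d} ρ → c ⊑ d → (c ++ ρ) ⊑ (d ++ ρ)
⊑-++ ρ []         = ⊑-refl ρ
⊑-++ ρ (skip s x) = skip s (⊑-++ ρ x)
⊑-++ ρ (same s x) = same s (⊑-++ ρ x)

weight-prefix : ∀ τ ρ → weight τ ≤ weight (τ ++ ρ)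
weight-prefix []      ρ = z≤n
weight-prefix (○ ∷ τ) ρ = weight-prefix τ ρ
weight-prefix (⊕ ∷ τ) ρ = s≤s (weight-prefix τ ρ)
weight-prefix (⊖ ∷ τ) ρ = s≤s (weight-prefix τ ρ)

In-neg : ∀ {n f σ} → (∀ c → f (flip c) ≡ f c) → In n f σ → In n f (negF σ)
In-neg h (F , l , e , σ⊆) = flip F , trans (length-flip F) l , trans (h F) e ,
  All.map⁺ (All.map (∈-flip F) σ⊆)

-- The four special edges

tails : Code
tails = ⊕ ∷ ⊕ ∷ []

InV-3 : ∀ {n} v → InVMinus n (+ 1) (+ 2) v → 2 < ∣ v ∣
InV-3 (+ 0) ((() , _) , _)
InV-3 (+ 1) (_ , h , _) = ⊥-elim (h refl)
InV-3 (+ 2) (_ , _ , h , _) = ⊥-elim (h refl)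
InV-3 (+ suc (suc (suc n))) _ = s≤s (s≤s (s≤s z≤n))
InV-3 -[1+ 0 ] (_ , _ , _ , h , _) = ⊥-elim (h refl)
InV-3 -[1+ 1 ] (_ , _ , _ , _ , h) = ⊥-elim (h refl)
InV-3 -[1+ suc (suc n) ] _ = s≤s (s≤s (s≤s z≤n))

InV-top : ∀ {N} n v → InVMinus N (+ suc n) (+ suc (suc n)) v → ∣ v ∣ ≤ suc (suc n) → ∣ v ∣ ≤ n
InV-top n v (_ , h₁ , h₂ , h₃ , h₄) h = ≤-pred (≤∧≢⇒< (≤-pred (≤∧≢⇒< h (ne v h₂ h₄))) (ne v h₁ h₃))
  where
  ne : ∀ {m} v → v ≢ + suc m → - v ≢ + suc m → ∣ v ∣ ≢ suc m
  ne (+ _)    h h′ refl = h refl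
  ne -[1+ _ ] h h′ refl = h′ refl

pairless : Face → Set
pairless S = (v : ℤ) → v ∈ S → - v ∉ S

module Special (κ m : ℕ) where
  private
    k = suc κ
    n = width k + m

  -- S avoids ±1 and ±2, so the last two statuses of its code can be discarded and replaced by ⊕ ⊕
  -- once the rest is completed to a facet of the link.
  bottom-face : ∀ S → length S ≤ k → All (InVMinus n (+ 1) (+ 2)) S → pairless S → In n (Δc k m) (+ 1 ∷ + 2 ∷ S)
  bottom-face S h hs p = go (encode n S) (length-encode n S) (≤-trans (weight-encode n S) h)
    (All.zip (All.map (λ {v} → InV-3 {n} v) hs , encode-∈ n S (All.map proj₁ hs) p))
    where
    go : ∀ σ → length σ ≡ n → weight σ ≤ k → All (λ v → 2 < ∣ v ∣ × v ∈ toF σ) S → In n (Δc k m) (+ 1 ∷ + 2 ∷ S)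
    go σ l w a with last-two σ {width κ + m} l
    ... | τ , s , t , refl = build (LinkFamily.Δ-cs k m τ l′ (subst (weight τ ≤_) (sym (+-identityʳ k)) (≤-trans (weight-prefix τ _) w)))
      where
      l″ : 2 + length τ ≡ 2 + (LinkFamily.width k + m)
      l″ = trans (trans (+-comm 2 (length τ)) (sym (length-++ τ))) (trans l (cong (λ z → z + m) (width-+2 k)))
      l′ : length τ ≡ LinkFamily.width k + m
      l′ = suc-injective (suc-injective l″)
      build : Cl (LinkFamily.Δc k m) τ → In n (Δc k m) (+ 1 ∷ + 2 ∷ S)
      build (F , e , x) = F ++ tails ,
        trans (length-++ F) (trans (+-comm (length F) 2) (trans (cong (λ z → 2 + z) (trans (sym (⊑-length x)) l′))
          (cong (λ z → z + m) (sym (width-+2 k))))) ,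
        trans (proj₁ (Restricts.at (R-Δ k m) F (trans (sym (⊑-length x)) l′))) e ,
        suffix-∈ F tails (there (here refl)) ∷ suffix-∈ F tails (here refl) ∷
        All.map (λ { (h , v∈) → ⊑⇒⊆ (⊑-++ tails x) (∈-prefix τ (s ∷ t ∷ []) tails refl h v∈) }) a

  -- The link is a sphere of its own family, and these are invariant under `flip`: only the part of
  -- the facet before ⊕ ⊕ is negated.
  bottom-sym : ∀ σ → All (λ v → (v ≢ + 1) × (v ≢ + 2)) σ → In n (Δc k m) (+ 1 ∷ + 2 ∷ σ) → In n (Δc k m) (+ 1 ∷ + 2 ∷ negF σ)
  bottom-sym σ ne (F , l , e , x) with last-two F {width κ + m} l
  bottom-sym σ ne (_ , l , e , x₁ ∷ x₂ ∷ x) | τ , s , t , refl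
    with refl ← ∈-head⊕ t [] (∈-tail s (t ∷ []) (s≤s z≤n) (∈-suffix τ (s ∷ t ∷ []) (s≤s z≤n) x₁))
       | refl ← ∈-head⊕ s (t ∷ []) (∈-suffix τ (s ∷ t ∷ []) ≤-refl x₂) =
    flip τ ++ tails , trans (length-++ (flip τ)) (trans (cong (_+ 2) (length-flip τ)) (trans (sym (length-++ τ)) l)) ,
    trans (proj₁ (Restricts.at (R-Δ k m) (flip τ) (trans (length-flip τ) l′)))
      (trans (sphere-flip (LinkFamily.width k) (LinkFamily.pre k (suc k)) m τ)
        (trans (sym (proj₁ (Restricts.at (R-Δ k m) τ l′))) e)) ,
    suffix-∈ (flip τ) tails (there (here refl)) ∷ suffix-∈ (flip τ) tails (here refl) ∷
    All.map⁺ (All.zipWith (λ { {v} ((v≢1 , v≢2) , v∈) → ∈-prefix (flip τ) (flip tails) tails refl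
      (subst (2 <_) (sym (∣-i∣≡∣i∣ v)) (far v v≢1 v≢2 v∈)) (subst (λ c → - v ∈ toF c) (flip-++ τ tails) (∈-flip (τ ++ tails) v∈)) })
      (ne , x))
    where
    l′ : length τ ≡ LinkFamily.width k + m
    l′ = suc-injective (suc-injective (trans (trans (+-comm 2 (length τ)) (sym (length-++ τ))) (trans l (cong (λ z → z + m) (width-+2 k)))))
    far : ∀ v → v ≢ + 1 → v ≢ + 2 → v ∈ toF (τ ++ tails) → 2 < ∣ v ∣
    far v h₁ h₂ v∈ with ∣ v ∣ ≤? 2
    ... | no  h = ≰⇒> h
    ... | yes h with ∈-suffix τ tails h v∈
    ...   | here e           = ⊥-elim (h₂ e)
    ...   | there (here e)   = ⊥-elim (h₁ e)

  -- the vertices n − 1 and n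
  p q : ℤ
  p = + suc (width κ + m)
  q = + suc (suc (width κ + m))

  top-face : ∀ S → length S ≤ k → All (InVMinus n p q) S → pairless S → In n (Δc k m) (p ∷ q ∷ S)
  top-face S h hs pl = go (encode n S) (length-encode n S) (≤-trans (weight-encode n S) h) (encode-∈ n S (All.map proj₁ hs) pl)
    where
    go : ∀ σ → length σ ≡ n → weight σ ≤ k → All (_∈ toF σ) S → In n (Δc k m) (p ∷ q ∷ S)
    go (s ∷ t ∷ τ) l w a with Δ-cs κ m τ (suc-injective (suc-injective l))
      (subst (weight τ ≤_) (+-comm 1 κ) (≤-trans (weight-∷ t τ) (≤-trans (weight-∷ s (t ∷ τ)) w)))
    ... | F , e , x = ⊕ ∷ ⊕ ∷ F , cong (λ z → 2 + z) lF , trans (link-top κ m F) e ,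
      there (here (cong (λ z → + suc z) (sym lF))) ∷ here (cong (λ z → + suc (suc z)) (sym lF)) ∷
      All.zipWith (λ { {v} (h , v∈) → there (there (⊑⇒⊆ x
        (let h′ = subst (∣ v ∣ ≤_) (sym (suc-injective (suc-injective l))) (InV-top (width κ + m) v h (proj₂ (proj₁ h)))
         in ∈-tail t τ h′ (∈-tail s (t ∷ τ) (≤-trans h′ (n≤1+n _)) v∈)))) }) (hs , a)
      where
      lF : length F ≡ width κ + m
      lF = trans (sym (⊑-length x)) (suc-injective (suc-injective l))

  top-sym : ∀ σ → All (λ v → (v ≢ p) × (v ≢ q)) σ → In n (Δc k m) (p ∷ q ∷ σ) → In n (Δc k m) (p ∷ q ∷ negF σ)
  top-sym σ ne (s ∷ t ∷ τ , l , e , x₁ ∷ x₂ ∷ x) with suc-injective (suc-injective l)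
  ... | l′ with refl ← ∈-head⊕ s (t ∷ τ) (subst (λ z → + suc (suc z) ∈ toF (s ∷ t ∷ τ)) (sym l′) x₂)
    with refl ← ∈-head⊕ t τ (∈-tail s (t ∷ τ) ≤-refl (subst (λ z → + suc z ∈ toF (s ∷ t ∷ τ)) (sym l′) x₁)) =
    ⊕ ∷ ⊕ ∷ flip τ , trans (cong (λ z → 2 + z) (length-flip τ)) l ,
    trans (link-top κ m (flip τ)) (trans (sphere-flip (width κ) (pre κ (suc κ)) m τ) (trans (sym (link-top κ m τ)) e)) ,
    there (here (cong (λ z → + suc z) lf)) ∷ here (cong (λ z → + suc (suc z)) lf) ∷
    All.map⁺ (All.zipWith (λ { {v} ((v≢p , v≢q) , v∈) → there (there (∈-flip τ (inside v v≢p v≢q v∈))) }) (ne , x))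
    where
    lf : width κ + m ≡ length (flip τ)
    lf = trans (sym l′) (sym (length-flip τ))
    inside : ∀ v → v ≢ p → v ≢ q → v ∈ toF (⊕ ∷ ⊕ ∷ τ) → v ∈ toF τ
    inside v h₁ h₂ (here e)         = ⊥-elim (h₂ (trans e (cong (λ z → + suc (suc z)) l′)))
    inside v h₁ h₂ (there (here e)) = ⊥-elim (h₁ (trans e (cong (λ z → + suc z) l′)))
    inside v h₁ h₂ (there (there v∈)) = v∈

open Main
open _⊆_

-- Non-faces

Small : ℕ → Face → Set
Small n = All (λ v → ∣ v ∣ ≤ n)

Small-neg : ∀ {n σ} → Small n σ → Small n (negF σ)
Small-neg h = All.map⁺ (All.map (λ {v} → subst (_≤ _) (sym (∣-i∣≡∣i∣ v))) h)

In-⊆ : ∀ {n f g σ} → f ⊆ g → In n f σ → In n g σ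
In-⊆ h (F , l , e , x) = F , l , h .incl F e , x

In-∂ : ∀ {n f σ} → In n (∂ f) σ → In n f σ
In-∂ {f = f} (R , l , e , x) with ∂-coface f R e
... | F , e′ , y = F , trans (sym (⊑-length y)) l , e′ , All.map (⊑⇒⊆ y) x

In-unneg : ∀ {n f σ} → In n (neg f) σ → In n f (negF σ)
In-unneg (F , l , e , x) = flip F , trans (length-flip F) l , e , All.map⁺ (All.map (∈-flip F) x)

negF-invol : ∀ σ → negF (negF σ) ≡ σ
negF-invol σ = trans (sym (map-∘ σ)) (trans (map-cong neg-involutive σ) (map-id σ))

All-tail : ∀ s c {n σ} → length c ≡ n → Small n σ → All (_∈ toF (s ∷ c)) σ → All (_∈ toF c) σ
All-tail s c refl h x = All.zipWith (λ { (h , v∈) → ∈-tail s c h v∈ }) (h , x)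

In-half : ∀ {n f g σ} → Small n σ → In (suc n) (half f g) σ → In n f σ ⊎ In n (neg g) σ
In-half h (⊕ ∷ F , l , e , x) = inj₁ (F , suc-injective l , e , All-tail ⊕ F (suc-injective l) h x)
In-half h (⊖ ∷ F , l , e , x) = inj₂ (F , suc-injective l , e , All-tail ⊖ F (suc-injective l) h x)

In-half-⊖ : ∀ {n f g σ} → Small n σ → In (suc n) (half f g) (- (+ suc n) ∷ σ) → In n (neg g) σ
In-half-⊖ h (s ∷ F , refl , e , x₀ ∷ x) with refl ← ∈-head⊖ s F x₀ = F , refl , e , All-tail ⊖ F refl h x

In-ext-⊕ : ∀ {n D B σ} → Small n σ → In (suc n) (ext D B) (+ suc n ∷ σ) → In n B σ
In-ext-⊕ h (s ∷ F , refl , e , x₀ ∷ x) with refl ← ∈-head⊕ s F x₀ = In-∂ (F , refl , e , All-tail ⊕ F refl h x)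

-- A new facet meets V_n in a facet of ±∂B, hence in a face of ±B, which was in D before the
-- replacement.
In-ext : ∀ {n D B σ} → B ⊆ D → neg B ⊆ D → Small n σ → In (suc n) (ext D B) σ → In n D σ
In-ext {D = D} {B} b b′ h (⊕ ∷ F , refl , e , x) = In-⊆ b (In-∂ (F , refl , e , All-tail ⊕ F refl h x))
In-ext {D = D} {B} b b′ h (⊖ ∷ F , refl , e , x) =
  In-⊆ b′ (In-∂ (F , refl , trans (∂-neg B F) e , All-tail ⊖ F refl h x))
In-ext {D = D} {B} b b′ h (○ ∷ F , refl , e , x) = F , refl , aux (D F) (B F) (B (flip F)) refl refl refl e , All-tail ○ F refl h x
  where
  aux : ∀ d c c′ → D F ≡ d → B F ≡ c → B (flip F) ≡ c′ → (d xor (c xor c′)) ≡ true → D F ≡ true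
  aux true  c     c′   p q r s = p
  aux false true  c′   p q r s = b .incl F q
  aux false false true p q r s = b′ .incl F r

Δ-mono₁ : ∀ k m {σ} → Small (width k + m) σ → In (width k + suc m) (Δc k (suc m)) σ → In (width k + m) (Δc k m) σ
Δ-mono₁ k m {σ} h x = In-ext (pre⊆Δ k m) (negpre⊆Δ k m) h (subst (λ n → In n (Δc k (suc m)) σ) (+-suc (width k) m) x)

Δ-mono : ∀ k {m m′ σ} → m ≤ m′ → Small (width k + m) σ → In (width k + m′) (Δc k m′) σ → In (width k + m) (Δc k m) σ
Δ-mono k {m} {m′} {σ} h s x with m≤n⇒∃[o]m+o≡n h
... | o , refl = go o x
  where
  go : ∀ o → In (width k + (m + o)) (Δc k (m + o)) σ → In (width k + m) (Δc k m) σ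
  go zero    x = subst (λ z → In (width k + z) (Δc k z) σ) (+-identityʳ m) x
  go (suc o) x = go o (Δ-mono₁ k (m + o) (All.map (λ p → ≤-trans p (+-monoʳ-≤ (width k) (m≤m+n m o))) s)
    (subst (λ z → In (width k + z) (Δc k z) σ) (+-suc m o) x))

-- Without the top vertex only the two bases remain, and the base of -n, with its sign, is contained
-- in the other one.
unwind : ∀ {g J n} → Ranged J (Nested g) → ∀ j → j ≤ suc J → ∀ m {σ} → Small n σ →
  In (suc n) (halves g j m) σ → In n (g j m) σ
unwind H zero    r       m h x with In-half h x
... | inj₁ y            = y
... | inj₂ (F , _ , () , _)
unwind H (suc j) (s≤s r) m h x with In-half h x
... | inj₁ y = y
... | inj₂ y = In-⊆ (H j r m) y

unwind² : ∀ k j → j ≤ suc (suc k) → ∀ m {σ} → Small (width k + m) σ →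
  In (width (suc k) + m) (pre (suc k) j m) σ → In (width k + m) (balls k j m) σ
unwind² k j r m h x = unwind (balls-nested k) j r m h
  (unwind (Nested-half (balls-nested k)) j r m (All.map (λ p → ≤-trans p (n≤1+n _)) h) x)

top⊆Δ : ∀ k m → balls k (suc (suc k)) m ⊆ Δc k m
top⊆Δ k m = subst (_⊆ Δc k m) (sym (balls-top k m)) (⊞-⊆ ⊆-refl (pre⊆Δ k m))

peel : ∀ k m {σ} → Small (width (suc k) + m) σ →
  In (width (suc k) + suc m) (Δc (suc k) (suc m)) (+ (width (suc k) + suc m) ∷ σ) →
  In (width (suc k) + m) (pre (suc k) (suc (suc k)) m) σ
peel k m {σ} h x = In-ext-⊕ h (subst (λ n → In n (Δc (suc k) (suc m)) (+ n ∷ σ)) (+-suc (width (suc k)) m) x)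

-- The link of the top vertex n is ∂B. On V_{n-3}, B shrinks to a ball of dimension d - 2 contained
-- in Δ^{d-2}_{n-3}.
raise : ∀ k m {σ} → Small (width k + m) σ →
  In (width (suc k) + suc m) (Δc (suc k) (suc m)) (+ (width (suc k) + suc m) ∷ σ) → In (width k + m) (Δc k m) σ
raise k m h x = In-⊆ (top⊆Δ k m) (unwind² k (suc (suc k)) ≤-refl m h
  (peel k m (All.map (λ p → ≤-trans p (≤-trans (n≤1+n _) (n≤1+n _))) h) x))

-- {1} misses B^{d,0}_n, and adding the top vertex of Δ^{2j-1}_n to missing j, a non-face of
-- B^{2j-1,j-1}_{n-1}, gives a non-face of Δ^{2j-1}_n: {3, 1}, {6, 3, 1}, …

missing : ℕ → Face
missing zero          = []
missing (suc zero)    = + 1 ∷ []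
missing (suc (suc i)) = + (width i + suc i) ∷ missing (suc i)

width-mono : ∀ {i k} → i ≤ k → width i ≤ width k
width-mono {k = zero}  z≤n = ≤-refl
width-mono {k = suc k} z≤n = ≤-trans (width-mono {k = k} z≤n) (≤-trans (n≤1+n _) (n≤1+n _))
width-mono (s≤s h) = s≤s (s≤s (width-mono h))

1≤width : ∀ k → 1 ≤ width k
1≤width zero    = s≤s z≤n
1≤width (suc k) = s≤s z≤n

missing-small : ∀ j k m → j ≤ suc (suc k) → j ≤ suc m → Small (width k + m) (missing j)
missing-small zero          k m h h′ = []
missing-small (suc zero)    k m h h′ = ≤-trans (1≤width k) (m≤m+n _ m) ∷ []
missing-small (suc (suc i)) k m (s≤s (s≤s h)) (s≤s h′) = +-mono-≤ (width-mono h) h′ ∷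
  missing-small (suc i) k m (s≤s (≤-trans h (n≤1+n _))) (≤-trans h′ (n≤1+n _))

balls-0 : ∀ k m → balls k 0 m ⊆ 𝟎
balls-0 zero    m = ⊆-refl
balls-0 (suc k) m = half-⊆ (half-⊆ (balls-0 k m) (mk (λ _ ()))) (mk (λ _ ()))

missing-1 : ∀ m → ¬ In (2 + m) (edge m) (+ 1 ∷ [])
missing-1 m (⊕ ∷ F , l , e , v∈ ∷ []) with bottom-true m F e
... | refl rewrite length-bottom m | toF-bottom m with v∈
... | there (here ())
... | there (there ())

missing-balls : ∀ j k m → j ≤ suc (suc k) → j ≤ suc m → ¬ In (width k + m) (balls k j m) (missing j)
missing-balls zero    k m h h′ x with In-⊆ (balls-0 k m) x
... | F , l , () , _
missing-balls (suc zero)    zero    m h h′ x = missing-1 m x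
missing-balls (suc zero)    (suc k) m h h′ x = missing-balls 1 k m (s≤s z≤n) h′ (unwind² k 1 (s≤s z≤n) m (missing-small 1 k m (s≤s z≤n) h′) x)
missing-balls (suc (suc i)) k m h h′ x with m≤n⇒m<n∨m≡n h
-- The index is the top one, so the ball lies in Δ. Restricting to the sphere whose top vertex is
-- the largest element of the set, 3i + 3, leaves the link of that vertex, which is contained in a
-- ball of index one lower.
missing-balls (suc (suc i)) k m h h′ x | inj₂ refl = missing-balls (suc i) i i (n≤1+n _) ≤-refl
  (subst (λ f → In (width i + i) f (missing (suc i))) (sym (balls-low i (suc i) i ≤-refl))
    (In-ext-⊕ (missing-small (suc i) i i (n≤1+n _) ≤-refl)
      (subst (λ n → In n (Δc i (suc i)) (+ n ∷ missing (suc i))) (+-suc (width i) i)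
        (Δ-mono i (≤-pred h′) (missing-small (suc (suc i)) i (suc i) ≤-refl ≤-refl) (In-⊆ (top⊆Δ i m) x)))))
missing-balls (suc (suc i)) (suc k) m h h′ x | inj₁ (s≤s lt) = missing-balls (suc (suc i)) k m lt h′
  (unwind² k (suc (suc i)) lt m (missing-small (suc (suc i)) k m lt h′)
    (subst (λ f → In (width (suc k) + m) f (missing (suc (suc i)))) (balls-low (suc k) (suc (suc i)) m lt) x))
missing-balls (suc (suc i)) zero m h h′ x | inj₁ (s≤s (s≤s ()))

open Main
open _⊆_

-- Edges whose links are not neighbourly

-- A witness against cs-k-neighborliness of the link. Non-edges are included, with the empty set as
-- witness; the induction on the dimension starts from non-edges of the cycle.
record Bad (k m : ℕ) (a b : ℤ) : Set where
  constructor bad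
  field
    set   : Face
    short : length set ≤ k
    away  : All (InVMinus (width k + m) a b) set
    pless : pairless set
    non   : ¬ In (width k + m) (Δc k m) (a ∷ b ∷ set)

∣∣-≢ : ∀ {u a : ℤ} → ∣ u ∣ < ∣ a ∣ → u ≢ a
∣∣-≢ h refl = 1+n≰n h

away-small : ∀ {n a b u} → 1 ≤ ∣ u ∣ → ∣ u ∣ ≤ n → ∣ u ∣ < ∣ a ∣ → ∣ u ∣ < ∣ b ∣ → InVMinus n a b u
away-small {u = u} p q h h′ = (p , q) , ∣∣-≢ h , ∣∣-≢ h′ ,
  ∣∣-≢ (subst (_< _) (sym (∣-i∣≡∣i∣ u)) h) , ∣∣-≢ (subst (_< _) (sym (∣-i∣≡∣i∣ u)) h′)

away-big : ∀ {n a b u} → 1 ≤ ∣ u ∣ → ∣ u ∣ ≤ n → ∣ a ∣ < ∣ u ∣ → ∣ b ∣ < ∣ u ∣ → InVMinus n a b u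
away-big {u = u} p q h h′ = (p , q) , (∣∣-≢ h ∘ sym) , (∣∣-≢ h′ ∘ sym) ,
  (∣∣-≢ (subst (_ <_) (sym (∣-i∣≡∣i∣ u)) h) ∘ sym) , (∣∣-≢ (subst (_ <_) (sym (∣-i∣≡∣i∣ u)) h′) ∘ sym)

neg-≡ : ∀ {u a : ℤ} → - u ≡ a → u ≡ - a
neg-≡ {u} refl = sym (neg-involutive u)

away-neg : ∀ {n a b u} → InVMinus n a b u → InVMinus n (- a) (- b) (- u)
away-neg {n} {a} {b} {u} ((p , q) , h₁ , h₂ , h₃ , h₄) =
  (subst (1 ≤_) (sym (∣-i∣≡∣i∣ u)) p , subst (_≤ n) (sym (∣-i∣≡∣i∣ u)) q) ,
  (λ e → h₁ (trans (neg-≡ e) (neg-involutive a))) , (λ e → h₂ (trans (neg-≡ e) (neg-involutive b))) ,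
  (λ e → h₃ (trans (neg-≡ e) (neg-involutive a))) , (λ e → h₄ (trans (neg-≡ e) (neg-involutive b)))

away-swap : ∀ {n a b u} → InVMinus n a b u → InVMinus n b a u
away-swap (i , h₁ , h₂ , h₃ , h₄) = i , h₂ , h₁ , h₄ , h₃

pairless-neg : ∀ S → pairless S → pairless (negF S)
pairless-neg S h v v∈ v∈′ = h (- v) (back v∈) (back v∈′)
  where
  back : ∀ {v} → v ∈ negF S → - v ∈ S
  back {v} v∈ = subst (- v ∈_) (negF-invol S) (∈-map⁺ -_ v∈)

In-swap : ∀ {n f a b S} → In n f (a ∷ b ∷ S) → In n f (b ∷ a ∷ S)
In-swap (F , l , e , x ∷ y ∷ z) = F , l , e , y ∷ x ∷ z

Bad-swap : ∀ {k m a b} → Bad k m a b → Bad k m b a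
Bad-swap (bad S h w p x) = bad S h (All.map away-swap w) p (x ∘ In-swap)

Bad-neg : ∀ {k m a b} → Bad k m a b → Bad k m (- a) (- b)
Bad-neg {k} {m} {a} {b} (bad S h w p x) = bad (negF S) (subst (_≤ k) (sym (length-map -_ S)) h)
  (All.map⁺ (All.map away-neg w)) (pairless-neg S p)
  (λ y → x (subst (In (width k + m) (Δc k m)) (negF-invol (a ∷ b ∷ S))
    (In-neg (sphere-flip (width k) (pre k (suc k)) m) y)))

away-mono : ∀ {n n′ a b u} → n ≤ n′ → InVMinus n a b u → InVMinus n′ a b u
away-mono h ((p , q) , r) = (p , ≤-trans q h) , r

away-small-set : ∀ {n a b S} → All (InVMinus n a b) S → Small n S
away-small-set = All.map (proj₂ ∘ proj₁)

Bad-mono : ∀ {k m m′ a b} → m ≤ m′ → ∣ a ∣ ≤ width k + m → ∣ b ∣ ≤ width k + m → Bad k m a b → Bad k m′ a b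
Bad-mono {k} h p q (bad S h′ w pl x) = bad S h′ (All.map (away-mono (+-monoʳ-≤ (width k) h)) w) pl
  (λ y → x (Δ-mono k h (p ∷ q ∷ away-small-set w) y))

Bad-raise : ∀ {k m a b} → ∣ a ∣ ≤ width k + m → ∣ b ∣ ≤ width k + m → Bad k m a b → Bad (suc k) (suc m) a b
Bad-raise {k} {m} {a} {b} p q (bad S h w pl x) = bad (+ N ∷ S) (s≤s h)
  (away-big (s≤s z≤n) ≤-refl (lt p) (lt q) ∷ All.map (away-mono (≤-trans (+-monoʳ-≤ (width k) (n≤1+n m)) (≤-trans (n≤1+n _) (n≤1+n _)))) w)
  pl′ (λ { (F , l , e , y₁ ∷ y₂ ∷ y₃ ∷ y) → x (raise k m (p ∷ q ∷ away-small-set w) (F , l , e , y₃ ∷ y₁ ∷ y₂ ∷ y)) })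
  where
  N = width (suc k) + suc m
  lt : ∀ {z} → z ≤ width k + m → z < N
  lt h = s≤s (≤-trans h (≤-trans (+-monoʳ-≤ (width k) (n≤1+n m)) (n≤1+n _)))
  far : ∀ {u} → u ∈ S → u ≢ + N × - u ≢ + N
  far {u} u∈ = ∣∣-≢ (lt (All.lookup (away-small-set w) u∈)) ,
    ∣∣-≢ (subst (_< N) (sym (∣-i∣≡∣i∣ u)) (lt (All.lookup (away-small-set w) u∈)))
  pl′ : pairless (+ N ∷ S)
  pl′ v (here refl) (here ())
  pl′ v (here refl) (there v∈) = proj₂ (far v∈) (neg-involutive (+ N))
  pl′ v (there v∈)  (here e)   = proj₂ (far v∈) e
  pl′ v (there v∈)  (there v∈′) = pl v v∈ v∈′

Positive : ℤ → Set
Positive v = ∃[ i ] v ≡ + suc i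

missing-positive : ∀ j → All Positive (missing j)
missing-positive zero          = []
missing-positive (suc zero)    = (0 , refl) ∷ []
missing-positive (suc (suc i)) = (_ , cong (λ z → + z) (+-suc (width i) i)) ∷ missing-positive (suc i)

Positive-pairless : ∀ {S} → All Positive S → pairless S
Positive-pairless h v v∈ v∈′ with All.lookup h v∈ | All.lookup h v∈′
... | _ , refl | _ , ()

length-missing : ∀ j → length (missing j) ≡ j
length-missing zero          = refl
length-missing (suc zero)    = refl
length-missing (suc (suc i)) = cong suc (length-missing (suc i))

Positive-∣∣ : ∀ {v} → Positive v → 1 ≤ ∣ v ∣
Positive-∣∣ (_ , refl) = s≤s z≤n

-- Edges {M, v} with M = width (suc k) + suc y the top vertex: v = −(M−1), ±(M−2), or ∣v∣ ≤ M − 3.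

module Top (k y : ℕ) (k≤y : k ≤ y) where
  private
    U = width k + y
    M = + suc (suc (suc U))

  small-away : ∀ {a b u} → U < ∣ a ∣ → U < ∣ b ∣ → 1 ≤ ∣ u ∣ → ∣ u ∣ ≤ U → InVMinus (width (suc k) + suc y) a b u
  small-away h h′ p q = away-small p (≤-trans q (≤-trans (+-monoʳ-≤ (width k) (n≤1+n y)) (≤-trans (n≤1+n _) (n≤1+n _))))
    (≤-trans (s≤s q) h) (≤-trans (s≤s q) h′)

  private
    Ts : Face
    Ts = missing (suc k)
    small : Small U Ts
    small = missing-small (suc k) k y (n≤1+n _) (s≤s k≤y)

  peel′ : ∀ {σ} → Small (suc (suc U)) σ → In (width (suc k) + suc y) (Δc (suc k) (suc y)) (M ∷ σ) →
    In (suc (suc U)) (pre (suc k) (suc (suc k)) y) σ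
  peel′ {σ} h x = peel k y h (subst (λ z → In (width (suc k) + suc y) (Δc (suc k) (suc y)) (+ z ∷ σ)) (sym (+-suc (width (suc k)) y)) x)

  negT : ∀ {v} → suc U ≤ ∣ v ∣ → ¬ In (width (suc k) + suc y) (Δc (suc k) (suc y)) (M ∷ v ∷ negF Ts) →
    Bad (suc k) (suc y) M v
  negT {v} h x = bad (negF Ts) (≤-reflexive (trans (length-map -_ Ts) (length-missing (suc k))))
    (All.map⁺ (All.zipWith (λ { {u} (p , q) → small-away (s≤s (≤-trans (n≤1+n _) (n≤1+n _))) h
      (subst (1 ≤_) (sym (∣-i∣≡∣i∣ u)) (Positive-∣∣ p)) (subst (_≤ U) (sym (∣-i∣≡∣i∣ u)) q) }) (missing-positive (suc k) , small)))
    (pairless-neg Ts (Positive-pairless (missing-positive (suc k)))) x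

  noT : ¬ In U (neg (balls k (suc k) y)) (negF Ts)
  noT x = missing-balls (suc k) k y (n≤1+n _) (s≤s k≤y)
    (subst (In U (balls k (suc k) y)) (negF-invol Ts) (In-unneg x))

  weaken : ∀ {n σ} → Small n σ → Small (suc n) σ
  weaken = All.map (λ p → ≤-trans p (n≤1+n _))

  -- The link of M lies in B, where -(M - 1) is the apex of the negative cone. Its base has the
  -- index lowered by one, and on V_{M-3} it lies in -B^{d-2,k}, which misses the negative of the
  -- missing set.
  bad-m1 : Bad (suc k) (suc y) M (- (+ suc (suc U)))
  bad-m1 = negT (n≤1+n _) (λ x → noT (unneg
    (In-half-⊖ (weaken (Small-neg small)) (peel′ (≤-refl ∷ weaken (weaken (Small-neg small))) x))))
    where
    unneg : In (suc U) (neg (halves (balls k) (suc k) y)) (negF Ts) → In U (neg (balls k (suc k) y)) (negF Ts)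
    unneg x = subst (In U (neg (balls k (suc k) y))) (cong negF (negF-invol Ts)) (renege
      (unwind {g = balls k} (balls-nested k) (suc k) (n≤1+n _) y (Small-neg (Small-neg small)) (In-unneg x)))
      where
      renege : ∀ {n f σ} → In n f σ → In n (neg f) (negF σ)
      renege {f = f} (F , l , e , x) = flip F , trans (length-flip F) l , trans (cong f (flip-invol F)) e , All.map⁺ (All.map (∈-flip F) x)

  bad-m2 : Bad (suc k) (suc y) M (- (+ suc U))
  bad-m2 = negT ≤-refl (λ x → noT (In-half-⊖ (Small-neg small)
    (unwind {g = halves (balls k)} (Nested-half {g = balls k} (balls-nested k)) (suc (suc k)) ≤-refl y (≤-refl ∷ weaken (Small-neg small))
      (peel′ (n≤1+n _ ∷ weaken (weaken (Small-neg small))) x))))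

  -- Including -(M - 1) in the witness turns M - 2 into the apex of a negative cone after the sign
  -- change. Two negative cones lower the index by two, so `missing k` is enough and the witness
  -- still has k + 1 elements.
  bad-p2 : Bad (suc k) (suc y) M (+ suc U)
  bad-p2 = bad (- (+ suc (suc U)) ∷ missing k) (s≤s (≤-reflexive (length-missing k)))
    (((s≤s z≤n , s≤s (s≤s (+-monoʳ-≤ (width k) (n≤1+n y)))) , (λ ()) , (λ ()) ,
       (λ e → 1+n≢n (sym (+-injective e))) , (λ e → 1+n≢n (+-injective e))) ∷
      All.zipWith (λ { (p , q) → small-away (s≤s (≤-trans (n≤1+n _) (n≤1+n _))) ≤-refl (Positive-∣∣ p) q }) (missing-positive k , small′))
    pl
    (λ { (F , l , e , x₁ ∷ x₂ ∷ x₃ ∷ x) → missing-balls k k y (≤-trans (n≤1+n _) (n≤1+n _)) (≤-trans k≤y (n≤1+n _))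
      (subst (In U (balls k k y)) (negF-invol (missing k)) (In-unneg (In-half-⊖ (Small-neg small′)
        (In-unneg (In-half-⊖ (≤-refl ∷ weaken small′)
          (peel′ (≤-refl ∷ n≤1+n _ ∷ weaken (weaken small′)) (F , l , e , x₁ ∷ x₃ ∷ x₂ ∷ x))))))) })
    where
    small′ : Small U (missing k)
    small′ = missing-small k k y (≤-trans (n≤1+n _) (n≤1+n _)) (≤-trans k≤y (n≤1+n _))
    pl : pairless (- (+ suc (suc U)) ∷ missing k)
    pl v (here refl) (here ())
    pl v (here refl) (there v∈) = 1+n≰n (≤-trans (n≤1+n _) (All.lookup small′ v∈))
    pl v (there v∈) (here e) = 1+n≰n (≤-trans (n≤1+n _) (subst (_≤ U) (trans (sym (∣-i∣≡∣i∣ v)) (cong ∣_∣ e)) (All.lookup small′ v∈)))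
    pl v (there v∈) (there v∈′) = Positive-pairless (missing-positive k) v v∈ v∈′

  -- A non-face {v, v′} ∪ S of Δ^{d-2}_{M-3} gives the non-face {M, v, v′} ∪ S.
  bad-low : ∀ {v v′} → ∣ v ∣ ≤ U → 1 ≤ ∣ v′ ∣ → ∣ v′ ∣ ≤ U → v ≢ v′ → - v ≢ v′ → Bad k y v v′ → Bad (suc k) (suc y) M v
  bad-low {v} {v′} h p q ne ne′ (bad S l w pl x) = bad (v′ ∷ S) (s≤s l)
    (((p , weak q) , ∣∣-≢ (lt q) , (ne ∘ sym) , ∣∣-≢ (subst (_< suc (suc (suc U))) (sym (∣-i∣≡∣i∣ v′)) (lt q)) ,
       (λ e → ne′ (sym (neg-≡ e)))) ∷
     All.map (λ { {u} ((p , q) , h₁ , h₂ , h₃ , h₄) → (p , weak q) , ∣∣-≢ (lt q) , h₁ ,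
       ∣∣-≢ (subst (_< suc (suc (suc U))) (sym (∣-i∣≡∣i∣ u)) (lt q)) , h₃ }) w)
    pl′
    (λ z → x (raise k y (h ∷ q ∷ away-small-set w)
      (subst (λ z → In (width (suc k) + suc y) (Δc (suc k) (suc y)) (+ z ∷ v ∷ v′ ∷ S)) (sym (+-suc (width (suc k)) y)) z)))
    where
    weak : ∀ {z} → z ≤ U → z ≤ width (suc k) + suc y
    weak q = ≤-trans q (≤-trans (+-monoʳ-≤ (width k) (n≤1+n y)) (≤-trans (n≤1+n _) (n≤1+n _)))
    lt : ∀ {z} → z ≤ U → z < suc (suc (suc U))
    lt q = s≤s (≤-trans q (≤-trans (n≤1+n _) (n≤1+n _)))
    pl′ : pairless (v′ ∷ S)
    pl′ u (here refl) (here e) with + 0 ℤ.≟ v′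
    ... | yes refl = ⊥-elim (1+n≰n p)
    ... | no  ne″  = zero-neg v′ (ne″ ∘ sym) e
      where
      zero-neg : ∀ u → u ≢ + 0 → - u ≢ u
      zero-neg (+ 0)       h e = h refl
      zero-neg (+ suc _)   h ()
      zero-neg -[1+ _ ]    h ()
    pl′ u (here refl) (there u∈) = proj₁ (proj₂ (proj₂ (proj₂ (All.lookup (All.map away-swap w) u∈)))) (neg-involutive v′)
    pl′ u (there u∈) (here e)    = proj₂ (proj₂ (proj₂ (proj₂ (All.lookup w u∈)))) e
    pl′ u (there u∈) (there u∈′) = pl u u∈ u∈′

-- The edge {M − 1, M} of Δ^d_M is contained only in facets of the two replaced balls.

module Adjacent (k y : ℕ) (k≤y : k ≤ y) where
  private
    U = width k + y
    h : ℕ → Chain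
    h j = halves (balls k) j y

  -- The links of the edge in Δ, B and -B are a smaller sphere, the complement of its middle ball,
  -- and that middle ball.
  cancel : ∀ τ → (Δc (suc k) y ⊞ (pre (suc k) (suc (suc k)) y ⊞ neg (pre (suc k) (suc (suc k)) y))) (⊕ ∷ ⊕ ∷ τ) ≡ false
  cancel τ = begin
    Δc (suc k) y (⊕ ∷ ⊕ ∷ τ) xor (balls k (suc (suc k)) y τ xor balls k (suc k) y (flip (flip τ)))
      ≡⟨ cong₂ (λ a f → a xor (f τ xor balls k (suc k) y (flip (flip τ)))) (link-top k y τ) (balls-top k y) ⟩
    Δc k y τ xor ((Δc k y τ xor pre k (suc k) y τ) xor balls k (suc k) y (flip (flip τ)))
      ≡⟨ cong₂ (λ f σ → Δc k y τ xor ((Δc k y τ xor pre k (suc k) y τ) xor f σ)) (balls-low k (suc k) y ≤-refl) (flip-invol τ) ⟩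
    Δc k y τ xor ((Δc k y τ xor pre k (suc k) y τ) xor pre k (suc k) y τ)
      ≡⟨ cong (Δc k y τ xor_) (⊞-cancel (Δc k y) (pre k (suc k) y) τ) ⟩
    Δc k y τ xor Δc k y τ
      ≡⟨ xor-same (Δc k y τ) ⟩
    false ∎
    where open ≡-Reasoning

  ∂-⊖⊖ : ∀ τ → ∂ (pre (suc k) (suc (suc k)) y) (flip (⊕ ∷ ⊕ ∷ τ)) ≡ ∂ (balls k (suc k) y) τ
  ∂-⊖⊖ τ = trans (∂-neg (h (suc k)) (⊖ ∷ flip τ)) (cong (∂ (balls k (suc k) y)) (flip-invol τ))

  -- By `cancel` every facet through the edge contains a new vertex. The link of the edge in ∂B and
  -- in ∂(-B) is the boundary of the same middle ball, of dimension d - 2.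
  adjacent : ∀ {n S} → Small n S →
    In (suc (suc (suc n))) (ext (Δc (suc k) y) (pre (suc k) (suc (suc k)) y)) (+ suc (suc n) ∷ + suc n ∷ S) →
    In n (balls k (suc k) y) S
  adjacent h (s ∷ t ∷ u ∷ τ , l , e , x₁ ∷ x₂ ∷ x) with refl ← suc-injective (suc-injective (suc-injective l))
    with refl ← ∈-head⊕ t (u ∷ τ) (∈-tail s (t ∷ u ∷ τ) ≤-refl x₁)
    with refl ← ∈-head⊕ u τ (∈-tail ⊕ (u ∷ τ) ≤-refl (∈-tail s (⊕ ∷ u ∷ τ) (n≤1+n _) x₂)) = go s e
    where
    x′ : All (_∈ toF τ) _
    x′ = All.zipWith (λ { (h , v∈) → ∈-tail ⊕ τ h (∈-tail ⊕ (⊕ ∷ τ) (≤-trans h (n≤1+n _)) (∈-tail s (⊕ ∷ ⊕ ∷ τ) (≤-trans h (≤-trans (n≤1+n _) (n≤1+n _))) v∈)) }) (h , x)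
    go : ∀ s → ext (Δc (suc k) y) (pre (suc k) (suc (suc k)) y) (s ∷ ⊕ ∷ ⊕ ∷ τ) ≡ true → In _ (balls k (suc k) y) _
    go ○ e with trans (sym (cancel τ)) e
    ... | ()
    go ⊕ e = subst (λ f → In (length τ) f _) (sym (balls-low k (suc k) y ≤-refl))
      (In-∂ (τ , refl , trans (sym (balls-∂top k y τ)) e , x′))
    go ⊖ e = In-∂ (τ , refl , trans (sym (∂-⊖⊖ τ)) e , x′)

  bad-p1 : Bad (suc k) (suc y) (+ suc (suc U)) (+ suc U)
  bad-p1 = bad (missing (suc k)) (≤-reflexive (length-missing (suc k)))
    (All.zipWith (λ { (p , q) → Top.small-away k y k≤y (n≤1+n _) ≤-refl (Positive-∣∣ p) q }) (missing-positive (suc k) , small))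
    (Positive-pairless (missing-positive (suc k)))
    (λ x → missing-balls (suc k) k y (n≤1+n _) (s≤s k≤y) (adjacent small
      (subst (λ n → In n (Δc (suc k) (suc y)) (+ suc (suc U) ∷ + suc U ∷ missing (suc k))) (+-suc (width (suc k)) y) x)))
    where
    small : Small U (missing (suc k))
    small = missing-small (suc k) k y (n≤1+n _) (s≤s k≤y)

open Main
open _⊆_

-- Non-faces by exhaustive search

anyCode : ℕ → (Code → Bool) → Bool
anyCode zero    P = P []
anyCode (suc n) P = anyCode n (P ∘ (○ ∷_)) ∨ (anyCode n (P ∘ (⊕ ∷_)) ∨ anyCode n (P ∘ (⊖ ∷_)))

∨-false : ∀ {a b} → a ∨ b ≡ false → a ≡ false × b ≡ false
∨-false {false} {false} e = refl , refl

anyCode-false : ∀ n P → anyCode n P ≡ false → ∀ c → length c ≡ n → P c ≡ false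
anyCode-false zero    P e []      l = e
anyCode-false (suc n) P e (○ ∷ c) l = anyCode-false n (P ∘ (○ ∷_)) (proj₁ (∨-false e)) c (suc-injective l)
anyCode-false (suc n) P e (⊕ ∷ c) l = anyCode-false n (P ∘ (⊕ ∷_))
  (proj₁ (∨-false (proj₂ (∨-false {anyCode n (P ∘ (○ ∷_))} e)))) c (suc-injective l)
anyCode-false (suc n) P e (⊖ ∷ c) l = anyCode-false n (P ∘ (⊖ ∷_))
  (proj₂ (∨-false {anyCode n (P ∘ (⊕ ∷_))} (proj₂ (∨-false {anyCode n (P ∘ (○ ∷_))} e)))) c (suc-injective l)

face? : ℕ → Chain → Face → Bool
face? n f σ = anyCode n (λ c → f c ∧ subᵇ σ (toF c))

nonface : ∀ n f σ → face? n f σ ≡ false → ¬ In n f σ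
nonface n f σ e (F , l , fF , x) with trans (sym (cong₂ _∧_ fF (⊆⇒subᵇ σ (toF F) (All.lookup x))))
  (anyCode-false n (λ c → f c ∧ subᵇ σ (toF c)) e F l)
... | ()

nonedge : ∀ {m a b} → ¬ In (width 0 + m) (Δc 0 m) (a ∷ b ∷ []) → Bad 0 m a b
nonedge x = bad [] z≤n [] (λ v ()) x

-- Induction over all remaining edges

EdgesBad : ℕ → Set
EdgesBad k = ∃[ N ] (∀ m → N ≤ m → ∀ M v → 1 ≤ ∣ v ∣ → ∣ v ∣ < M → M ≤ width (suc k) + m →
  ¬ (M ≡ 2 × v ≡ + 1) → ¬ (M ≡ width (suc k) + m × v ≡ + (M ∸ 1)) → Bad (suc k) m (+ M) v)

-- The vertices i + 1 and −(companion i + 1) have opposite signs, so they span no special edge.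
companion : ℕ → ℕ
companion 1 = 0
companion _ = 1

Companions : ℕ → Set
Companions k = ∃[ N ] (∀ y → N ≤ y → ∀ i → suc i ≤ width k + y → Bad k y (+ suc i) -[1+ companion i ])

companions-0 : Companions 0
-- The square Δ^1_2 still has the edge {1, -2}; the hexagon Δ^1_3 has none of the three pairs that
-- are checked.
companions-0 = 1 , go
  where
  first : ∀ {y a b} → 1 ≤ y → face? 3 (Δc 0 1) (a ∷ b ∷ []) ≡ false → ∣ a ∣ ≤ 3 → ∣ b ∣ ≤ 3 → Bad 0 y a b
  first {a = a} {b} h e p q = Bad-mono h p q (nonedge (nonface 3 (Δc 0 1) (a ∷ b ∷ []) e))
  go : ∀ y → 1 ≤ y → ∀ i → suc i ≤ 2 + y → Bad 0 y (+ suc i) -[1+ companion i ]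
  go y h 0 p = first h refl (s≤s z≤n) (s≤s (s≤s z≤n))
  go y h 1 p = first h refl (s≤s (s≤s z≤n)) (s≤s z≤n)
  go y h 2 p = first h refl ≤-refl (s≤s (s≤s z≤n))
  -- In Δ^1_{4+j} the vertex is the top one, and its neighbors are 3 + j and -1.
  go y h (suc (suc (suc j))) (s≤s (s≤s p)) = Bad-mono p ≤-refl (s≤s (s≤s z≤n))
    (nonedge (λ x → far (In-ext-⊕ (s≤s (s≤s z≤n) ∷ []) x)))
    where
    far : ¬ In (3 + j) (edge (suc j)) (- (+ 2) ∷ [])
    far (⊕ ∷ F , l , e , v∈ ∷ []) with bottom-true (suc j) F e
    ... | refl rewrite length-bottom j | toF-bottom j with v∈
    ... | there (here ())
    ... | there (there ())

companions-suc : ∀ k → EdgesBad k → Companions (suc k)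
companions-suc k (N , E) = N , go
  where
  2≤width : ∀ y → 2 ≤ width (suc k) + y
  2≤width y = s≤s (s≤s z≤n)
  go : ∀ y → N ≤ y → ∀ i → suc i ≤ width (suc k) + y → Bad (suc k) y (+ suc i) -[1+ companion i ]
  go y h 0 p = Bad-swap (Bad-neg (E y h 2 (- (+ 1)) (s≤s z≤n) ≤-refl (2≤width y) (λ { (_ , ()) }) (λ { (_ , ()) })))
  go y h 1 p = E y h 2 (- (+ 1)) (s≤s z≤n) ≤-refl p (λ { (_ , ()) }) (λ { (_ , ()) })
  go y h (suc (suc i)) p = E y h (3 + i) (- (+ 2)) (s≤s z≤n) (s≤s (s≤s (s≤s z≤n))) p (λ { (() , _) }) (λ { (_ , ()) })

companion≢ : ∀ i → companion i ≢ i
companion≢ 0 ()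
companion≢ 1 ()
companion≢ (suc (suc i)) ()

companion-≤ : ∀ i → suc (companion i) ≤ 2
companion-≤ 0 = ≤-refl
companion-≤ 1 = s≤s z≤n
companion-≤ (suc (suc i)) = ≤-refl

2≤width : ∀ k → 2 ≤ width k
2≤width zero    = ≤-refl
2≤width (suc k) = s≤s (s≤s z≤n)

module Big (k : ℕ) (C : Companions k) where
  L : ℕ
  L = proj₁ C ⊔ k

  low-case : ∀ y (h : L ≤ y) v → 1 ≤ ∣ v ∣ → ∣ v ∣ ≤ width k + y → Bad (suc k) (suc y) (+ (3 + (width k + y))) v
  low-case y h (+ suc i) p q = Top.bad-low k y (≤-trans (m≤n⊔m (proj₁ C) k) h) q (s≤s z≤n)
    (≤-trans (companion-≤ i) (≤-trans (2≤width k) (m≤m+n _ y)))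
    (λ ()) (λ e → companion≢ i (sym (-[1+-injective e)))
    (proj₂ C y (≤-trans (m≤m⊔n (proj₁ C) k) h) i q)
  low-case y h -[1+ i ] p q = Top.bad-low k y (≤-trans (m≤n⊔m (proj₁ C) k) h) {v′ = + suc (companion i)} q (s≤s z≤n)
    (≤-trans (companion-≤ i) (≤-trans (2≤width k) (m≤m+n _ y)))
    (λ ()) (λ e → companion≢ i (sym (suc-injective (+-injective e))))
    (Bad-neg (proj₂ C y (≤-trans (m≤m⊔n (proj₁ C) k) h) i q))

  top-case : ∀ y → L ≤ y → ∀ v → 1 ≤ ∣ v ∣ → ∣ v ∣ < 3 + (width k + y) → v ≢ + (2 + (width k + y)) →
    Bad (suc k) (suc y) (+ (3 + (width k + y))) v
  top-case y h v p (s≤s q) ne with m≤n⇒m<n∨m≡n q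
  top-case y h v p (s≤s q) ne | inj₁ (s≤s q′) with m≤n⇒m<n∨m≡n q′
  top-case y h v p (s≤s q) ne | inj₁ (s≤s q′) | inj₁ (s≤s q″) = low-case y h v p q″
  top-case y h (+ _) p (s≤s q) ne | inj₁ (s≤s q′) | inj₂ refl = Top.bad-p2 k y (≤-trans (m≤n⊔m (proj₁ C) k) h)
  top-case y h -[1+ _ ] p (s≤s q) ne | inj₁ (s≤s q′) | inj₂ refl = Top.bad-m2 k y (≤-trans (m≤n⊔m (proj₁ C) k) h)
  top-case y h (+ _) p (s≤s q) ne | inj₂ refl = ⊥-elim (ne refl)
  top-case y h -[1+ _ ] p (s≤s q) ne | inj₂ refl = Top.bad-m1 k y (≤-trans (m≤n⊔m (proj₁ C) k) h)

  big-case : ∀ m M v → 3 + (width k + L) ≤ M → 1 ≤ ∣ v ∣ → ∣ v ∣ < M → M ≤ width (suc k) + m →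
    ¬ (M ≡ width (suc k) + m × v ≡ + (M ∸ 1)) → Bad (suc k) m (+ M) v
  big-case m M v hM p q r ne with m≤n⇒∃[o]m+o≡n hM
  ... | o , refl with v ℤ.≟ + (2 + (width k + L + o))
  ... | no  v≢ = Bad-mono y≤m (s≤s (s≤s e-≤)) (≤-trans (≤-trans (n≤1+n _) q) (s≤s (s≤s e-≤)))
    (subst (λ z → Bad (suc k) (suc (L + o)) (+ (3 + z)) v) (sym (+-assoc (width k) L o))
      (top-case (L + o) (m≤m+n L o) v p (subst (λ z → ∣ v ∣ < 3 + z) (+-assoc (width k) L o) q)
        (λ e → v≢ (trans e (cong (λ z → + (2 + z)) (sym (+-assoc (width k) L o)))))))
    where
    e-≤ : suc (width k + L + o) ≤ width k + suc (L + o)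
    e-≤ = ≤-reflexive (trans (cong suc (+-assoc (width k) L o)) (sym (+-suc (width k) (L + o))))
    y≤m : suc (L + o) ≤ m
    y≤m = +-cancelˡ-≤ (width k) _ _ (≤-trans (≤-reflexive (trans (+-suc (width k) (L + o)) (cong suc (sym (+-assoc (width k) L o))))) (≤-pred (≤-pred r)))
  -- The edge {M - 1, M} needs the further vertex M + 1; it exists because the case M = n is
  -- excluded.
  ... | yes refl = Bad-mono y≤m (s≤s (s≤s e-≤)) (s≤s (≤-trans (n≤1+n _) (s≤s e-≤)))
    (subst (λ z → Bad (suc k) (suc (suc (L + o))) (+ (2 + z)) (+ (1 + z))) (trans (+-suc (width k) (L + o)) (cong suc (sym (+-assoc (width k) L o))))
      (Adjacent.bad-p1 k (suc (L + o)) (≤-trans (m≤n⊔m (proj₁ C) k) (≤-trans (m≤m+n L o) (n≤1+n _)))))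
    where
    e-≤ : suc (width k + L + o) ≤ width k + suc (suc (L + o))
    e-≤ = ≤-trans (≤-reflexive (trans (cong suc (+-assoc (width k) L o)) (sym (+-suc (width k) (L + o))))) (+-monoʳ-≤ (width k) (n≤1+n _))
    y≤m : suc (suc (L + o)) ≤ m
    y≤m = +-cancelˡ-≤ (width k) _ _ (≤-trans (≤-reflexive (trans (+-suc (width k) (suc (L + o))) (cong suc (trans (+-suc (width k) (L + o)) (cong suc (sym (+-assoc (width k) L o)))))))
      (≤-pred (≤-pred (≤∧≢⇒< r (λ e → ne (e , refl))))))

module Base (m : ℕ) (m≥5 : 5 ≤ m) where
  -- The cycle on V_6 is used because {5, -1} is an edge of the one on V_5. Raising a non-edge of
  -- Δ^1_6 uses the vertex 9 of Δ^3_9, whence m ≥ 5. Left over are {2, 3}, {3, 4} and {4, 5}, edges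
  -- of the cycle.
  table : ∀ {a b} → face? 6 (Δc 0 4) (a ∷ b ∷ []) ≡ false → (∣ a ∣ ≤ᵇ 6) ≡ true → (∣ b ∣ ≤ᵇ 6) ≡ true → Bad 1 m a b
  table {a} {b} e p q = Bad-mono m≥5 (≤-trans p′ (≤ᵇ⇒≤ 6 9 _)) (≤-trans q′ (≤ᵇ⇒≤ 6 9 _))
    (Bad-raise p′ q′ (nonedge (nonface 6 (Δc 0 4) (a ∷ b ∷ []) e)))
    where
    p′ = ≤ᵇ⇒≤ ∣ a ∣ 6 (subst T (sym p) _)
    q′ = ≤ᵇ⇒≤ ∣ b ∣ 6 (subst T (sym q) _)

  -- As an edge of the cycle it cannot be raised, and `Adjacent` starts only at {3, 4}; a direct
  -- search in Δ^3_5 gives -1.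
  bad-3-2 : Bad 1 m (+ 3) (+ 2)
  bad-3-2 = Bad-mono (≤-trans (s≤s z≤n) m≥5) (≤ᵇ⇒≤ 3 5 _) (≤ᵇ⇒≤ 2 5 _)
    (bad (- (+ 1) ∷ []) ≤-refl (away-small ≤-refl (s≤s z≤n) (s≤s (s≤s z≤n)) ≤-refl ∷ [])
      (λ { v (here refl) (here ()) })
      (nonface 5 (Δc 1 1) (+ 3 ∷ + 2 ∷ - (+ 1) ∷ []) refl))

  n≤5 : ∀ i → (i ≤ᵇ 5) ≡ true → i ≤ 5
  n≤5 i e = ≤ᵇ⇒≤ i 5 (subst T (sym e) _)

  n≤n+ : ∀ i {n} → (i ≤ᵇ n) ≡ true → i ≤ n
  n≤n+ i {n} e = ≤ᵇ⇒≤ i n (subst T (sym e) _)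

  small-edges : ∀ M v → 1 ≤ ∣ v ∣ → ∣ v ∣ < M → M < 6 → ¬ (M ≡ 2 × v ≡ + 1) → Bad 1 m (+ M) v
  small-edges 0 v p () h ne
  small-edges 1 v p lt h ne = ⊥-elim (<⇒≱ lt p)
  small-edges 2 (+ 0) () lt h ne
  small-edges 2 (+ 1) p lt h ne = ⊥-elim (ne (refl , refl))
  small-edges 2 (+ suc (suc i)) p (s≤s (s≤s ())) h ne
  small-edges 2 -[1+ 0 ] p lt h ne = table refl refl refl
  small-edges 2 -[1+ suc i ] p (s≤s (s≤s ())) h ne
  small-edges 3 (+ 0) () lt h ne
  small-edges 3 (+ 1) p lt h ne = table refl refl refl
  small-edges 3 (+ 2) p lt h ne = bad-3-2
  small-edges 3 (+ suc (suc (suc i))) p (s≤s (s≤s (s≤s ()))) h ne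
  small-edges 3 -[1+ 0 ] p lt h ne = table refl refl refl
  small-edges 3 -[1+ 1 ] p lt h ne = table refl refl refl
  small-edges 3 -[1+ suc (suc i) ] p (s≤s (s≤s (s≤s ()))) h ne
  small-edges 4 (+ 0) () lt h ne
  small-edges 4 (+ 1) p lt h ne = table refl refl refl
  small-edges 4 (+ 2) p lt h ne = table refl refl refl
  small-edges 4 (+ 3) p lt h ne = Bad-mono (≤-trans (n≤5 1 refl) m≥5) (n≤n+ 4 refl) (n≤n+ 3 refl) (Adjacent.bad-p1 0 0 z≤n)
  small-edges 4 (+ suc (suc (suc (suc i)))) p (s≤s (s≤s (s≤s (s≤s ())))) h ne
  small-edges 4 -[1+ 0 ] p lt h ne = table refl refl refl
  small-edges 4 -[1+ 1 ] p lt h ne = table refl refl refl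
  small-edges 4 -[1+ 2 ] p lt h ne = table refl refl refl
  small-edges 4 -[1+ suc (suc (suc i)) ] p (s≤s (s≤s (s≤s (s≤s ())))) h ne
  small-edges 5 (+ 0) () lt h ne
  small-edges 5 (+ 1) p lt h ne = table refl refl refl
  small-edges 5 (+ 2) p lt h ne = table refl refl refl
  small-edges 5 (+ 3) p lt h ne = table refl refl refl
  small-edges 5 (+ 4) p lt h ne = Bad-mono (≤-trans (n≤5 2 refl) m≥5) (n≤n+ 5 refl) (n≤n+ 4 refl) (Adjacent.bad-p1 0 1 z≤n)
  small-edges 5 (+ suc (suc (suc (suc (suc i))))) p (s≤s (s≤s (s≤s (s≤s (s≤s ()))))) h ne
  small-edges 5 -[1+ 0 ] p lt h ne = table refl refl refl
  small-edges 5 -[1+ 1 ] p lt h ne = table refl refl refl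
  small-edges 5 -[1+ 2 ] p lt h ne = table refl refl refl
  small-edges 5 -[1+ 3 ] p lt h ne = table refl refl refl
  small-edges 5 -[1+ suc (suc (suc (suc i))) ] p (s≤s (s≤s (s≤s (s≤s (s≤s ()))))) h ne
  small-edges (suc (suc (suc (suc (suc (suc M)))))) v p lt (s≤s (s≤s (s≤s (s≤s (s≤s (s≤s ())))))) ne

edges-bad : ∀ k → EdgesBad k
edges-bad zero = 5 , go
  where
  go : ∀ m → 5 ≤ m → ∀ M v → 1 ≤ ∣ v ∣ → ∣ v ∣ < M → M ≤ width 1 + m →
    ¬ (M ≡ 2 × v ≡ + 1) → ¬ (M ≡ width 1 + m × v ≡ + (M ∸ 1)) → Bad 1 m (+ M) v
  -- 6 = 3 + (width 0 + L) with L = 1 is where `big-case` begins.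
  go m h M v p q r ne ne′ with 6 ≤? M
  ... | yes M≥6 = Big.big-case 0 companions-0 m M v M≥6 p q r ne′
  ... | no  M<6 = Base.small-edges m h M v p q (≰⇒> M<6) ne
-- The bound `cut` ensures that a small M lies below the top vertex of the sphere that is raised, so
-- {M - 1, M} is not its special top edge.
edges-bad (suc k) = suc (N ⊔ cut) , go
  where
  open Big (suc k) (companions-suc k (edges-bad k))
  N = proj₁ (edges-bad k)
  cut = 3 + (width (suc k) + L)
  go : ∀ m → suc (N ⊔ cut) ≤ m → ∀ M v → 1 ≤ ∣ v ∣ → ∣ v ∣ < M → M ≤ width (suc (suc k)) + m →
    ¬ (M ≡ 2 × v ≡ + 1) → ¬ (M ≡ width (suc (suc k)) + m × v ≡ + (M ∸ 1)) → Bad (suc (suc k)) m (+ M) v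
  go (suc m) (s≤s h) M v p q r ne ne′ with cut ≤? M
  ... | yes M≥ = big-case (suc m) M v M≥ p q r ne′
  ... | no  M≱ = Bad-raise M≤ (≤-trans (≤-trans (n≤1+n _) q) M≤)
    (proj₂ (edges-bad k) m (≤-trans (m≤m⊔n N cut) h) M v p q M≤ ne (λ { (e , _) → 1+n≰n (subst (_< width (suc k) + m) e M<) }))
    where
    M< : M < width (suc k) + m
    M< = ≤-trans (≰⇒> M≱) (≤-trans (m≤n⊔m N cut) (≤-trans h (m≤n+m m _)))
    M≤ : M ≤ width (suc k) + m
    M≤ = ≤-trans (n≤1+n _) M<

open Main

-- From chains back to the statement

Claim : ℕ → ℕ → ℕ → Set
Claim k d n =
  ((a b : ℤ) → a ≢ b → InV n a → InV n b → (a ∷ b ∷ []) ∈ᶜ Δ d n →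
    (CsNeighborly k (InVMinus n a b) (InLk a b (Δ d n)) ⇔ SpecialEdge n a b))
  × ((a b : ℤ) → SpecialEdge n a b →
    ((a ∷ b ∷ []) ∈ᶜ Δ d n) × CentrallySymmetric (InLk a b (Δ d n)))

∣∣-≡ : ∀ a b → ∣ a ∣ ≡ ∣ b ∣ → a ≡ b ⊎ a ≡ - b
∣∣-≡ (+ m)         (+ n)         e    = inj₁ (cong (λ z → + z) e)
∣∣-≡ (+ .(suc n))  -[1+ n ]      refl = inj₂ refl
∣∣-≡ -[1+ m ]      (+ .(suc m))  refl = inj₂ refl
∣∣-≡ -[1+ m ]      -[1+ .m ]     refl = inj₁ refl

special-swap : ∀ {n a b} → SpecialEdge n a b → SpecialEdge n b a
special-swap (inj₁ x)               = inj₁ (flip-edge x)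
  where
  flip-edge : ∀ {a b c d} → SameEdge a b c d → SameEdge b a c d
  flip-edge (inj₁ (p , q)) = inj₂ (q , p)
  flip-edge (inj₂ (p , q)) = inj₁ (q , p)
special-swap (inj₂ (inj₁ (inj₁ (p , q)))) = inj₂ (inj₁ (inj₂ (q , p)))
special-swap (inj₂ (inj₁ (inj₂ (p , q)))) = inj₂ (inj₁ (inj₁ (q , p)))
special-swap (inj₂ (inj₂ (inj₁ (inj₁ (p , q))))) = inj₂ (inj₂ (inj₁ (inj₂ (q , p))))
special-swap (inj₂ (inj₂ (inj₁ (inj₂ (p , q))))) = inj₂ (inj₂ (inj₁ (inj₁ (q , p))))
special-swap (inj₂ (inj₂ (inj₂ (inj₁ (p , q))))) = inj₂ (inj₂ (inj₂ (inj₂ (q , p))))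
special-swap (inj₂ (inj₂ (inj₂ (inj₂ (p , q))))) = inj₂ (inj₂ (inj₂ (inj₁ (q , p))))

module Final (κ m : ℕ) (m≥ : proj₁ (edges-bad κ) ≤ m) where
  k n d : ℕ
  k = suc κ
  n = width k + m
  d = suc (ev k)

  Γ : Cx
  Γ = Δ d n

  R : Rep n (width k) Γ (Δc k m)
  R = repΔ k m

  sym-Δ : ∀ c → Δc k m (flip c) ≡ Δc k m c
  sym-Δ = sphere-flip (width k) (pre k (suc k)) m

  Nb Sym : ℤ → ℤ → Set
  Nb a b  = ∀ S → length S ≤ k → All (InVMinus n a b) S → pairless S → In n (Δc k m) (a ∷ b ∷ S)
  Sym a b = ∀ σ → All (λ v → (v ≢ a) × (v ≢ b)) σ → In n (Δc k m) (a ∷ b ∷ σ) → In n (Δc k m) (a ∷ b ∷ negF σ)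

  In-unneg₂ : ∀ {a b σ} → In n (Δc k m) (a ∷ b ∷ negF σ) → In n (Δc k m) (- a ∷ - b ∷ σ)
  In-unneg₂ {a} {b} {σ} x = subst (λ τ → In n (Δc k m) (- a ∷ - b ∷ τ)) (negF-invol σ) (In-neg sym-Δ x)

  In-neg₂ : ∀ {a b σ} → In n (Δc k m) (- a ∷ - b ∷ σ) → In n (Δc k m) (a ∷ b ∷ negF σ)
  In-neg₂ {a} {b} {σ} x = subst₂ (λ a b → In n (Δc k m) (a ∷ b ∷ negF σ)) (neg-involutive a) (neg-involutive b) (In-neg sym-Δ x)

  Nb-neg : ∀ {a b} → Nb a b → Nb (- a) (- b)
  Nb-neg {a} {b} N S h w p = In-unneg₂ (N (negF S) (subst (_≤ k) (sym (length-map -_ S)) h)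
    (All.map⁺ (All.map (λ x → subst₂ (λ a b → InVMinus n a b _) (neg-involutive a) (neg-involutive b) (away-neg x)) w))
    (pairless-neg S p))

  Sym-neg : ∀ {a b} → Sym a b → Sym (- a) (- b)
  Sym-neg {a} {b} H σ w x = In-unneg₂ (H (negF σ)
    (All.map⁺ (All.map (λ { (h , h′) → (λ e → h (neg-≡ e)) , (λ e → h′ (neg-≡ e)) }) w)) (In-neg₂ x))

  special-elim : ∀ {a b} (P : ℤ → ℤ → Set) → (∀ {a b} → P a b → P b a) → (∀ {a b} → P a b → P (- a) (- b)) →
    P (+ 1) (+ 2) → P (+ (n ∸ 1)) (+ n) → SpecialEdge n a b → P a b
  special-elim P sw ng x y (inj₁ (inj₁ (refl , refl)))               = x
  special-elim P sw ng x y (inj₁ (inj₂ (refl , refl)))               = sw x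
  special-elim P sw ng x y (inj₂ (inj₁ (inj₁ (refl , refl))))        = ng x
  special-elim P sw ng x y (inj₂ (inj₁ (inj₂ (refl , refl))))        = sw (ng x)
  special-elim P sw ng x y (inj₂ (inj₂ (inj₁ (inj₁ (refl , refl))))) = y
  special-elim P sw ng x y (inj₂ (inj₂ (inj₁ (inj₂ (refl , refl))))) = sw y
  special-elim P sw ng x y (inj₂ (inj₂ (inj₂ (inj₁ (refl , refl))))) = ng y
  special-elim P sw ng x y (inj₂ (inj₂ (inj₂ (inj₂ (refl , refl))))) = sw (ng y)

  special-Nb : ∀ {a b} → SpecialEdge n a b → Nb a b
  special-Nb = special-elim Nb (λ N S h w p → In-swap (N S h (All.map away-swap w) p)) Nb-neg
    (Special.bottom-face κ m) (Special.top-face κ m)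

  special-Sym : ∀ {a b} → SpecialEdge n a b → Sym a b
  special-Sym = special-elim Sym
    (λ H σ w x → In-swap (H σ (All.map (λ { (p , q) → q , p }) w) (In-swap x))) Sym-neg
    (Special.bottom-sym κ m) (Special.top-sym κ m)

  link-face : ∀ {a b S} → All (InVMinus n a b) S → In n (Δc k m) (a ∷ b ∷ S) → InLk a b Γ S
  link-face w x = (λ a∈ → proj₁ (proj₂ (All.lookup w a∈)) refl) , (λ b∈ → proj₁ (proj₂ (proj₂ (All.lookup w b∈))) refl) , In⇒∈ᶜ R x

  -- No facet contains antipodes. This keeps a and b out of -σ, as membership in the link requires.
  opposite : ∀ {a b σ} → In n (Δc k m) (a ∷ b ∷ σ) → All (λ v → (- v ≢ a) × (- v ≢ b)) σ
  opposite (F , _ , _ , x ∷ y ∷ z) = All.map (λ {v} v∈ →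
    (λ { refl → ∉-neg F v∈ x }) , (λ { refl → ∉-neg F v∈ y })) z

  neg-fresh : ∀ {c : ℤ} {σ} → All (λ v → - v ≢ c) σ → c ∉ negF σ
  neg-fresh {c} w c∈ = All.lookup (All.map⁺ {P = λ u → u ≢ c} w) c∈ refl

  special-symmetric : ∀ {a b} → SpecialEdge n a b → CentrallySymmetric (InLk a b Γ)
  special-symmetric {a} {b} s σ (a∉ , b∉ , x) = neg-fresh (All.map proj₁ o) , neg-fresh (All.map proj₂ o) ,
    In⇒∈ᶜ R (special-Sym s σ (All.tabulate (λ v∈ → (λ { refl → a∉ v∈ }) , (λ { refl → b∉ v∈ }))) (∈ᶜ⇒In R x))
    where
    o : All (λ v → (- v ≢ a) × (- v ≢ b)) σ
    o = opposite (∈ᶜ⇒In R x)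

  special⊎bad⁺ : ∀ M v → 1 ≤ ∣ v ∣ → ∣ v ∣ < M → M ≤ n → SpecialEdge n (+ M) v ⊎ Bad k m (+ M) v
  special⊎bad⁺ M v p q r with M ≟ 2 | v ℤ.≟ + 1 | M ≟ n | v ℤ.≟ + (M ∸ 1)
  ... | yes e | yes e′ | _     | _      = inj₁ (inj₁ (inj₂ (cong (λ z → + z) e , e′)))
  ... | _     | _      | yes e | yes e′ = inj₁ (inj₂ (inj₂ (inj₁ (inj₂ (cong (λ z → + z) e , trans e′ (cong (λ z → + (z ∸ 1)) e))))))
  ... | no ne | _      | no ne′ | _     = inj₂ (proj₂ (edges-bad κ) m m≥ M v p q r (ne ∘ proj₁) (ne′ ∘ proj₁))
  ... | no ne | _      | _ | no ne′     = inj₂ (proj₂ (edges-bad κ) m m≥ M v p q r (ne ∘ proj₁) (ne′ ∘ proj₂))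
  ... | _ | no ne      | no ne′ | _     = inj₂ (proj₂ (edges-bad κ) m m≥ M v p q r (ne ∘ proj₂) (ne′ ∘ proj₁))
  ... | _ | no ne      | _ | no ne′     = inj₂ (proj₂ (edges-bad κ) m m≥ M v p q r (ne ∘ proj₂) (ne′ ∘ proj₂))

  special-neg : ∀ {a b} → SpecialEdge n a b → SpecialEdge n (- a) (- b)
  special-neg (inj₁ (inj₁ (refl , refl)))               = inj₂ (inj₁ (inj₁ (refl , refl)))
  special-neg (inj₁ (inj₂ (refl , refl)))               = inj₂ (inj₁ (inj₂ (refl , refl)))
  special-neg (inj₂ (inj₁ (inj₁ (refl , refl))))        = inj₁ (inj₁ (refl , refl))
  special-neg (inj₂ (inj₁ (inj₂ (refl , refl))))        = inj₁ (inj₂ (refl , refl))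
  special-neg (inj₂ (inj₂ (inj₁ (inj₁ (refl , refl))))) = inj₂ (inj₂ (inj₂ (inj₁ (refl , refl))))
  special-neg (inj₂ (inj₂ (inj₁ (inj₂ (refl , refl))))) = inj₂ (inj₂ (inj₂ (inj₂ (refl , refl))))
  special-neg (inj₂ (inj₂ (inj₂ (inj₁ (refl , refl))))) = inj₂ (inj₂ (inj₁ (inj₁ (refl , refl))))
  special-neg (inj₂ (inj₂ (inj₂ (inj₂ (refl , refl))))) = inj₂ (inj₂ (inj₁ (inj₂ (refl , refl))))

  special⊎bad< : ∀ a b → 1 ≤ ∣ b ∣ → ∣ b ∣ < ∣ a ∣ → ∣ a ∣ ≤ n → SpecialEdge n a b ⊎ Bad k m a b
  special⊎bad< (+ M)    b p q r = special⊎bad⁺ M b p q r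
  special⊎bad< -[1+ i ] b p q r with special⊎bad⁺ (suc i) (- b) (subst (1 ≤_) (sym (∣-i∣≡∣i∣ b)) p)
    (subst (_< suc i) (sym (∣-i∣≡∣i∣ b)) q) r
  ... | inj₁ s = inj₁ (subst (SpecialEdge n -[1+ i ]) (neg-involutive b) (special-neg s))
  ... | inj₂ s = inj₂ (subst (Bad k m -[1+ i ]) (neg-involutive b) (Bad-neg s))

  special⊎bad : ∀ a b → a ≢ b → a ≢ - b → InV n a → InV n b → SpecialEdge n a b ⊎ Bad k m a b
  special⊎bad a b ne ne′ (p , q) (p′ , q′) with <-cmp ∣ a ∣ ∣ b ∣
  ... | tri> _ _ h = special⊎bad< a b p′ h q
  ... | tri≈ _ e _ with ∣∣-≡ a b e
  ...   | inj₁ x = ⊥-elim (ne x)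
  ...   | inj₂ x = ⊥-elim (ne′ x)
  special⊎bad a b ne ne′ (p , q) (p′ , q′) | tri< h _ _ with special⊎bad< b a p h q′
  ... | inj₁ s = inj₁ (special-swap {n} s)
  ... | inj₂ s = inj₂ (Bad-swap s)

  claim : Claim k d n
  claim = (λ a b ne a∈ b∈ e → mk⇔ (only a b ne a∈ b∈ e)
      (λ s S h w p → link-face w (special-Nb s S h w p))) ,
    (λ a b s → In⇒∈ᶜ R (special-Nb s [] z≤n [] (λ v ())) , special-symmetric s)
    where
    only : ∀ a b → a ≢ b → InV n a → InV n b → (a ∷ b ∷ []) ∈ᶜ Γ →
      CsNeighborly k (InVMinus n a b) (InLk a b Γ) → SpecialEdge n a b
    only a b ne a∈ b∈ e H with special⊎bad a b ne ne′ a∈ b∈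
      where
      ne′ : a ≢ - b
      ne′ a≡ with ∈ᶜ⇒In R e
      ... | F , _ , _ , x ∷ y ∷ [] = ∉-neg F y (subst (_∈ toF F) a≡ x)
    ... | inj₁ s = s
    ... | inj₂ (bad S h w p x) = ⊥-elim (x (∈ᶜ⇒In R (proj₂ (proj₂ (H S h w p)))))

dimension : ∀ κ → 2 * suc (suc κ) ∸ 1 ≡ suc (ev (suc κ))
dimension κ = cong suc (trans (cong (λ z → κ + z) (cong (λ z → 2 + z) (+-identityʳ κ))) (double κ))
  where
  double : ∀ κ → κ + suc (suc κ) ≡ ev (suc κ)
  double zero    = refl
  double (suc κ) = cong suc (trans (+-suc κ (suc (suc κ))) (cong suc (double κ)))

theorem5p5 : (k : ℕ) → 2 ≤ k → ∃[ N ] ((n : ℕ) → N ≤ n →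
    ((a b : ℤ) → a ≢ b → InV n a → InV n b → (a ∷ b ∷ []) ∈ᶜ Δ (2 * k ∸ 1) n →
    (CsNeighborly (k ∸ 1) (InVMinus n a b) (InLk a b (Δ (2 * k ∸ 1) n)) ⇔ SpecialEdge n a b))
    × ((a b : ℤ) → SpecialEdge n a b →
    ((a ∷ b ∷ []) ∈ᶜ Δ (2 * k ∸ 1) n) × CentrallySymmetric (InLk a b (Δ (2 * k ∸ 1) n))))
-- Here `width (suc κ)` is d + 1, which converts the bound on m into one on n = d + 1 + m.
theorem5p5 (suc (suc κ)) (s≤s (s≤s z≤n)) = width (suc κ) + proj₁ (edges-bad κ) , λ n h → large n h
  where
  large : ∀ n → width (suc κ) + proj₁ (edges-bad κ) ≤ n → Claim (suc κ) (2 * suc (suc κ) ∸ 1) n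
  large n h with m≤n⇒∃[o]m+o≡n h
  ... | o , refl = subst₂ (Claim (suc κ)) (sym (dimension κ)) (sym (+-assoc (width (suc κ)) _ o))
    (Final.claim κ (proj₁ (edges-bad κ) + o) (m≤m+n _ o))
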